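{- For every $\alpha,\gamma\in(0,1/4)$ there exists $n_0$ such that the following holds for every integer $n\ge n_0$. Let $H$ be a $3$-graph on $n$ vertices such that \[ e(H)\ge \max\left\{\binom{4\alpha n}{3},\ \binom{n}{3}-\binom{n-\alpha n}{3}\right\}+\gamma n^3. \] Then $H$ contains a $Y_{3,2}$-tiling covering more than $4\alpha n$ vertices.
   Context: A $3$-graph $H$ consists of a vertex set $V$ and an edge set $E\subseteq\binom{V}{3}$; $e(H)=|E|$. $Y_{3,2}$ is the $3$-graph consisting of two edges intersecting in exactly two vertices (so it has $4$ vertices). A $Y_{3,2}$-tiling of $H$ is a family of vertex-disjoint copies of $Y_{3,2}$ in $H$; it covers the vertices of all its copies. Binomial coefficients $\binom{x}{3}$ with non-integer $x$ denote $x(x-1)(x-2)/6$.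
   Formalization: The parameters α and γ range over the rational numbers in (0,1/4) instead of all real numbers in (0,1/4). -}

module Defs where

open import Data.Bool using (Bool; true; false)
open import Data.Nat as ℕ using (ℕ)
open import Data.Fin using (Fin; toℕ)
open import Data.Integer using (+_)
open import Data.Rational using (ℚ; _/_; _*_; _-_; _+_)
open import Data.List using (List; []; _∷_; length; filter; concatMap; allFin; map)
open import Data.List.Relation.Unary.Unique.Propositional using (Unique)
open import Data.Product using (_×_; _,_; Σ)
open import Relation.Binary.PropositionalEquality using (_≡_; _≢_)
open import Relation.Nullary using (¬_)
open import Relation.Nullary.Decidable using (_×-dec_)
open import Data.Bool.Properties using () renaming (_≟_ to _≟B_)

record ThreeGraph (n : ℕ) : Set where
  field
    edge     : Fin n → Fin n → Fin n → Bool
    sym₁₂    : ∀ a b c → edge a b c ≡ edge b a c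
    sym₂₃    : ∀ a b c → edge a b c ≡ edge a c b
    distinct : ∀ a b c → edge a b c ≡ true → (a ≢ b) × (b ≢ c) × (a ≢ c)
open ThreeGraph public

triples : (n : ℕ) → List (Fin n × Fin n × Fin n)
triples n = concatMap (λ i → concatMap (λ j → map (λ k → (i , j , k)) (allFin n)) (allFin n)) (allFin n)

e : {n : ℕ} → ThreeGraph n → ℕ
e {n} H = length (filter (λ { (i , j , k) →
            ((toℕ i ℕ.<? toℕ j) ×-dec (toℕ j ℕ.<? toℕ k)) ×-dec (edge H i j k ≟B true) })
          (triples n))

ℕ→ℚ : ℕ → ℚ
ℕ→ℚ m = + m / 1

choose3 : ℚ → ℚ
choose3 x = x * (x - ℕ→ℚ 1) * (x - ℕ→ℚ 2) * (+ 1 / 6)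

record Y32 {n : ℕ} (H : ThreeGraph n) : Set where
  field
    a b c d : Fin n
    vertsDistinct : Unique (a ∷ b ∷ c ∷ d ∷ [])
    edge₁ : edge H a b c ≡ true
    edge₂ : edge H a b d ≡ true
open Y32 public

Y32-vertices : {n : ℕ} {H : ThreeGraph n} → Y32 H → List (Fin n)
Y32-vertices Y = a Y ∷ b Y ∷ c Y ∷ d Y ∷ []

record Tiling {n : ℕ} (H : ThreeGraph n) : Set where
  field
    copies   : List (Y32 H)
    disjoint : Unique (concatMap Y32-vertices copies)
open Tiling public

covered : {n : ℕ} {H : ThreeGraph n} → Tiling H → ℕ
covered T = length (concatMap Y32-vertices (copies T))

{-# OPTIONS --safe #-}
-- Let T be a tiling with m ≤ α n copies and let U be the set of u = n − 4 m uncovered vertices. If T cannot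
-- be enlarged, then U spans at most n² ordered edges, and the remaining edges are governed by which
-- vertices of the copies have dense links in U, which pairs of vertices have large codegree into U, and
-- which triples are edges. For a triple of copies this is a finite pattern. By linear programming duality
-- (Fourier–Motzkin elimination), a pattern either admits vertex weights under which every copy weighs at
-- most 1 and every Y₃₂ that can be built in a blow-up of the pattern weighs at least 1, or some blow-up
-- of it contains more disjoint Y₃₂ than copies. Patterns of the second kind occur in o(n³) triples only, since
-- a positive proportion would contain a complete tripartite family of copies with one common pattern
-- (Kővári–Sós–Turán), and T could be enlarged there. Patterns of the first kind contribute at most
-- max (64 m², 3 u² + 21 u m + 37 m²) each, attained by a clique on the copies and by a cover with
-- one vertex in every copy. Summing over all triples of copies gives
-- 6 e(H) ≤ max ((4m)³, n³ − (n − m)³) + o(n³), contradicting the hypothesis on e(H).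

module Submission where

open import Defs
open import Data.Bool using (Bool; T; _∧_; _∨_; false; not; true)
open import Data.Bool.Properties using (T-∧; T-≡; T?) renaming (_≟_ to _≟B_)
open import Data.Empty using (⊥; ⊥-elim)
open import Data.Fin using (Fin; combine; punchIn; remQuot; suc; toℕ; zero)
open import Data.Fin.Properties using (all?; any?; combine-remQuot; punchInᵢ≢i; remQuot-combine) renaming (_≟_ to _≟F_)
open import Data.List using (List; []; _++_; _∷_; allFin; cartesianProduct; cartesianProductWith; concat; concatMap; filter; length; lookup; map; replicate; take; upTo)
import Data.List.Membership.DecPropositional as DecMembership
open import Data.List.Membership.Propositional using (_∈_; _∉_; lose)
open import Data.List.Membership.Propositional.Properties
open import Data.List.Properties using (length-++; length-map; length-tabulate; length-take; length-upTo; map-∘; ∷-injectiveʳ; ∷-injectiveˡ)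
open import Data.List.Relation.Binary.Disjoint.Propositional using (Disjoint)
open import Data.List.Relation.Unary.All as All using (All; []; _∷_)
import Data.List.Relation.Unary.All.Properties as All
open import Data.List.Relation.Unary.AllPairs as AllPairs using (AllPairs; []; _∷_)
import Data.List.Relation.Unary.AllPairs.Properties as AllPairs
open import Data.List.Relation.Unary.Any using (here; there)
open import Data.List.Relation.Unary.Unique.Propositional using (Unique)
import Data.List.Relation.Unary.Unique.Propositional.Properties as Unique
open import Data.Product using (_,_; _×_; proj₁; proj₂; Σ; ∃-syntax)
open import Data.Sum as Sum using (_⊎_; inj₁; inj₂)
open import Data.Unit using (tt)
open import Data.Vec as Vec using (Vec; []; _∷_; head; tail)
import Data.Vec.Properties as Vec
open import Function using (Equivalence; _∘_)
open import Relation.Binary.PropositionalEquality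
open import Relation.Nullary using (Dec; does; no; yes; ¬_)
open import Relation.Nullary.Decidable using (_×-dec_; dec-true; dec⇒maybe; from-yes; ¬?)

-- An edge meets at most three copies, so patterns on triples of copies see every edge whole, and
-- only finitely many patterns occur. They are far too many to treat one by one; duality replaces
-- the case analysis. The weights of the first alternative turn the count of edges into elementary
-- inequalities about three weight vectors of length four. A certificate for the second alternative
-- has natural multiplicities, which already are the recipe: so many copies to give up in each
-- class, so many `Y32` to build. Such a recipe may ask for several copies of the same class, which
-- is why a single triple is not enough and a blow-up is needed. Uncovered vertices carry no weight:
-- links of size `n * n / K` and codegrees of size `n / K` outlast the deletion of boundedly many
-- vertices. Natural numbers are used up to the final comparison, with all densities multiplied out
-- by `K`. The tiling is not chosen maximum; each augmentation restarts the count from the new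
-- tiling, so that errors do not accumulate.

module Sums where
  open import Data.Nat using (ℕ; _+_; _*_; _≤_; z≤n; s≤s)
  open import Data.Nat.Properties
  open import Data.Nat.Tactic.RingSolver using (solve-∀)

  -- A linear inequality l ≤ r follows from A ≤ B once r + A exceeds l + B by a visible term.
  lin : ∀ {A B l r : ℕ} s → A ≤ B → l + B + s ≡ r + A → l ≤ r
  lin {A} {B} {l} {r} s A≤B eq = +-cancelʳ-≤ B l r (begin
    l + B      ≤⟨ m≤m+n (l + B) s ⟩
    l + B + s  ≡⟨ eq ⟩
    r + A      ≤⟨ +-monoʳ-≤ r A≤B ⟩
    r + B      ∎)
    where open ≤-Reasoning

  -- Indicators and sums over lists

  ⟦_⟧ : Bool → ℕ
  ⟦ true ⟧  = 1
  ⟦ false ⟧ = 0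

  ⟦⟧≤1 : ∀ b → ⟦ b ⟧ ≤ 1
  ⟦⟧≤1 true  = s≤s z≤n
  ⟦⟧≤1 false = z≤n

  open import Algebra.Properties.CommutativeSemigroup +-commutativeSemigroup using (x∙yz≈y∙xz)

  private variable
    X Y : Set

  ∑ : List X → (X → ℕ) → ℕ
  ∑ []       f = 0
  ∑ (x ∷ xs) f = f x + ∑ xs f

  ∑-mono∈ : ∀ (xs : List X) {f g : X → ℕ} → (∀ x → x ∈ xs → f x ≤ g x) → ∑ xs f ≤ ∑ xs g
  ∑-mono∈ []       h = z≤n
  ∑-mono∈ (x ∷ xs) h = +-mono-≤ (h x (here refl)) (∑-mono∈ xs λ y y∈ → h y (there y∈))

  ∑-mono : ∀ (xs : List X) {f g : X → ℕ} → (∀ x → f x ≤ g x) → ∑ xs f ≤ ∑ xs g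
  ∑-mono xs h = ∑-mono∈ xs λ x _ → h x

  ∑-cong : ∀ (xs : List X) {f g : X → ℕ} → (∀ x → f x ≡ g x) → ∑ xs f ≡ ∑ xs g
  ∑-cong []       h = refl
  ∑-cong (x ∷ xs) h = cong₂ _+_ (h x) (∑-cong xs h)

  ∑-+ : ∀ (xs : List X) (f g : X → ℕ) → ∑ xs (λ x → f x + g x) ≡ ∑ xs f + ∑ xs g
  ∑-+ []       f g = refl
  ∑-+ (x ∷ xs) f g rewrite ∑-+ xs f g = interchange (f x) (g x) (∑ xs f) (∑ xs g)
    where
    interchange : ∀ a b c d → a + b + (c + d) ≡ a + c + (b + d)
    interchange = solve-∀

  ∑-* : ∀ c (xs : List X) (f : X → ℕ) → ∑ xs (λ x → c * f x) ≡ c * ∑ xs f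
  ∑-* c []       f = sym (*-zeroʳ c)
  ∑-* c (x ∷ xs) f rewrite ∑-* c xs f = sym (*-distribˡ-+ c (f x) (∑ xs f))

  ∑-const : ∀ c (xs : List X) → ∑ xs (λ _ → c) ≡ length xs * c
  ∑-const c []       = refl
  ∑-const c (x ∷ xs) = cong (c +_) (∑-const c xs)

  ∑-zero : ∀ (xs : List X) → ∑ xs (λ _ → 0) ≡ 0
  ∑-zero []       = refl
  ∑-zero (x ∷ xs) = ∑-zero xs

  ∑-swap : ∀ (xs : List X) (ys : List Y) (f : X → Y → ℕ) →
           ∑ xs (λ x → ∑ ys (f x)) ≡ ∑ ys (λ y → ∑ xs (λ x → f x y))
  ∑-swap []       ys f = sym (∑-zero ys)
  ∑-swap (x ∷ xs) ys f = trans (cong (∑ ys (f x) +_) (∑-swap xs ys f))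
                               (sym (∑-+ ys (f x) (λ y → ∑ xs (λ x → f x y))))

  ∑-++ : ∀ (xs ys : List X) (f : X → ℕ) → ∑ (xs ++ ys) f ≡ ∑ xs f + ∑ ys f
  ∑-++ []       ys f = refl
  ∑-++ (x ∷ xs) ys f = trans (cong (f x +_) (∑-++ xs ys f)) (sym (+-assoc (f x) _ _))

  ∑-concatMap : ∀ (h : Y → List X) (ys : List Y) (f : X → ℕ) →
                ∑ (concatMap h ys) f ≡ ∑ ys (λ y → ∑ (h y) f)
  ∑-concatMap h []       f = refl
  ∑-concatMap h (y ∷ ys) f = trans (∑-++ (h y) (concatMap h ys) f) (cong (∑ (h y) f +_) (∑-concatMap h ys f))

  ∑-map : ∀ (h : Y → X) (ys : List Y) (f : X → ℕ) → ∑ (map h ys) f ≡ ∑ ys (f ∘ h)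
  ∑-map h []       f = refl
  ∑-map h (y ∷ ys) f = cong (f (h y) +_) (∑-map h ys f)

  ∑-≤const : ∀ (xs : List X) {f : X → ℕ} c → (∀ x → f x ≤ c) → ∑ xs f ≤ length xs * c
  ∑-≤const xs c h = ≤-trans (∑-mono xs h) (≤-reflexive (∑-const c xs))

  length≡∑ : ∀ (xs : List X) → length xs ≡ ∑ xs (λ _ → 1)
  length≡∑ xs = sym (trans (∑-const 1 xs) (*-identityʳ _))

  -- The entry of `ys` matched with the head of `xs` is cut out before the tail is treated;
  -- uniqueness of `xs` keeps the tail inside what remains.
  ∑-⊆ : ∀ {xs ys : List X} (f : X → ℕ) → Unique xs → (∀ {x} → x ∈ xs → x ∈ ys) → ∑ xs f ≤ ∑ ys f
  ∑-⊆ {xs = []}     f _          _   = z≤n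
  ∑-⊆ {xs = x ∷ xs} f (x≢ ∷ uxs) sub with ∈-∃++ (sub (here refl))
  ... | as , bs , refl = begin
    f x + ∑ xs f                  ≤⟨ +-monoʳ-≤ (f x) (∑-⊆ f uxs sub′) ⟩
    f x + ∑ (as ++ bs) f          ≡⟨ cong (f x +_) (∑-++ as bs f) ⟩
    f x + (∑ as f + ∑ bs f)       ≡⟨ x∙yz≈y∙xz (f x) (∑ as f) (∑ bs f) ⟩
    ∑ as f + (f x + ∑ bs f)       ≡⟨ ∑-++ as (x ∷ bs) f ⟨
    ∑ (as ++ x ∷ bs) f            ∎
    where
    open ≤-Reasoning
    sub′ : ∀ {y} → y ∈ xs → y ∈ as ++ bs
    sub′ y∈ with ∈-++⁻ as (sub (there y∈))
    ... | inj₁ y∈as         = ∈-++⁺ˡ y∈as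
    ... | inj₂ (here refl)  = ⊥-elim (All.lookup x≢ y∈ refl)
    ... | inj₂ (there y∈bs) = ∈-++⁺ʳ as y∈bs

  length-allFin : ∀ n → length (allFin n) ≡ n
  length-allFin n = length-tabulate (λ i → i)

  Unique⇒length≤ : ∀ {n} {xs : List (Fin n)} → Unique xs → length xs ≤ n
  Unique⇒length≤ {n} {xs} u = begin
    length xs                ≡⟨ length≡∑ xs ⟩
    ∑ xs (λ _ → 1)           ≤⟨ ∑-⊆ _ u (λ _ → ∈-allFin _) ⟩
    ∑ (allFin n) (λ _ → 1)   ≡⟨ length≡∑ (allFin n) ⟨
    length (allFin n)        ≡⟨ length-allFin n ⟩
    n                        ∎
    where open ≤-Reasoning

  filterT : (X → Bool) → List X → List X
  filterT p = filter (T? ∘ p)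

  ∑-filter : ∀ (p : X → Bool) (xs : List X) (f : X → ℕ) → ∑ (filterT p xs) f ≡ ∑ xs (λ x → ⟦ p x ⟧ * f x)
  ∑-filter p []       f = refl
  ∑-filter p (x ∷ xs) f with p x
  ... | true  = cong₂ _+_ (sym (+-identityʳ (f x))) (∑-filter p xs f)
  ... | false = ∑-filter p xs f

  length-filterT : ∀ (p : X → Bool) (xs : List X) → length (filterT p xs) ≡ ∑ xs (λ x → ⟦ p x ⟧)
  length-filterT p xs = trans (length≡∑ (filterT p xs))
    (trans (∑-filter p xs _) (∑-cong xs λ x → *-identityʳ _))

-- Complete tripartite families in dense ternary relations

module DenseTripartite where
  open Sums

  open import Data.Nat using (ℕ; zero; suc; _+_; _*_; _^_; _≤_; _<_; _⊓_; z≤n; s≤s; _≤ᵇ_; _≤?_; NonZero; >-nonZero)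
  open import Data.Nat.Properties
  open import Data.Nat.Tactic.RingSolver using (solve-∀)

  private variable
    X Y Z : Set

  -- Fibres with `f z < B / (2 * k)` carry at most half of the guaranteed total, so the others carry
  -- the rest at no more than `B` each. The inequalities are multiplied out to avoid division.
  dense-fibres : ∀ (zs : List Z) (f : Z → ℕ) B k .{{_ : NonZero B}} → (∀ z → f z ≤ B) →
                 length zs * B ≤ k * ∑ zs f →
                 length zs ≤ 2 * k * length (filterT (λ z → B ≤ᵇ 2 * k * f z) zs)
  dense-fibres {Z} zs f B k f≤B dense =
    subst (λ g → length zs ≤ 2 * k * g) (sym (length-filterT good zs))
      (*-cancelʳ-≤ _ _ B (lin 0 (≤-trans (*-monoʳ-≤ 2 dense) (≤-trans (≤-reflexive (sym (*-assoc 2 k _))) total))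
        (rearrange (length zs) B (2 * k) (∑ zs (λ z → ⟦ good z ⟧)))))
    where
    good : Z → Bool
    good z = B ≤ᵇ 2 * k * f z

    pointwise : ∀ z → 2 * k * f z ≤ 2 * k * B * ⟦ good z ⟧ + B
    pointwise z with good z in eq
    ... | true  = ≤-trans (*-monoʳ-≤ (2 * k) (f≤B z))
                    (≤-trans (≤-reflexive (sym (*-identityʳ _))) (m≤m+n _ B))
    ... | false = ≤-trans (≰⇒≥ λ B≤ → subst T eq (≤⇒≤ᵇ B≤)) (m≤n+m B _)

    total : 2 * k * ∑ zs f ≤ 2 * k * B * ∑ zs (λ z → ⟦ good z ⟧) + length zs * B
    total = begin
      2 * k * ∑ zs f                                   ≡⟨ ∑-* (2 * k) zs f ⟨
      ∑ zs (λ z → 2 * k * f z)                         ≤⟨ ∑-mono zs pointwise ⟩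
      ∑ zs (λ z → 2 * k * B * ⟦ good z ⟧ + B)          ≡⟨ ∑-+ zs _ _ ⟩
      ∑ zs (λ z → 2 * k * B * ⟦ good z ⟧) + ∑ zs (λ _ → B)
                                                       ≡⟨ cong₂ _+_ (∑-* (2 * k * B) zs _) (∑-const B zs) ⟩
      2 * k * B * ∑ zs (λ z → ⟦ good z ⟧) + length zs * B ∎
      where open ≤-Reasoning

    rearrange : ∀ l B k g → l * B + (k * B * g + l * B) + 0 ≡ k * g * B + 2 * (l * B)
    rearrange = solve-∀

  -- One bit of the colour is fixed at a time, keeping the value taken more often, so each of the
  -- `N` steps costs a factor 2. The class is returned as a predicate below `p`, the form in which
  -- the density arguments use it.
  pigeonhole : ∀ N (f : Y → Vec Bool N) (ys : List Y) (p : Y → Bool) →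
    Σ (Vec Bool N) λ c → Σ (Y → Bool) λ q →
      (∀ y → T (q y) → T (p y) × f y ≡ c) × ∑ ys (λ y → ⟦ p y ⟧) ≤ 2 ^ N * ∑ ys (λ y → ⟦ q y ⟧)
  pigeonhole zero f ys p = [] , p , (λ y py → py , empty (f y)) , ≤-reflexive (sym (+-identityʳ _))
    where
    empty : (v : Vec Bool 0) → v ≡ []
    empty [] = refl
  pigeonhole {Y} (suc N) f ys p = choose (∑p₁ ≤? ∑p₀)
    where
    p₁ p₀ : Y → Bool
    p₁ y = p y ∧ head (f y)
    p₀ y = p y ∧ not (head (f y))

    ∑p₁ ∑p₀ : ℕ
    ∑p₁ = ∑ ys (λ y → ⟦ p₁ y ⟧)
    ∑p₀ = ∑ ys (λ y → ⟦ p₀ y ⟧)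

    split : ∀ b c → ⟦ b ⟧ ≡ ⟦ b ∧ c ⟧ + ⟦ b ∧ not c ⟧
    split true  true  = refl
    split true  false = refl
    split false _     = refl

    halves : ∑ ys (λ y → ⟦ p y ⟧) ≡ ∑p₁ + ∑p₀
    halves = trans (∑-cong ys λ y → split (p y) (head (f y))) (∑-+ ys _ _)

    Result : Set
    Result = Σ (Vec Bool (suc N)) λ c → Σ (Y → Bool) λ q →
      (∀ y → T (q y) → T (p y) × f y ≡ c) × ∑ ys (λ y → ⟦ p y ⟧) ≤ 2 ^ suc N * ∑ ys (λ y → ⟦ q y ⟧)

    recurse : ∀ b (p′ : Y → Bool) → (∀ y → T (p′ y) → T (p y) × head (f y) ≡ b) →
              ∑ ys (λ y → ⟦ p y ⟧) ≤ 2 * ∑ ys (λ y → ⟦ p′ y ⟧) → Result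
    recurse b p′ sub half with pigeonhole N (tail ∘ f) ys p′
    ... | c , q , q⇒ , bound = b ∷ c , q ,
          (λ y qy → proj₁ (sub y (proj₁ (q⇒ y qy))) ,
                    glue (f y) (proj₂ (sub y (proj₁ (q⇒ y qy)))) (proj₂ (q⇒ y qy))) ,
          ≤-trans half (≤-trans (*-monoʳ-≤ 2 bound) (≤-reflexive (sym (*-assoc 2 (2 ^ N) _))))
      where
      glue : (v : Vec Bool (suc N)) → head v ≡ b → tail v ≡ c → v ≡ b ∷ c
      glue (_ ∷ _) refl refl = refl

    T-not : ∀ b → T (not b) → b ≡ false
    T-not false _ = refl

    choose : Dec (∑p₁ ≤ ∑p₀) → Result
    choose (yes p₁≤p₀) = recurse false p₀
      (λ y t → let py , hy = Equivalence.to T-∧ t in py , T-not _ hy)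
      (≤-trans (≤-reflexive halves) (lin 0 p₁≤p₀ (double ∑p₁ ∑p₀)))
      where
      double : ∀ a b → a + b + b + 0 ≡ 2 * b + a
      double = solve-∀
    choose (no p₁≰p₀) = recurse true p₁
      (λ y t → let py , hy = Equivalence.to T-∧ t in py , Equivalence.to T-≡ hy)
      (≤-trans (≤-reflexive halves) (lin 0 (≰⇒≥ p₁≰p₀) (double ∑p₁ ∑p₀)))
      where
      double : ∀ a b → a + b + a + 0 ≡ 2 * a + b
      double = solve-∀

  ∑⟦⟧>0⇒∃ : ∀ (ys : List Y) (p : Y → Bool) → 0 < ∑ ys (λ y → ⟦ p y ⟧) → ∃[ y ] y ∈ ys × T (p y)
  ∑⟦⟧>0⇒∃ (y ∷ ys) p h with p y in eq
  ... | true  = y , here refl , Equivalence.from T-≡ eq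
  ... | false with ∑⟦⟧>0⇒∃ ys p h
  ...   | z , z∈ , pz = z , there z∈ , pz

  -- The trace of `p` on `xs` as a bit vector, so that `pigeonhole` can sort columns by the set of
  -- kept rows that they meet.
  memberships : (xs : List X) → (X → Bool) → Vec Bool (length xs)
  memberships []       p = []
  memberships (x ∷ xs) p = p x ∷ memberships xs p

  memberships-injective : ∀ (xs : List X) {p q : X → Bool} → memberships xs p ≡ memberships xs q →
                          ∀ {x} → x ∈ xs → p x ≡ q x
  memberships-injective (x ∷ xs) eq (here refl) = cong head eq
  memberships-injective (x ∷ xs) eq (there x∈)  = memberships-injective xs (cong tail eq) x∈

  -- The density lost in one step: `2 * (2 * k)` by the averaging over columns, and the power of 2
  -- by the choice of one set of rows among the subsets of `2 * (2 * k) * s` kept rows.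
  blowup : ℕ → ℕ → ℕ
  blowup k s = 2 * (2 * k) * 2 ^ (2 * (2 * k) * s)

  *>0⇒>0 : ∀ m {n} → 0 < m * n → 0 < n
  *>0⇒>0 m {zero}  h = subst (0 <_) (*-zeroʳ m) h
  *>0⇒>0 m {suc n} h = s≤s z≤n

  -- One step of the Kővári–Sós–Turán argument: only boundedly many dense rows are kept, so that
  -- the columns can be classified by the exact set of kept rows that they meet.
  popular-rows : ∀ (xs : List X) (ys : List Y) (R : X → Y → Bool) k s .{{_ : NonZero k}} →
    Unique xs → 0 < s → 0 < length ys →
    length xs * length ys ≤ k * ∑ xs (λ x → ∑ ys (λ y → ⟦ R x y ⟧)) →
    2 * k * (2 * (2 * k) * s) ≤ length xs →
    Σ (List X) λ xs′ → Σ (Y → Bool) λ q → Unique xs′ × s ≤ length xs′ × (∀ x → x ∈ xs′ → x ∈ xs) ×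
      (∀ x y → x ∈ xs′ → T (q y) → T (R x y)) ×
      length ys ≤ blowup k s * ∑ ys (λ y → ⟦ q y ⟧)
  popular-rows {X} {Y} xs ys R k s ux s>0 ys>0 dense large =
    conclude (pigeonhole N (λ y → subst (Vec Bool) len (memberships rows (λ x → R x y))) ys popular)
    where
    instance
      nz-2k : NonZero (2 * k)
      nz-2k = m*n≢0 2 k
      nz-4k : NonZero (2 * (2 * k))
      nz-4k = m*n≢0 2 (2 * k)
      nz-ys : NonZero (length ys)
      nz-ys = >-nonZero ys>0
      nz-s : NonZero s
      nz-s = >-nonZero s>0

    -- Chosen so that a popular column meets at least `N / (2 * (2 * k)) = s` of the `N` kept rows.
    N : ℕ
    N = 2 * (2 * k) * s

    instance
      nz-N : NonZero N
      nz-N = m*n≢0 (2 * (2 * k)) s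

    rowSize : X → ℕ
    rowSize x = ∑ ys (λ y → ⟦ R x y ⟧)

    rowSize≤ : ∀ x → rowSize x ≤ length ys
    rowSize≤ x = ≤-trans (∑-≤const ys 1 (λ y → ⟦⟧≤1 (R x y))) (≤-reflexive (*-identityʳ _))

    isDense : X → Bool
    isDense x = length ys ≤ᵇ 2 * k * rowSize x

    denseRows : List X
    denseRows = filterT isDense xs

    N≤dense : N ≤ length denseRows
    N≤dense = *-cancelˡ-≤ (2 * k) (≤-trans large (dense-fibres xs rowSize (length ys) k rowSize≤ dense))

    rows : List X
    rows = take N denseRows

    len : length rows ≡ N
    len = trans (length-take N denseRows) (m≤n⇒m⊓n≡m N≤dense)

    ∈take : ∀ {x} n (zs : List X) → x ∈ take n zs → x ∈ zs
    ∈take (suc n) (z ∷ zs) (here eq)  = here eq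
    ∈take (suc n) (z ∷ zs) (there x∈) = there (∈take n zs x∈)

    row-∈ : ∀ {x} → x ∈ rows → x ∈ xs × T (isDense x)
    row-∈ x∈ = ∈-filter⁻ (T? ∘ isDense) (∈take N denseRows x∈)

    degree : Y → ℕ
    degree y = ∑ rows (λ x → ⟦ R x y ⟧)

    degree≤ : ∀ y → degree y ≤ N
    degree≤ y = ≤-trans (∑-≤const rows 1 (λ x → ⟦⟧≤1 (R x y))) (≤-reflexive (trans (*-identityʳ _) len))

    popular : Y → Bool
    popular y = N ≤ᵇ 2 * (2 * k) * degree y

    dense′ : length ys * N ≤ 2 * k * ∑ ys degree
    dense′ = begin
      length ys * N                         ≡⟨ *-comm (length ys) N ⟩
      N * length ys                         ≡⟨ cong (_* length ys) len ⟨
      length rows * length ys               ≡⟨ ∑-const (length ys) rows ⟨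
      ∑ rows (λ _ → length ys)              ≤⟨ ∑-mono∈ rows (λ x x∈ → ≤ᵇ⇒≤ _ _ (proj₂ (row-∈ x∈))) ⟩
      ∑ rows (λ x → 2 * k * rowSize x)      ≡⟨ ∑-* (2 * k) rows rowSize ⟩
      2 * k * ∑ rows rowSize                ≡⟨ cong (2 * k *_) (∑-swap rows ys _) ⟩
      2 * k * ∑ ys degree                   ∎
      where open ≤-Reasoning

    Result : Set
    Result = Σ (List X) λ xs′ → Σ (Y → Bool) λ q → Unique xs′ × s ≤ length xs′ × (∀ x → x ∈ xs′ → x ∈ xs) ×
      (∀ x y → x ∈ xs′ → T (q y) → T (R x y)) ×
      length ys ≤ blowup k s * ∑ ys (λ y → ⟦ q y ⟧)

    conclude : (Σ (Vec Bool N) λ c → Σ (Y → Bool) λ q → (∀ y → T (q y) → T (popular y) × _ ≡ c) ×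
                 ∑ ys (λ y → ⟦ popular y ⟧) ≤ 2 ^ N * ∑ ys (λ y → ⟦ q y ⟧)) → Result
    conclude (c , q , q⇒ , bound) = result
      where
      size : length ys ≤ blowup k s * ∑ ys (λ y → ⟦ q y ⟧)
      size = begin
        length ys
          ≤⟨ dense-fibres ys degree N (2 * k) degree≤ dense′ ⟩
        2 * (2 * k) * length (filterT popular ys)
          ≡⟨ cong (2 * (2 * k) *_) (length-filterT popular ys) ⟩
        2 * (2 * k) * ∑ ys (λ y → ⟦ popular y ⟧)
          ≤⟨ *-monoʳ-≤ (2 * (2 * k)) bound ⟩
        2 * (2 * k) * (2 ^ N * ∑ ys (λ y → ⟦ q y ⟧))
          ≡⟨ *-assoc (2 * (2 * k)) (2 ^ N) _ ⟨
        blowup k s * ∑ ys (λ y → ⟦ q y ⟧) ∎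
        where open ≤-Reasoning

      witness : ∃[ y ] y ∈ ys × T (q y)
      witness = ∑⟦⟧>0⇒∃ ys q (*>0⇒>0 (blowup k s) (≤-trans ys>0 size))

      -- One column stands for its class: the rows `xs′` that it meets are met by every column of
      -- the class, because the traces agree, and there are at least `s` of them because it is
      -- popular.
      y₀ : Y
      y₀ = proj₁ witness

      same : ∀ y → T (q y) → memberships rows (λ x → R x y) ≡ memberships rows (λ x → R x y₀)
      same y qy = subst-injective len
        (trans (proj₂ (q⇒ y qy)) (sym (proj₂ (q⇒ y₀ (proj₂ (proj₂ witness))))))

      xs′ : List X
      xs′ = filterT (λ x → R x y₀) rows

      s≤ : s ≤ length xs′
      s≤ = subst (s ≤_) (sym (length-filterT (λ x → R x y₀) rows))
        (*-cancelˡ-≤ (2 * (2 * k)) (≤ᵇ⇒≤ _ _ (proj₁ (q⇒ y₀ (proj₂ (proj₂ witness))))))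

      in-xs′ : ∀ {x} → x ∈ xs′ → x ∈ rows × T (R x y₀)
      in-xs′ = ∈-filter⁻ (λ x → T? (R x y₀))

      result : Result
      result = xs′ , q ,
        Unique.filter⁺ (λ x → T? (R x y₀)) (Unique.take⁺ N (Unique.filter⁺ (T? ∘ isDense) ux)) ,
        s≤ ,
        (λ x x∈ → proj₁ (row-∈ (proj₁ (in-xs′ x∈)))) ,
        (λ x y x∈ qy → subst T (sym (memberships-injective rows (same y qy) (proj₁ (in-xs′ x∈))))
                               (proj₂ (in-xs′ x∈))) ,
        size

  ∑-cartesianProduct : ∀ (xs : List X) (ys : List Y) (f : X × Y → ℕ) →
                       ∑ (cartesianProduct xs ys) f ≡ ∑ xs (λ x → ∑ ys (λ y → f (x , y)))
  ∑-cartesianProduct []       ys f = refl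
  ∑-cartesianProduct (x ∷ xs) ys f =
    trans (∑-++ (map (x ,_) ys) _ f) (cong₂ _+_ (∑-map (x ,_) ys f) (∑-cartesianProduct xs ys f))

  length-cartesianSquare : ∀ (xs : List X) → length (cartesianProduct xs xs) ≡ length xs * length xs
  length-cartesianSquare xs = begin
    length (cartesianProduct xs xs)            ≡⟨ length≡∑ (cartesianProduct xs xs) ⟩
    ∑ (cartesianProduct xs xs) (λ _ → 1)       ≡⟨ ∑-cartesianProduct xs xs _ ⟩
    ∑ xs (λ _ → ∑ xs (λ _ → 1))                ≡⟨ ∑-const _ xs ⟩
    length xs * ∑ xs (λ _ → 1)                 ≡⟨ cong (length xs *_) (length≡∑ xs) ⟨
    length xs * length xs                      ∎
    where open ≡-Reasoning

  blowup≢0 : ∀ k s .{{_ : NonZero k}} → NonZero (blowup k s)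
  blowup≢0 k s = m*n≢0 _ _ {{m*n≢0 2 _ {{_}} {{m*n≢0 2 k}}}} {{m^n≢0 2 (2 * (2 * k) * s)}}

  -- The summands serve, in this order, the two applications of `popular-rows`, the size of the
  -- third part, and nonemptiness.
  tripartiteBound : ℕ → ℕ → ℕ
  tripartiteBound k s = 2 * k * (2 * (2 * k) * s) + (2 * k₁ * (2 * (2 * k₁) * s) + (blowup k₁ s * s + 1))
    where
    k₁ : ℕ
    k₁ = blowup k s

  -- The ternary relation is read as a bipartite one between entries and pairs. The pairs kept with
  -- the first part are again dense, so the same step produces the second part, and the columns kept
  -- there are the third. All parts come from `xs` and may overlap; only the relation can separate
  -- them.
  dense⇒complete-tripartite : ∀ (xs : List X) (R : X → X → X → Bool) k s .{{_ : NonZero k}} → 0 < s →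
    Unique xs → tripartiteBound k s ≤ length xs →
    length xs * (length xs * length xs) ≤ k * ∑ xs (λ x → ∑ xs (λ y → ∑ xs (λ z → ⟦ R x y z ⟧))) →
    ∃[ as ] ∃[ bs ] Σ (List X) λ cs → (Unique as × s ≤ length as) × (Unique bs × s ≤ length bs) × (Unique cs × s ≤ length cs) ×
      (∀ x y z → x ∈ as → y ∈ bs → z ∈ cs → T (R x y z))
  dense⇒complete-tripartite {X} xs R k s s>0 ux large dense = level₁
    (popular-rows xs (cartesianProduct xs xs) (λ x yz → R x (proj₁ yz) (proj₂ yz)) k s ux s>0 pairs>0 dense₁
      (≤-trans (m≤m+n _ _) large))
    where
    open ≤-Reasoning
    k₁ : ℕ
    k₁ = blowup k s

    instance
      nz₁ : NonZero k₁
      nz₁ = blowup≢0 k s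
      nz₂ : NonZero (blowup k₁ s)
      nz₂ = blowup≢0 k₁ s

    large₁ : 2 * k₁ * (2 * (2 * k₁) * s) + (blowup k₁ s * s + 1) ≤ length xs
    large₁ = ≤-trans (m≤n+m _ (2 * k * (2 * (2 * k) * s))) large

    large₂ : blowup k₁ s * s + 1 ≤ length xs
    large₂ = ≤-trans (m≤n+m _ (2 * k₁ * (2 * (2 * k₁) * s))) large₁

    xs>0 : 0 < length xs
    xs>0 = ≤-trans (m≤n+m 1 (blowup k₁ s * s)) large₂

    pairs>0 : 0 < length (cartesianProduct xs xs)
    pairs>0 = subst (0 <_) (sym (length-cartesianSquare xs)) (*-mono-≤ xs>0 xs>0)

    dense₁ : length xs * length (cartesianProduct xs xs)
           ≤ k * ∑ xs (λ x → ∑ (cartesianProduct xs xs) (λ yz → ⟦ R x (proj₁ yz) (proj₂ yz) ⟧))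
    dense₁ = begin
      length xs * length (cartesianProduct xs xs)  ≡⟨ cong (length xs *_) (length-cartesianSquare xs) ⟩
      length xs * (length xs * length xs)          ≤⟨ dense ⟩
      k * ∑ xs (λ x → ∑ xs (λ y → ∑ xs (λ z → ⟦ R x y z ⟧)))
        ≡⟨ cong (k *_) (∑-cong xs λ x → ∑-cartesianProduct xs xs _) ⟨
      k * ∑ xs (λ x → ∑ (cartesianProduct xs xs) (λ yz → ⟦ R x (proj₁ yz) (proj₂ yz) ⟧)) ∎

    Result : Set
    Result = ∃[ as ] ∃[ bs ] Σ (List X) λ cs →
      (Unique as × s ≤ length as) × (Unique bs × s ≤ length bs) × (Unique cs × s ≤ length cs) ×
      (∀ x y z → x ∈ as → y ∈ bs → z ∈ cs → T (R x y z))

    level₁ : _ → Result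
    level₁ (as , q , ua , s≤a , _ , q⇒R , dense-q) = level₂
      (popular-rows xs xs (λ y z → q (y , z)) k₁ s ux s>0 xs>0 dense₂
        (≤-trans (m≤m+n _ (blowup k₁ s * s + 1)) large₁))
      where
      dense₂ : length xs * length xs ≤ k₁ * ∑ xs (λ y → ∑ xs (λ z → ⟦ q (y , z) ⟧))
      dense₂ = begin
        length xs * length xs            ≡⟨ length-cartesianSquare xs ⟨
        length (cartesianProduct xs xs)  ≤⟨ dense-q ⟩
        k₁ * ∑ (cartesianProduct xs xs) (λ yz → ⟦ q yz ⟧)
          ≡⟨ cong (k₁ *_) (∑-cartesianProduct xs xs _) ⟩
        k₁ * ∑ xs (λ y → ∑ xs (λ z → ⟦ q (y , z) ⟧)) ∎

      level₂ : _ → Result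
      level₂ (bs , q′ , ub , s≤b , _ , q′⇒q , dense-q′) =
        as , bs , filterT q′ xs , (ua , s≤a) , (ub , s≤b) , (Unique.filter⁺ (T? ∘ q′) ux , s≤c) ,
        λ x y z x∈ y∈ z∈ → q⇒R x (y , z) x∈ (q′⇒q y z y∈ (proj₂ (∈-filter⁻ (T? ∘ q′) {xs = xs} z∈)))
        where
        s≤c : s ≤ length (filterT q′ xs)
        s≤c = *-cancelˡ-≤ (blowup k₁ s) (begin
          blowup k₁ s * s                          ≤⟨ m≤m+n _ 1 ⟩
          blowup k₁ s * s + 1                      ≤⟨ large₂ ⟩
          length xs                                ≤⟨ dense-q′ ⟩
          blowup k₁ s * ∑ xs (λ z → ⟦ q′ z ⟧)      ≡⟨ cong (blowup k₁ s *_) (length-filterT q′ xs) ⟨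
          blowup k₁ s * length (filterT q′ xs)     ∎)

-- Fourier-Motzkin elimination and Farkas' lemma

module FourierMotzkin where
  open import Data.Integer as ℤ using (ℤ; 0ℤ; 1ℤ; -_; +_; -[1+_])
  import Data.Integer.Properties as ℤ
  import Data.Integer.Tactic.RingSolver as ℤ-Solver
  open import Data.Nat as ℕ using (ℕ; zero; suc)
  import Data.Nat.Properties as ℕ

  -- The affine inequality Σ coeff i · w i + const · N ≥ 0 in unknowns w i ≥ 0 and N > 0.
  record Constraint (d : ℕ) : Set where
    constructor _⊕_
    field
      coeff : Fin d → ℤ
      const : ℤ
  open Constraint

  dot : ∀ {d} → (Fin d → ℤ) → (Fin d → ℕ) → ℤ
  dot {zero}  f w = 0ℤ
  dot {suc d} f w = f zero ℤ.* + w zero ℤ.+ dot (f ∘ suc) (w ∘ suc)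

  dot-lin : ∀ {d} a b (f g : Fin d → ℤ) (w : Fin d → ℕ) →
            dot (λ i → a ℤ.* f i ℤ.+ b ℤ.* g i) w ≡ a ℤ.* dot f w ℤ.+ b ℤ.* dot g w
  dot-lin {zero}  a b f g w = sym (cong₂ ℤ._+_ (ℤ.*-zeroʳ a) (ℤ.*-zeroʳ b))
  dot-lin {suc d} a b f g w =
    trans (cong (λ s → (a ℤ.* f zero ℤ.+ b ℤ.* g zero) ℤ.* + w zero ℤ.+ s) (dot-lin a b (f ∘ suc) (g ∘ suc) (w ∘ suc)))
          (rearrange a b (f zero) (g zero) (+ w zero) _ _)
    where
    rearrange : ∀ a b f g w x y →
      (a ℤ.* f ℤ.+ b ℤ.* g) ℤ.* w ℤ.+ (a ℤ.* x ℤ.+ b ℤ.* y) ≡ a ℤ.* (f ℤ.* w ℤ.+ x) ℤ.+ b ℤ.* (g ℤ.* w ℤ.+ y)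
    rearrange = ℤ-Solver.solve-∀

  dot-scale : ∀ {d} h (f : Fin d → ℤ) (w : Fin d → ℕ) → dot f (λ i → h ℕ.* w i) ≡ + h ℤ.* dot f w
  dot-scale {zero}  h f w = sym (ℤ.*-zeroʳ (+ h))
  dot-scale {suc d} h f w =
    trans (cong₂ (λ x y → f zero ℤ.* x ℤ.+ y) (ℤ.pos-* h (w zero)) (dot-scale h (f ∘ suc) (w ∘ suc)))
          (rearrange (+ h) (f zero) (+ w zero) _)
    where
    rearrange : ∀ h f w x → f ℤ.* (h ℤ.* w) ℤ.+ h ℤ.* x ≡ h ℤ.* (f ℤ.* w ℤ.+ x)
    rearrange = ℤ-Solver.solve-∀

  value : ∀ {d} → Constraint d → (Fin d → ℕ) → ℕ → ℤ
  value c w N = dot (coeff c) w ℤ.+ const c ℤ.* + N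

  total : ∀ {A : Set} → (A → ℤ) → List A → ℤ
  total f []       = 0ℤ
  total f (x ∷ xs) = f x ℤ.+ total f xs

  total-++ : ∀ {A : Set} (f : A → ℤ) xs ys → total f (xs ++ ys) ≡ total f xs ℤ.+ total f ys
  total-++ f []       ys = sym (ℤ.+-identityˡ _)
  total-++ f (x ∷ xs) ys = trans (cong (λ s → f x ℤ.+ s) (total-++ f xs ys)) (sym (ℤ.+-assoc (f x) _ _))

  total-replicate : ∀ {A : Set} (f : A → ℤ) n x → total f (replicate n x) ≡ + n ℤ.* f x
  total-replicate f zero    x = refl
  total-replicate f (suc n) x = trans (cong (λ s → f x ℤ.+ s) (total-replicate f n x)) (sym (ℤ.suc-* (+ n) (f x)))

  private
    lead : ∀ {d} → Constraint (suc d) → ℤ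
    lead c = coeff c zero

    rest : ∀ {d} → Constraint (suc d) → Constraint d
    rest c = (coeff c ∘ suc) ⊕ const c

    isNonpos posPart negPart : ℤ → ℕ
    isNonpos (+ zero)   = 1
    isNonpos (+ suc _)  = 0
    isNonpos (-[1+ _ ]) = 1
    posPart (+ n)       = n
    posPart (-[1+ _ ])  = 0
    negPart (+ _)       = 0
    negPart (-[1+ n ])  = suc n

    -- The combination a q + b p with the leading variable forgotten.
    combination : ∀ {d} → ℕ → Constraint (suc d) → ℕ → Constraint (suc d) → Constraint d
    combination a q b p = (λ i → + a ℤ.* coeff q (suc i) ℤ.+ + b ℤ.* coeff p (suc i))
                    ⊕ (+ a ℤ.* const q ℤ.+ + b ℤ.* const p)

    -- The leading unknown is nonnegative, so a constraint with nonpositive leading coefficient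
    -- remains valid without it. For a positive coefficient the multiplier 0 leaves a trivial
    -- constraint, which saves a case distinction in `eliminate`.
    drop : ∀ {d} → Constraint (suc d) → Constraint d
    drop q = combination (isNonpos (lead q)) q 0 q

    -- A lower bound `p` on the leading unknown is added to an upper bound `q`, with multipliers
    -- that cancel it. For the other signs the multipliers still leave a nonpositive leading term,
    -- as `cancel-lead` checks, so every pair may be combined.
    cancel : ∀ {d} → Constraint (suc d) → Constraint (suc d) → Constraint d
    cancel p q = combination (isNonpos (lead q) ℕ.* posPart (lead p)) q (negPart (lead q)) p

    eliminate : ∀ {d} → List (Constraint (suc d)) → List (Constraint d)
    eliminate cs = map drop cs ++ cartesianProductWith cancel cs cs

    value-combination : ∀ {d} a (q : Constraint (suc d)) b p w N →
      value (combination a q b p) w N ≡ + a ℤ.* value (rest q) w N ℤ.+ + b ℤ.* value (rest p) w N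
    value-combination a q b p w N =
      trans (cong (λ s → s ℤ.+ _) (dot-lin (+ a) (+ b) (coeff q ∘ suc) (coeff p ∘ suc) w))
            (rearrange (+ a) (+ b) _ _ (const q) (const p) (+ N))
      where
      rearrange : ∀ a b x y c d n → a ℤ.* x ℤ.+ b ℤ.* y ℤ.+ (a ℤ.* c ℤ.+ b ℤ.* d) ℤ.* n
                                  ≡ a ℤ.* (x ℤ.+ c ℤ.* n) ℤ.+ b ℤ.* (y ℤ.+ d ℤ.* n)
      rearrange = ℤ-Solver.solve-∀

  -- A Farkas certificate with its multipliers written as repetitions in the list. That they are
  -- natural numbers matters later: they become numbers of copies and of pieces. As the unknowns are
  -- nonnegative, the coefficients only have to add up to something nonpositive.
  Refutation : ∀ {d} → List (Constraint d) → Set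
  Refutation {d} cs = Σ (List (Constraint d)) λ L → All (_∈ cs) L ×
    (∀ i → total (λ c → coeff c i) L ℤ.≤ 0ℤ) × total const L ℤ.< 0ℤ

  -- A rational solution with cleared denominators; `suc N` is the common denominator.
  Solution : ∀ {d} → List (Constraint d) → Set
  Solution {d} cs = Σ (Fin d → ℕ) λ w → Σ ℕ λ N → (∀ {c} → c ∈ cs → 0ℤ ℤ.≤ value c w (suc N))

  private
    Expansion : ∀ {d} → List (Constraint (suc d)) → Constraint d → Set
    Expansion {d} cs c = Σ (List (Constraint (suc d))) λ M → All (_∈ cs) M ×
      (∀ i → total (λ c → coeff c (suc i)) M ≡ coeff c i) × total const M ≡ const c × total lead M ℤ.≤ 0ℤ

    expand-combination : ∀ {d} {cs : List (Constraint (suc d))} {q p} → q ∈ cs → p ∈ cs → ∀ a b →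
      + a ℤ.* lead q ℤ.+ + b ℤ.* lead p ℤ.≤ 0ℤ → Expansion cs (combination a q b p)
    expand-combination {q = q} {p} q∈ p∈ a b lead≤0 =
      replicate a q ++ replicate b p ,
      All.++⁺ (All.replicate⁺ a q∈) (All.replicate⁺ b p∈) ,
      (λ i → sums (λ c → coeff c (suc i))) , sums const ,
      subst (ℤ._≤ 0ℤ) (sym (sums lead)) lead≤0
      where
      sums : ∀ f → total f (replicate a q ++ replicate b p) ≡ + a ℤ.* f q ℤ.+ + b ℤ.* f p
      sums f = trans (total-++ f (replicate a q) _) (cong₂ ℤ._+_ (total-replicate f a q) (total-replicate f b p))

    cancel-lead : ∀ hp hq → + (isNonpos hq ℕ.* posPart hp) ℤ.* hq ℤ.+ + negPart hq ℤ.* hp ℤ.≤ 0ℤ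
    cancel-lead hp (+ suc _)          = ℤ.≤-refl
    cancel-lead hp (+ zero)           = ℤ.≤-reflexive (trans (ℤ.+-identityʳ _) (ℤ.*-zeroʳ (+ (posPart hp ℕ.+ 0))))
    cancel-lead (+ n) (-[1+ m ])      = ℤ.≤-reflexive (trans
      (cong (λ k → + k ℤ.* -[1+ m ] ℤ.+ + suc m ℤ.* + n) (ℕ.+-identityʳ n)) (rearrange (+ n) (+ suc m)))
      where
      rearrange : ∀ n m → n ℤ.* (- m) ℤ.+ m ℤ.* n ≡ 0ℤ
      rearrange = ℤ-Solver.solve-∀
    cancel-lead (-[1+ n ]) (-[1+ m ]) = ℤ.-≤+

    drop-lead : ∀ h → + isNonpos h ℤ.* h ℤ.+ 0ℤ ℤ.* h ℤ.≤ 0ℤ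
    drop-lead (+ zero)   = ℤ.≤-refl
    drop-lead (+ suc n)  = ℤ.≤-refl
    drop-lead (-[1+ n ]) = ℤ.-≤+

    expand : ∀ {d} (cs : List (Constraint (suc d))) {c} → c ∈ eliminate cs → Expansion cs c
    expand cs c∈ with ∈-++⁻ (map drop cs) c∈
    ... | inj₁ c∈ˡ with ∈-map⁻ drop c∈ˡ
    ...   | q , q∈ , refl = expand-combination q∈ q∈ (isNonpos (lead q)) 0 (drop-lead (lead q))
    expand cs c∈ | inj₂ c∈ʳ with ∈-cartesianProductWith⁻ cancel cs cs c∈ʳ
    ...   | p , q , p∈ , q∈ , refl = expand-combination q∈ p∈ (isNonpos (lead q) ℕ.* posPart (lead p)) (negPart (lead q)) (cancel-lead (lead p) (lead q))

    expandAll : ∀ {d} (cs : List (Constraint (suc d))) L → All (_∈ eliminate cs) L →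
      Σ (List (Constraint (suc d))) λ M → All (_∈ cs) M ×
      (∀ i → total (λ c → coeff c (suc i)) M ≡ total (λ c → coeff c i) L) ×
      total const M ≡ total const L × total lead M ℤ.≤ 0ℤ
    expandAll cs []      []         = [] , [] , (λ _ → refl) , refl , ℤ.≤-refl
    expandAll cs (c ∷ L) (c∈ ∷ L∈) with expand cs c∈ | expandAll cs L L∈
    ... | M₁ , M₁∈ , coeff₁ , const₁ , lead₁ | M₂ , M₂∈ , coeff₂ , const₂ , lead₂ =
      M₁ ++ M₂ , All.++⁺ M₁∈ M₂∈ ,
      (λ i → trans (total-++ _ M₁ M₂) (cong₂ ℤ._+_ (coeff₁ i) (coeff₂ i))) ,
      trans (total-++ _ M₁ M₂) (cong₂ ℤ._+_ const₁ const₂) ,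
      subst (ℤ._≤ 0ℤ) (sym (total-++ lead M₁ M₂)) (ℤ.+-mono-≤ lead₁ lead₂)

    refute : ∀ {d} (cs : List (Constraint (suc d))) → Refutation (eliminate cs) → Refutation cs
    refute cs (L , L∈ , coeff≤0 , const<0) with expandAll cs L L∈
    ... | M , M∈ , coeff≡ , const≡ , lead≤0 = M , M∈ ,
      (λ { zero → lead≤0 ; (suc i) → subst (ℤ._≤ 0ℤ) (sym (coeff≡ i)) (coeff≤0 i) }) ,
      subst (ℤ._< 0ℤ) (sym const≡) const<0

    -- Among the fractions −t/h with h > 0, together with 0/1, a largest one.
    Largest : ∀ {A : Set} (h : A → ℕ) (t : A → ℤ) (Q : ℕ → ℤ → Set) → List A → Set
    Largest h t Q xs = Σ ℕ λ H → Σ ℤ λ τ → τ ℤ.≤ 0ℤ × Q (suc H) τ ×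
      (∀ {x} → x ∈ xs → 0 ℕ.< h x → + h x ℤ.* τ ℤ.≤ + suc H ℤ.* t x)

    -- `Q` is any property shared by all candidate fractions. In `lift` it says that a candidate
    -- respects every upper bound on the unknown, so that the largest lower bound respects them too.
    largest : ∀ {A : Set} (h : A → ℕ) (t : A → ℤ) (Q : ℕ → ℤ → Set) xs → Q 1 0ℤ →
      (∀ {x} → x ∈ xs → 0 ℕ.< h x → Q (h x) (t x)) → Largest h t Q xs
    largest h t Q []       Q₀ Qs = 0 , 0ℤ , ℤ.≤-refl , Q₀ , λ ()
    largest {A} h t Q (x ∷ xs) Q₀ Qs = step (h x) refl (largest h t Q xs Q₀ (λ x∈ → Qs (there x∈)))
      where
      step : ∀ k → h x ≡ k → Largest h t Q xs → Largest h t Q (x ∷ xs)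
      step zero eq (H , τ , τ≤0 , QHτ , max) = H , τ , τ≤0 , QHτ ,
        λ { (here refl) hx>0 → absurd (subst (0 ℕ.<_) eq hx>0) ; (there x∈) → max x∈ }
        where
        absurd : ∀ {B : Set} → 0 ℕ.< 0 → B
        absurd ()
      step (suc k) eq (H , τ , τ≤0 , QHτ , max) with + suc k ℤ.* τ ℤ.≤? + suc H ℤ.* t x
      ... | yes le = H , τ , τ≤0 , QHτ ,
        λ { (here refl) _ → subst (λ k → + k ℤ.* τ ℤ.≤ + suc H ℤ.* t x) (sym eq) le ; (there x∈) → max x∈ }
      ... | no gt = k , t x , tx≤0 ,
        subst (λ k → Q k (t x)) eq (Qs (here refl) (subst (0 ℕ.<_) (sym eq) (ℕ.s≤s ℕ.z≤n))) ,
        λ { (here refl) _ → ℤ.≤-reflexive (cong (λ k → + k ℤ.* t x) eq) ; (there y∈) hy>0 → older y∈ hy>0 }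
        where
        open ℤ.≤-Reasoning
        new≤ : + suc H ℤ.* t x ℤ.≤ + suc k ℤ.* τ
        new≤ = ℤ.<⇒≤ (ℤ.≰⇒> gt)

        tx≤0 : t x ℤ.≤ 0ℤ
        tx≤0 = ℤ.*-cancelˡ-≤-pos (t x) 0ℤ (+ suc H) (begin
          + suc H ℤ.* t x   ≤⟨ new≤ ⟩
          + suc k ℤ.* τ     ≤⟨ ℤ.*-monoˡ-≤-nonNeg (+ suc k) τ≤0 ⟩
          + suc k ℤ.* 0ℤ    ≡⟨ ℤ.*-zeroʳ (+ suc k) ⟩
          0ℤ                ≡⟨ ℤ.*-zeroʳ (+ suc H) ⟨
          + suc H ℤ.* 0ℤ    ∎)

        older : ∀ {y} → y ∈ xs → 0 ℕ.< h y → + h y ℤ.* t x ℤ.≤ + suc k ℤ.* t y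
        older {y} y∈ hy>0 = ℤ.*-cancelˡ-≤-pos _ _ (+ suc H) (begin
          + suc H ℤ.* (+ h y ℤ.* t x)   ≡⟨ swap (+ suc H) (+ h y) (t x) ⟩
          + h y ℤ.* (+ suc H ℤ.* t x)   ≤⟨ ℤ.*-monoˡ-≤-nonNeg (+ h y) new≤ ⟩
          + h y ℤ.* (+ suc k ℤ.* τ)     ≡⟨ swap (+ h y) (+ suc k) τ ⟩
          + suc k ℤ.* (+ h y ℤ.* τ)     ≤⟨ ℤ.*-monoˡ-≤-nonNeg (+ suc k) (max y∈ hy>0) ⟩
          + suc k ℤ.* (+ suc H ℤ.* t y) ≡⟨ swap (+ suc k) (+ suc H) (t y) ⟩
          + suc H ℤ.* (+ suc k ℤ.* t y) ∎)
          where
          swap : ∀ a b c → a ℤ.* (b ℤ.* c) ≡ b ℤ.* (a ℤ.* c)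
          swap = ℤ-Solver.solve-∀

    -- Back substitution: the leading unknown takes the largest of its lower bounds, or 0. The upper
    -- bounds hold at this value because `eliminate` has combined each of them with each lower
    -- bound.
    lift : ∀ {d} (cs : List (Constraint (suc d))) → Solution (eliminate cs) → Solution cs
    lift {d} cs (w , N , sat) = extend (largest (posPart ∘ lead) t Q cs Q₀ Qs)
      where
      t : Constraint (suc d) → ℤ
      t c = value (rest c) w (suc N)

      -- In other words, the value `- τ / H` of the leading unknown satisfies `q`, whose leading
      -- coefficient is `- negPart (lead q)`.
      Q : ℕ → ℤ → Set
      Q H τ = ∀ {q} → q ∈ cs → isNonpos (lead q) ≡ 1 → 0ℤ ℤ.≤ + H ℤ.* t q ℤ.+ + negPart (lead q) ℤ.* τ

      Q₀ : Q 1 0ℤ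
      Q₀ {q} q∈ np = subst (0ℤ ℤ.≤_) eq (sat (∈-++⁺ˡ (∈-map⁺ drop q∈)))
        where
        eq : value (drop q) w (suc N) ≡ 1ℤ ℤ.* t q ℤ.+ + negPart (lead q) ℤ.* 0ℤ
        eq rewrite value-combination (isNonpos (lead q)) q 0 q w (suc N) | np =
          cong (λ s → 1ℤ ℤ.* t q ℤ.+ s) (sym (ℤ.*-zeroʳ (+ negPart (lead q))))

      Qs : ∀ {p} → p ∈ cs → 0 ℕ.< posPart (lead p) → Q (posPart (lead p)) (t p)
      Qs {p} p∈ _ {q} q∈ np = subst (0ℤ ℤ.≤_) eq (sat (∈-++⁺ʳ (map drop cs) (∈-cartesianProductWith⁺ cancel p∈ q∈)))
        where
        eq : value (cancel p q) w (suc N) ≡ + posPart (lead p) ℤ.* t q ℤ.+ + negPart (lead q) ℤ.* t p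
        eq = trans (value-combination (isNonpos (lead q) ℕ.* posPart (lead p)) q (negPart (lead q)) p w (suc N))
          (cong (λ k → + k ℤ.* t q ℤ.+ + negPart (lead q) ℤ.* t p)
            (trans (cong (ℕ._* posPart (lead p)) np) (ℕ.*-identityˡ (posPart (lead p)))))

      extend : Largest (posPart ∘ lead) t Q cs → Solution cs
      -- Everything is scaled by `suc H` to stay within the integers; the new denominator
      -- `suc H * suc N` is the successor of the number given here.
      extend (H , τ , τ≤0 , QHτ , max) = w⁺ , N ℕ.+ H ℕ.* suc N , sat⁺
        where
        w⁺ : Fin (suc d) → ℕ
        w⁺ zero    = ℤ.∣ τ ∣
        w⁺ (suc i) = suc H ℕ.* w i

        ∣τ∣ : + ℤ.∣ τ ∣ ≡ - τ
        ∣τ∣ = trans (cong +_ (sym (ℤ.∣-i∣≡∣i∣ τ))) (ℤ.0≤i⇒+∣i∣≡i (ℤ.neg-mono-≤ τ≤0))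

        value⁺ : ∀ c → value c w⁺ (suc H ℕ.* suc N) ≡ lead c ℤ.* (- τ) ℤ.+ + suc H ℤ.* t c
        value⁺ c = trans
          (cong₂ (λ x y → lead c ℤ.* x ℤ.+ y ℤ.+ const c ℤ.* + (suc H ℕ.* suc N)) ∣τ∣ (dot-scale (suc H) (coeff c ∘ suc) w))
          (trans (cong (λ z → lead c ℤ.* (- τ) ℤ.+ + suc H ℤ.* dot (coeff c ∘ suc) w ℤ.+ const c ℤ.* z) (ℤ.pos-* (suc H) (suc N)))
            (rearrange (lead c) (- τ) (+ suc H) _ (const c) (+ suc N)))
          where
          rearrange : ∀ l τ h x k n → l ℤ.* τ ℤ.+ h ℤ.* x ℤ.+ k ℤ.* (h ℤ.* n) ≡ l ℤ.* τ ℤ.+ h ℤ.* (x ℤ.+ k ℤ.* n)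
          rearrange = ℤ-Solver.solve-∀

        sat⁺ : ∀ {c} → c ∈ cs → 0ℤ ℤ.≤ value c w⁺ (suc H ℕ.* suc N)
        sat⁺ {c} c∈ = subst (0ℤ ℤ.≤_) (sym (value⁺ c)) (bySign (lead c) refl)
          where
          bySign : ∀ l → lead c ≡ l → 0ℤ ℤ.≤ l ℤ.* (- τ) ℤ.+ + suc H ℤ.* t c
          bySign (+ suc n) eq = subst (0ℤ ℤ.≤_) (rearrange (+ suc H ℤ.* t c) (+ suc n) τ)
            (ℤ.i≤j⇒0≤j-i (subst (λ l → + posPart l ℤ.* τ ℤ.≤ + suc H ℤ.* t c) eq
              (max c∈ (subst (λ l → 0 ℕ.< posPart l) (sym eq) (ℕ.s≤s ℕ.z≤n)))))
            where
            rearrange : ∀ a b τ → a ℤ.- b ℤ.* τ ≡ b ℤ.* (- τ) ℤ.+ a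
            rearrange = ℤ-Solver.solve-∀
          bySign (+ zero) eq = subst (0ℤ ℤ.≤_) (trans (ℤ.+-identityʳ (+ suc H ℤ.* t c)) (sym (ℤ.+-identityˡ (+ suc H ℤ.* t c))))
            (subst (λ l → 0ℤ ℤ.≤ + suc H ℤ.* t c ℤ.+ + negPart l ℤ.* τ) eq (QHτ c∈ (cong isNonpos eq)))
          bySign (-[1+ n ]) eq = subst (0ℤ ℤ.≤_) (rearrange (+ suc H ℤ.* t c) (+ suc n) τ)
            (subst (λ l → 0ℤ ℤ.≤ + suc H ℤ.* t c ℤ.+ + negPart l ℤ.* τ) eq (QHτ c∈ (cong isNonpos eq)))
            where
            rearrange : ∀ a b τ → a ℤ.+ b ℤ.* τ ≡ (- b) ℤ.* (- τ) ℤ.+ a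
            rearrange = ℤ-Solver.solve-∀

  -- Elimination transports both outcomes: solutions lift and certificates expand. Without unknowns,
  -- a single negative constant is already a certificate.
  farkas : ∀ {d} (cs : List (Constraint d)) → Solution cs ⊎ Refutation cs
  farkas {zero} [] = inj₁ ((λ ()) , 0 , λ ())
  farkas {zero} (c ∷ cs) with 0ℤ ℤ.≤? const c | farkas cs
  ... | no c<0 | _ = inj₂ (c ∷ [] , here refl ∷ [] , (λ ()) , subst (ℤ._< 0ℤ) (sym (ℤ.+-identityʳ (const c))) (ℤ.≰⇒> c<0))
  ... | yes _  | inj₂ (L , L∈ , L≤0 , L<0) = inj₂ (L , All.map there L∈ , L≤0 , L<0)
  ... | yes c≥0 | inj₁ (_ , N , sat) = inj₁ ((λ ()) , N ,
      λ { (here refl) → subst (0ℤ ℤ.≤_) (sym (ℤ.+-identityˡ _)) (ℤ.*-monoʳ-≤-nonNeg (+ suc N) c≥0)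
        ; (there c∈) → sat c∈ })
  farkas {suc d} cs with farkas (eliminate cs)
  ... | inj₁ sol = inj₁ (lift cs sol)
  ... | inj₂ ref = inj₂ (refute cs ref)

-- Weights on three copies and the numbers of pairs and triples they allow

module LocalWeights where
  open Sums
  open DenseTripartite using (∑⟦⟧>0⇒∃)

  open import Data.Nat using (ℕ; zero; suc; _+_; _*_; _≤_; _<_; z≤n; s≤s; _≤?_; NonZero; >-nonZero)
  open import Data.Nat.Properties
  open import Data.Nat.Tactic.RingSolver using (solve-∀)

  ∑₃ : (Fin 3 → ℕ) → ℕ
  ∑₃ = ∑ (allFin 3)

  ∑₄ : (Fin 4 → ℕ) → ℕ
  ∑₄ = ∑ (allFin 4)

  ∑-remove : ∀ a (f : Fin 4 → ℕ) → ∑₄ f ≡ f a + ∑₃ (f ∘ punchIn a)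
  ∑-remove zero f = refl
  ∑-remove (suc zero) f = eq (f zero) (f (suc zero)) _
    where
    eq : ∀ x y z → x + (y + z) ≡ y + (x + z)
    eq = solve-∀
  ∑-remove (suc (suc zero)) f = eq (f zero) (f (suc zero)) (f (suc (suc zero))) _
    where
    eq : ∀ x y z w → x + (y + (z + w)) ≡ z + (x + (y + w))
    eq = solve-∀
  ∑-remove (suc (suc (suc zero))) f = eq (f zero) (f (suc zero)) (f (suc (suc zero))) (f (suc (suc (suc zero))))
    where
    eq : ∀ x y z w → x + (y + (z + (w + 0))) ≡ w + (x + (y + (z + 0)))
    eq = solve-∀

  δ : Fin 4 → Fin 4 → ℕ
  δ a x = ⟦ does (a ≟F x) ⟧

  δ-refl : ∀ a → δ a a ≡ 1
  δ-refl a = cong ⟦_⟧ (dec-true (a ≟F a) refl)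

  ∑-δ : ∀ a → ∑₄ (δ a) ≡ 1
  ∑-δ zero                   = refl
  ∑-δ (suc zero)             = refl
  ∑-δ (suc (suc zero))       = refl
  ∑-δ (suc (suc (suc zero))) = refl

  ∑₄-δ : ∀ c a (f : Fin 4 → ℕ) → ∑₄ (λ x → c * δ a x + f x) ≡ c + ∑₄ f
  ∑₄-δ c a f = begin
    ∑₄ (λ x → c * δ a x + f x)        ≡⟨ ∑-+ (allFin 4) (λ x → c * δ a x) f ⟩
    ∑₄ (λ x → c * δ a x) + ∑₄ f       ≡⟨ cong (_+ ∑₄ f) (∑-* c (allFin 4) (δ a)) ⟩
    c * ∑₄ (δ a) + ∑₄ f               ≡⟨ cong (λ s → c * s + ∑₄ f) (∑-δ a) ⟩
    c * 1 + ∑₄ f                      ≡⟨ cong (_+ ∑₄ f) (*-identityʳ c) ⟩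
    c + ∑₄ f                          ∎
    where open ≡-Reasoning

  ∑≤except : ∀ c e a a′ (f : Fin 4 → ℕ) → (∀ x → f x ≤ c + e) → (∀ x → x ≢ a → x ≢ a′ → f x ≤ c) →
             ∑₄ f ≤ e + (e + 4 * c)
  ∑≤except c e a a′ f f≤ f≤c = begin
    ∑₄ f                                       ≤⟨ ∑-mono (allFin 4) pointwise ⟩
    ∑₄ (λ x → e * δ a x + (e * δ a′ x + c))    ≡⟨ ∑₄-δ e a (λ x → e * δ a′ x + c) ⟩
    e + ∑₄ (λ x → e * δ a′ x + c)              ≡⟨ cong (e +_) (∑₄-δ e a′ (λ _ → c)) ⟩
    e + (e + ∑₄ (λ _ → c))                     ≡⟨⟩
    e + (e + 4 * c)                            ∎
    where
    open ≤-Reasoning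
    pointwise : ∀ x → f x ≤ e * δ a x + (e * δ a′ x + c)
    pointwise x with x ≟F a | x ≟F a′
    ... | yes refl | _ = begin
      f a                                  ≤⟨ f≤ a ⟩
      c + e                                ≡⟨ cong (c +_) (sym (trans (cong (e *_) (δ-refl a)) (*-identityʳ e))) ⟩
      c + e * δ a a                        ≡⟨ +-comm c _ ⟩
      e * δ a a + c                        ≤⟨ +-monoʳ-≤ (e * δ a a) (m≤n+m c (e * δ a′ a)) ⟩
      e * δ a a + (e * δ a′ a + c)         ∎
    ... | no _ | yes refl = begin
      f a′                                 ≤⟨ f≤ a′ ⟩
      c + e                                ≡⟨ cong (c +_) (sym (trans (cong (e *_) (δ-refl a′)) (*-identityʳ e))) ⟩
      c + e * δ a′ a′                      ≡⟨ +-comm c _ ⟩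
      e * δ a′ a′ + c                      ≤⟨ m≤n+m _ (e * δ a a′) ⟩
      e * δ a a′ + (e * δ a′ a′ + c)       ∎
    ... | no x≢a | no x≢a′ = ≤-trans (f≤c x x≢a x≢a′) (m≤n⇒m≤o+n (e * δ a x) (m≤n+m c (e * δ a′ x)))

  ∑∑ : (Fin 4 → Fin 4 → Bool) → ℕ
  ∑∑ t = ∑₄ (λ a → ∑₄ (λ b → ⟦ t a b ⟧))

  ∑∑∑ : (Fin 4 → Fin 4 → Fin 4 → Bool) → ℕ
  ∑∑∑ t = ∑₄ (λ a → ∑∑ (t a))

  ∑⟦⟧≤4 : ∀ (t : Fin 4 → Bool) → ∑₄ (λ b → ⟦ t b ⟧) ≤ 4
  ∑⟦⟧≤4 t = ∑-≤const (allFin 4) 1 (λ b → ⟦⟧≤1 (t b))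

  ∑∑≤16 : ∀ t → ∑∑ t ≤ 16
  ∑∑≤16 t = ∑-≤const (allFin 4) 4 (λ a → ∑⟦⟧≤4 (t a))

  ∑∑∑≤64 : ∀ t → ∑∑∑ t ≤ 64
  ∑∑∑≤64 t = ∑-≤const (allFin 4) 16 (λ a → ∑∑≤16 (t a))

  ∑∑-swap : ∀ t → ∑∑ t ≡ ∑∑ (λ b a → t a b)
  ∑∑-swap t = ∑-swap (allFin 4) (allFin 4) (λ a b → ⟦ t a b ⟧)

  ∑∑>0⇒∃ : ∀ t → 0 < ∑∑ t → ∃[ a ] ∃[ b ] T (t a b)
  ∑∑>0⇒∃ t h with any? (λ a → any? (λ b → T? (t a b)))
  ... | yes ∃ab = ∃ab
  ... | no ∄ab  = ⊥-elim (<⇒≱ h (≤-trans (∑-≤const (allFin 4) 0 λ a → ∑-≤const (allFin 4) 0 λ b → false≤ (t a b) (λ p → ∄ab (a , b , p))) z≤n))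
    where
    false≤ : ∀ b → ¬ T b → ⟦ b ⟧ ≤ 0
    false≤ true  ¬b = ⊥-elim (¬b tt)
    false≤ false _  = z≤n

  ⟦⟧≤ : ∀ b {n} → (T b → 1 ≤ n) → ⟦ b ⟧ ≤ n
  ⟦⟧≤ true  h = h tt
  ⟦⟧≤ false h = z≤n

  true! : ∀ {b} → b ≡ true → T b
  true! refl = tt

  module Weights (N : ℕ) (N>0 : 0 < N) where

    private instance
      N≢0 : NonZero N
      N≢0 = >-nonZero N>0

    Small : (Fin 4 → ℕ) → Set
    Small p = ∀ a → p a < N

    Pairs : (p q : Fin 4 → ℕ) → (Fin 4 → Fin 4 → Bool) → Set
    Pairs p q t = ∀ {a b} → T (t a b) → N ≤ p a + q b

    Pairs-swap : ∀ {p q t} → Pairs p q t → Pairs q p (λ b a → t a b)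
    Pairs-swap {p} {q} h {b} {a} tab = ≤-trans (h tab) (≤-reflexive (+-comm (p a) (q b)))

    pair≤ : ∀ {p : Fin 4 → ℕ} → ∑₄ p ≤ N → ∀ {a b} → a ≢ b → p a + p b ≤ N
    pair≤ {p} p≤ {a} {b} a≢b = ≤-trans (≤-reflexive (cong (p a +_) (sym (+-identityʳ (p b)))))
      (≤-trans (∑-⊆ {xs = a ∷ b ∷ []} p ((a≢b ∷ []) ∷ [] ∷ []) (λ _ → ∈-allFin _)) p≤)

    triple≤ : ∀ {p : Fin 4 → ℕ} → ∑₄ p ≤ N → ∀ {a b x} → a ≢ b → x ≢ a → x ≢ b → p a + p b + p x ≤ N
    triple≤ {p} p≤ {a} {b} {x} a≢b x≢a x≢b = ≤-trans (≤-reflexive (eq (p a) (p b) (p x)))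
      (≤-trans (∑-⊆ {xs = x ∷ a ∷ b ∷ []} p ((x≢a ∷ x≢b ∷ []) ∷ (a≢b ∷ []) ∷ [] ∷ []) (λ _ → ∈-allFin _)) p≤)
      where
      eq : ∀ a b x → a + b + x ≡ x + (a + (b + 0))
      eq = solve-∀

    heavy⇒zero : ∀ {p : Fin 4 → ℕ} → ∑₄ p ≤ N → ∀ {a} → N ≤ p a → ∀ x → x ≢ a → p x ≡ 0
    heavy⇒zero {p} p≤ {a} N≤pa x x≢a = n≤0⇒n≡0 (+-cancelˡ-≤ N (p x) 0 (begin
      N + p x    ≤⟨ +-monoˡ-≤ (p x) N≤pa ⟩
      p a + p x  ≤⟨ pair≤ {p} p≤ (≢-sym x≢a) ⟩
      N          ≡⟨ +-identityʳ N ⟨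
      N + 0      ∎))
      where open ≤-Reasoning

    Star : (Fin 4 → ℕ) → Set
    Star p = ∃[ a ] 2 * N ≤ 3 * p a

    SupportedOnTwo : (Fin 4 → ℕ) → Set
    SupportedOnTwo p = ∃[ a ] ∃[ a′ ] (∀ x → x ≢ a → x ≢ a′ → p x ≡ 0)

    -- The alternatives record how the weight is concentrated once there are more than two heavy
    -- pairs; each of them lowers the bound on triples.
    Structure : (p q : Fin 4 → ℕ) (t : Fin 4 → Fin 4 → Bool) → Set
    Structure p q t = ∑∑ t ≤ 4 × (∑∑ t ≤ 2 ⊎ Star p ⊎ Star q ⊎ SupportedOnTwo p)

    -- Two disjoint heavy pairs weigh at least `2 * N`, which exhausts the weight of both copies.
    matched-pairs⇒zero : ∀ {p q : Fin 4 → ℕ} → ∑₄ p ≤ N → ∑₄ q ≤ N → ∀ {a a′ b b′} → a ≢ a′ → b ≢ b′ →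
      N ≤ p a + q b → N ≤ p a′ + q b′ → ∀ x → x ≢ a → x ≢ a′ → p x ≡ 0
    matched-pairs⇒zero {p} {q} p≤ q≤ {a} {a′} {b} {b′} a≢a′ b≢b′ h h′ x x≢a x≢a′ =
      n≤0⇒n≡0 (lin 0 (+-mono-≤ (+-mono-≤ h h′) (+-mono-≤ (triple≤ {p} p≤ a≢a′ x≢a x≢a′) (pair≤ {q} q≤ b≢b′)))
        (eq (p a) (p a′) (p x) (q b) (q b′) N))
      where
      eq : ∀ a a′ x b b′ N → x + (a + b + (a′ + b′) + (N + N)) + 0 ≡ 0 + (N + N + (a + a′ + x + (b + b′)))
      eq = solve-∀

    -- All pairs share the vertex `a₀`, so there are at most four. If there are `k` of them, summing
    -- their weights gives `k * N ≤ k * p a₀ + N`, and `k ≥ 3` then puts two thirds of `N` on `a₀`.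
    fewRows : ∀ {p q : Fin 4 → ℕ} {t} → ∑₄ p ≤ N → ∑₄ q ≤ N → Small p → Pairs p q t → ∀ a₀ →
              (∀ a b → T (t a b) → a ≡ a₀) → ∑∑ t ≤ 4 × (∑∑ t ≤ 2 ⊎ Star p)
    fewRows {p} {q} {t} p≤ q≤ small h a₀ row = ≤-trans ∑≤row (∑⟦⟧≤4 (t a₀)) , star (k ≤? 2)
      where
      open ≤-Reasoning
      k : ℕ
      k = ∑₄ (λ b → ⟦ t a₀ b ⟧)

      ∑≤row : ∑∑ t ≤ k
      ∑≤row = begin
        ∑∑ t                                            ≡⟨ ∑-remove a₀ (λ a → ∑₄ (λ b → ⟦ t a b ⟧)) ⟩
        k + ∑₃ (λ i → ∑₄ (λ b → ⟦ t (punchIn a₀ i) b ⟧)) ≤⟨ +-monoʳ-≤ k (∑-≤const (allFin 3) 0 other) ⟩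
        k + 0                                           ≡⟨ +-identityʳ k ⟩
        k                                               ∎
        where
        other : ∀ i → ∑₄ (λ b → ⟦ t (punchIn a₀ i) b ⟧) ≤ 0
        other i = ∑-≤const (allFin 4) 0 (λ b → ⟦⟧≤ (t (punchIn a₀ i) b) λ tab → ⊥-elim (punchInᵢ≢i a₀ i (row _ b tab)))

      k*N : k * N ≤ k * p a₀ + N
      k*N = begin
        k * N                                            ≡⟨ *-comm k N ⟩
        N * k                                            ≡⟨ ∑-* N (allFin 4) (λ b → ⟦ t a₀ b ⟧) ⟨
        ∑₄ (λ b → N * ⟦ t a₀ b ⟧)                        ≤⟨ ∑-mono (allFin 4) pointwise ⟩
        ∑₄ (λ b → p a₀ * ⟦ t a₀ b ⟧ + q b)               ≡⟨ ∑-+ (allFin 4) (λ b → p a₀ * ⟦ t a₀ b ⟧) q ⟩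
        ∑₄ (λ b → p a₀ * ⟦ t a₀ b ⟧) + ∑₄ q              ≡⟨ cong (_+ ∑₄ q) (trans (∑-* (p a₀) (allFin 4) (λ b → ⟦ t a₀ b ⟧)) (*-comm (p a₀) k)) ⟩
        k * p a₀ + ∑₄ q                                  ≤⟨ +-monoʳ-≤ (k * p a₀) q≤ ⟩
        k * p a₀ + N                                     ∎
        where
        pointwise : ∀ b → N * ⟦ t a₀ b ⟧ ≤ p a₀ * ⟦ t a₀ b ⟧ + q b
        pointwise b with t a₀ b in eq
        ... | true  = subst₂ (λ x y → x ≤ y + q b) (sym (*-identityʳ N)) (sym (*-identityʳ (p a₀))) (h (Equivalence.from T-≡ eq))
        ... | false = ≤-trans (≤-reflexive (*-zeroʳ N)) z≤n

      star : Dec (k ≤ 2) → ∑∑ t ≤ 2 ⊎ Star p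
      star (yes k≤2) = inj₁ (≤-trans ∑≤row k≤2)
      star (no k≰2) with m≤n⇒∃[o]m+o≡n (≰⇒> k≰2) | m≤n⇒∃[o]m+o≡n (<⇒≤ (small a₀))
      ... | j , 3+j≡k | g , p+g≡N = inj₂ (a₀ , lin (j * g) k*N (subst₂ (λ k N →
          2 * N + (k * p a₀ + N) + j * g ≡ 3 * p a₀ + k * N) 3+j≡k p+g≡N (eq (p a₀) g j)))
        where
        eq : ∀ p g j → 2 * (p + g) + ((3 + j) * p + (p + g)) + j * g ≡ 3 * p + (3 + j) * (p + g)
        eq = solve-∀

    -- Either two heavy pairs are disjoint, and `matched-pairs⇒zero` confines both weights to two
    -- vertices each, or any two heavy pairs meet, and then all of them share one vertex on one of
    -- the two sides.
    pair-structure : ∀ {p q : Fin 4 → ℕ} {t} → ∑₄ p ≤ N → ∑₄ q ≤ N → Small p → Small q → Pairs p q t → Structure p q t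
    pair-structure {p} {q} {t} p≤ q≤ sp sq h
      with any? (λ a → any? λ b → any? λ a′ → any? λ b′ →
             (T? (t a b) ×-dec T? (t a′ b′)) ×-dec (¬? (a ≟F a′) ×-dec ¬? (b ≟F b′)))
    ... | yes (a , b , a′ , b′ , (tab , tab′) , a≢a′ , b≢b′) = ∑∑≤4 , inj₂ (inj₂ (inj₂ (a , a′ , pzero)))
      where
      open ≤-Reasoning
      pzero : ∀ x → x ≢ a → x ≢ a′ → p x ≡ 0
      pzero = matched-pairs⇒zero p≤ q≤ a≢a′ b≢b′ (h tab) (h tab′)
      qzero : ∀ y → y ≢ b → y ≢ b′ → q y ≡ 0
      qzero = matched-pairs⇒zero q≤ p≤ b≢b′ a≢a′ (Pairs-swap {p} {q} {t} h tab) (Pairs-swap {p} {q} {t} h tab′)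

      row : ∀ x → ∑₄ (λ y → ⟦ t x y ⟧) ≤ 2
      row x = ∑≤except 0 1 b b′ _ (λ y → ⟦⟧≤1 (t x y)) (λ y y≢b y≢b′ → ⟦⟧≤ (t x y) λ txy →
        ⊥-elim (<⇒≱ (sp x) (≤-trans (h txy) (≤-reflexive (trans (cong (p x +_) (qzero y y≢b y≢b′)) (+-identityʳ (p x)))))))

      ∑∑≤4 : ∑∑ t ≤ 4
      ∑∑≤4 = ∑≤except 0 2 a a′ _ row (λ x x≢a x≢a′ → ∑-≤const (allFin 4) 0 λ y → ⟦⟧≤ (t x y) λ txy →
        ⊥-elim (<⇒≱ (sq y) (≤-trans (h txy) (≤-reflexive (cong (_+ q y) (pzero x x≢a x≢a′))))))
    ... | no ∄match with any? (λ a → any? λ b → T? (t a b))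
    ...   | no ∄ = ≤-trans ∑∑≤0 z≤n , inj₁ (≤-trans ∑∑≤0 z≤n)
      where
      ∑∑≤0 : ∑∑ t ≤ 0
      ∑∑≤0 = ∑-≤const (allFin 4) 0 λ a → ∑-≤const (allFin 4) 0 λ b → ⟦⟧≤ (t a b) λ tab → ⊥-elim (∄ (a , b , tab))
    -- A second pair through `b₀` forces all pairs through `b₀`; without one, all of them pass
    -- through `a₀`.
    ...   | yes (a₀ , b₀ , t₀) with any? (λ x → ¬? (x ≟F a₀) ×-dec T? (t x b₀))
    ...     | no ∄x with fewRows {p} {q} {t} p≤ q≤ sp h a₀ row
      where
      row : ∀ a b → T (t a b) → a ≡ a₀
      row a b tab with a ≟F a₀ | b ≟F b₀
      ... | yes eq | _ = eq
      ... | no a≢a₀ | yes refl = ⊥-elim (∄x (a , a≢a₀ , tab))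
      ... | no a≢a₀ | no b≢b₀ = ⊥-elim (∄match (a , b , a₀ , b₀ , (tab , t₀) , a≢a₀ , b≢b₀))
    ...       | ≤4 , inj₁ ≤2 = ≤4 , inj₁ ≤2
    ...       | ≤4 , inj₂ st = ≤4 , inj₂ (inj₁ st)
    pair-structure {p} {q} {t} p≤ q≤ sp sq h | no ∄match | yes (a₀ , b₀ , t₀) | yes (x , x≢a₀ , tx)
      with fewRows {q} {p} {λ b a → t a b} q≤ p≤ sq (Pairs-swap {p} {q} {t} h) b₀ column
      where
      column : ∀ b a → T (t a b) → b ≡ b₀
      column b a tab with b ≟F b₀ | a ≟F a₀
      ... | yes eq | _ = eq
      ... | no b≢b₀ | no a≢a₀ = ⊥-elim (∄match (a , b , a₀ , b₀ , (tab , t₀) , a≢a₀ , b≢b₀))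
      ... | no b≢b₀ | yes refl = ⊥-elim (∄match (a₀ , b , x , b₀ , (tab , tx) , ≢-sym x≢a₀ , b≢b₀))
    ... | ≤4 , inj₁ ≤2 = subst (_≤ 4) (sym (∑∑-swap t)) ≤4 , inj₁ (subst (_≤ 2) (sym (∑∑-swap t)) ≤2)
    ... | ≤4 , inj₂ st = subst (_≤ 4) (sym (∑∑-swap t)) ≤4 , inj₂ (inj₂ (inj₁ st))

    small? : ∀ p → (∃[ a ] N ≤ p a) ⊎ Small p
    small? p with any? (λ a → N ≤? p a)
    ... | yes heavy = inj₁ heavy
    ... | no ¬heavy = inj₂ (λ a → ≰⇒> λ N≤ → ¬heavy (a , N≤))

    singles≤1 : ∀ {p : Fin 4 → ℕ} (t : Fin 4 → Bool) → ∑₄ p ≤ N → (∀ {a} → T (t a) → N ≤ p a) → ∑₄ (λ a → ⟦ t a ⟧) ≤ 1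
    singles≤1 {p} t p≤ h with any? (λ a → T? (t a))
    ... | no ∄ = ≤-trans (∑-≤const (allFin 4) 0 λ a → ⟦⟧≤ (t a) λ ta → ⊥-elim (∄ (a , ta))) z≤n
    ... | yes (a , ta) = begin
      ∑₄ (λ x → ⟦ t x ⟧)                             ≡⟨ ∑-remove a (λ x → ⟦ t x ⟧) ⟩
      ⟦ t a ⟧ + ∑₃ (λ i → ⟦ t (punchIn a i) ⟧)       ≤⟨ +-mono-≤ (⟦⟧≤1 (t a)) (∑-≤const (allFin 3) 0 other) ⟩
      1                                              ∎
      where
      open ≤-Reasoning
      other : ∀ i → ⟦ t (punchIn a i) ⟧ ≤ 0
      other i = ⟦⟧≤ (t (punchIn a i)) λ ti → ⊥-elim (<⇒≱ N>0
        (≤-trans (h ti) (≤-reflexive (heavy⇒zero {p} p≤ (h ta) _ (punchInᵢ≢i a i)))))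

    -- A vertex of full weight leaves zero elsewhere in its copy, so a heavy pair avoiding it needs
    -- a vertex of full weight in the other copy, and there is at most one. This gives `4 + 3 * 1`.
    heavy⇒pairs≤7 : ∀ {p q : Fin 4 → ℕ} {t} → ∑₄ p ≤ N → ∑₄ q ≤ N → Pairs p q t → ∀ {a} → N ≤ p a → ∑∑ t ≤ 7
    heavy⇒pairs≤7 {p} {q} {t} p≤ q≤ h {a} N≤pa = begin
      ∑∑ t                                                         ≡⟨ ∑-remove a (λ x → ∑₄ (λ b → ⟦ t x b ⟧)) ⟩
      ∑₄ (λ b → ⟦ t a b ⟧) + ∑₃ (λ i → ∑₄ (λ b → ⟦ t (punchIn a i) b ⟧)) ≤⟨ +-mono-≤ (∑⟦⟧≤4 (t a)) (∑-≤const (allFin 3) 1 other) ⟩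
      7                                                            ∎
      where
      open ≤-Reasoning
      other : ∀ i → ∑₄ (λ b → ⟦ t (punchIn a i) b ⟧) ≤ 1
      other i = singles≤1 (t (punchIn a i)) q≤ λ {b} tib →
        ≤-trans (h tib) (≤-reflexive (cong (_+ q b) (heavy⇒zero {p} p≤ N≤pa _ (punchInᵢ≢i a i))))

    pairs≤7 : ∀ {p q : Fin 4 → ℕ} {t} → ∑₄ p ≤ N → ∑₄ q ≤ N → Pairs p q t → ∑∑ t ≤ 7
    pairs≤7 {p} {q} {t} p≤ q≤ h with small? p | small? q
    ... | inj₁ (a , N≤pa) | _ = heavy⇒pairs≤7 {p} {q} {t} p≤ q≤ h N≤pa
    ... | inj₂ _ | inj₁ (b , N≤qb) = subst (_≤ 7) (sym (∑∑-swap t))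
      (heavy⇒pairs≤7 {q} {p} {λ b a → t a b} q≤ p≤ (Pairs-swap {p} {q} {t} h) N≤qb)
    ... | inj₂ sp | inj₂ sq = ≤-trans (proj₁ (pair-structure {p} {q} {t} p≤ q≤ sp sq h)) (m≤m+n 4 3)

    -- In a blow-up an edge yields three kinds of `Y32`, according to which of its three vertices is
    -- taken twice; each kind has to weigh at least `N`.
    Triples : (p q r : Fin 4 → ℕ) → (Fin 4 → Fin 4 → Fin 4 → Bool) → Set
    Triples p q r t = ∀ {a b c} → T (t a b c) →
      N ≤ p a + (q b + r c) + p a × N ≤ p a + (q b + r c) + q b × N ≤ p a + (q b + r c) + r c

    rotate : (Fin 4 → Fin 4 → Fin 4 → Bool) → (Fin 4 → Fin 4 → Fin 4 → Bool)
    rotate t b c a = t a b c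

    ∑∑∑-rotate : ∀ t → ∑∑∑ t ≡ ∑∑∑ (rotate t)
    ∑∑∑-rotate t = trans (∑-swap (allFin 4) (allFin 4) (λ a b → ∑₄ (λ c → ⟦ t a b c ⟧)))
      (∑-cong (allFin 4) λ b → ∑-swap (allFin 4) (allFin 4) (λ a c → ⟦ t a b c ⟧))

    Triples-rotate : ∀ {p q r t} → Triples p q r t → Triples q r p (rotate t)
    Triples-rotate {p} {q} {r} h {b} {c} {a} tabc with h tabc
    ... | hp , hq , hr = go hq , go hr , go hp
      where
      go : ∀ {x} → N ≤ p a + (q b + r c) + x → N ≤ q b + (r c + p a) + x
      go {x} le = ≤-trans le (≤-reflexive (eq (p a) (q b) (r c) x))
        where
        eq : ∀ a b c x → a + (b + c) + x ≡ b + (c + a) + x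
        eq = solve-∀

    -- One vertex of weight ρ against three disjoint pairs of total weight at most N.
    matching-bound : ∀ (u v : Fin 3 → ℕ) ρ (s : Fin 3 → Bool) → ∑₃ u + ∑₃ v ≤ N →
      (∀ i → T (s i) → N ≤ ρ + (u i + v i) + ρ × N ≤ ρ + (u i + v i) + u i × N ≤ ρ + (u i + v i) + v i) →
      ∑₃ (λ i → ⟦ s i ⟧) * N ≤ N + 4 * ρ
    matching-bound u v ρ s uv≤N h
      with s zero in e₀ | s (suc zero) in e₁ | s (suc (suc zero)) in e₂
    ... | false | false | false = z≤n
    ... | true  | false | false = ≤-trans (≤-reflexive (+-identityʳ N)) (m≤m+n N _)
    ... | false | true  | false = ≤-trans (≤-reflexive (+-identityʳ N)) (m≤m+n N _)
    ... | false | false | true  = ≤-trans (≤-reflexive (+-identityʳ N)) (m≤m+n N _)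
    ... | true  | true  | false =
      lin (u (suc (suc zero)) + v (suc (suc zero))) (+-mono-≤ uv≤N (+-mono-≤ (proj₁ (h zero (true! e₀))) (proj₁ (h (suc zero) (true! e₁)))))
        (eq N ρ (u zero) (u (suc zero)) (u (suc (suc zero))) (v zero) (v (suc zero)) (v (suc (suc zero))))
      where
      eq : ∀ N ρ u₀ u₁ u₂ v₀ v₁ v₂ →
        (N + (N + 0)) + (N + ((ρ + (u₀ + v₀) + ρ) + (ρ + (u₁ + v₁) + ρ))) + (u₂ + v₂)
        ≡ N + 4 * ρ + ((u₀ + (u₁ + (u₂ + 0))) + (v₀ + (v₁ + (v₂ + 0))) + (N + N))
      eq = solve-∀
    ... | true  | false | true  =
      lin (u (suc zero) + v (suc zero)) (+-mono-≤ uv≤N (+-mono-≤ (proj₁ (h zero (true! e₀))) (proj₁ (h (suc (suc zero)) (true! e₂)))))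
        (eq N ρ (u zero) (u (suc zero)) (u (suc (suc zero))) (v zero) (v (suc zero)) (v (suc (suc zero))))
      where
      eq : ∀ N ρ u₀ u₁ u₂ v₀ v₁ v₂ →
        (N + (N + 0)) + (N + ((ρ + (u₀ + v₀) + ρ) + (ρ + (u₂ + v₂) + ρ))) + (u₁ + v₁)
        ≡ N + 4 * ρ + ((u₀ + (u₁ + (u₂ + 0))) + (v₀ + (v₁ + (v₂ + 0))) + (N + N))
      eq = solve-∀
    ... | false | true  | true  =
      lin (u zero + v zero) (+-mono-≤ uv≤N (+-mono-≤ (proj₁ (h (suc zero) (true! e₁))) (proj₁ (h (suc (suc zero)) (true! e₂)))))
        (eq N ρ (u zero) (u (suc zero)) (u (suc (suc zero))) (v zero) (v (suc zero)) (v (suc (suc zero))))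
      where
      eq : ∀ N ρ u₀ u₁ u₂ v₀ v₁ v₂ →
        (N + (N + 0)) + (N + ((ρ + (u₁ + v₁) + ρ) + (ρ + (u₂ + v₂) + ρ))) + (u₀ + v₀)
        ≡ N + 4 * ρ + ((u₀ + (u₁ + (u₂ + 0))) + (v₀ + (v₁ + (v₂ + 0))) + (N + N))
      eq = solve-∀
    -- With all three edges, doubling the vertex of weight `ρ` would only give `3 * N ≤ N + 6 * ρ`.
    -- Doubling its partners instead gives `N ≤ 2 * ρ`, which is enough.
    ... | true  | true  | true  = *-cancelˡ-≤ 3 (lin 0
      (+-mono-≤ (*-monoʳ-≤ 6 uv≤N) (*-monoʳ-≤ 2 (+-mono-≤ (each zero (true! e₀)) (+-mono-≤ (each (suc zero) (true! e₁)) (each (suc (suc zero)) (true! e₂))))))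
        (eq N ρ (u zero) (u (suc zero)) (u (suc (suc zero))) (v zero) (v (suc zero)) (v (suc (suc zero)))))
      where
      each : ∀ i → T (s i) → N + N ≤ (ρ + (u i + v i) + u i) + (ρ + (u i + v i) + v i)
      each i si = +-mono-≤ (proj₁ (proj₂ (h i si))) (proj₂ (proj₂ (h i si)))
      eq : ∀ N ρ u₀ u₁ u₂ v₀ v₁ v₂ →
        3 * (N + (N + (N + 0))) + (6 * N + 2 * (((ρ + (u₀ + v₀) + u₀) + (ρ + (u₀ + v₀) + v₀)) +
           (((ρ + (u₁ + v₁) + u₁) + (ρ + (u₁ + v₁) + v₁)) + ((ρ + (u₂ + v₂) + u₂) + (ρ + (u₂ + v₂) + v₂))))) + 0
        ≡ 3 * (N + 4 * ρ) + (6 * ((u₀ + (u₁ + (u₂ + 0))) + (v₀ + (v₁ + (v₂ + 0)))) + 2 * ((N + N) + ((N + N) + (N + N))))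
      eq = solve-∀

    -- Seven pairs contain `b₀` or `c₀`. As these two weigh at least `N`, at most `N` is left on the
    -- other vertices, whose nine pairs split into three matchings along the cyclic diagonals;
    -- `matching-bound` applies to each.
    slice-bound : ∀ {p q r : Fin 4 → ℕ} {t} → ∑₄ q ≤ N → ∑₄ r ≤ N → Triples p q r t → ∀ {b₀ c₀} → N ≤ q b₀ + r c₀ →
                  ∀ a → ∑∑ (t a) * N ≤ 10 * N + 12 * p a
    slice-bound {p} {q} {r} {t} q≤ r≤ h {b₀} {c₀} heavy a = begin
      ∑∑ (t a) * N                            ≤⟨ *-monoˡ-≤ N outside ⟩
      (7 + nine) * N                          ≡⟨ *-distribʳ-+ N 7 nine ⟩
      7 * N + nine * N                        ≡⟨ cong (λ s → 7 * N + s * N) split ⟩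
      7 * N + (m₀ + (m₁ + m₂)) * N            ≡⟨ cong (7 * N +_) (trans (*-distribʳ-+ N m₀ (m₁ + m₂)) (cong (m₀ * N +_) (*-distribʳ-+ N m₁ m₂))) ⟩
      7 * N + (m₀ * N + (m₁ * N + m₂ * N))    ≤⟨ +-monoʳ-≤ (7 * N) (+-mono-≤ (bound (λ i → i) refl) (+-mono-≤
                                                   (bound cyc (cyc-∑ (v zero) (v (suc zero)) (v (suc (suc zero)))))
                                                   (bound (cyc ∘ cyc) (cyc²-∑ (v zero) (v (suc zero)) (v (suc (suc zero))))))) ⟩
      7 * N + (N + 4 * p a + (N + 4 * p a + (N + 4 * p a))) ≡⟨ eq N (p a) ⟩
      10 * N + 12 * p a                       ∎
      where
      open ≤-Reasoning
      u v : Fin 3 → ℕ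
      u i = q (punchIn b₀ i)
      v i = r (punchIn c₀ i)

      s : Fin 3 → Fin 3 → Bool
      s i j = t a (punchIn b₀ i) (punchIn c₀ j)

      uv≤N : ∑₃ u + ∑₃ v ≤ N
      uv≤N = lin 0 (+-mono-≤ heavy (+-mono-≤ (subst (_≤ N) (∑-remove b₀ q) q≤) (subst (_≤ N) (∑-remove c₀ r) r≤)))
        (rearrange (∑₃ u) (∑₃ v) N (q b₀) (r c₀))
        where
        rearrange : ∀ u v N q r → u + v + (q + r + (N + N)) + 0 ≡ N + (N + (q + u + (r + v)))
        rearrange = solve-∀

      cyc : Fin 3 → Fin 3
      cyc zero             = suc zero
      cyc (suc zero)       = suc (suc zero)
      cyc (suc (suc zero)) = zero

      cyc-∑ : ∀ a b c → b + (c + (a + 0)) ≡ a + (b + (c + 0))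
      cyc-∑ = solve-∀
      cyc²-∑ : ∀ a b c → c + (a + (b + 0)) ≡ a + (b + (c + 0))
      cyc²-∑ = solve-∀

      nine m₀ m₁ m₂ : ℕ
      nine = ∑₃ (λ i → ∑₃ (λ j → ⟦ s i j ⟧))
      m₀ = ∑₃ (λ i → ⟦ s i i ⟧)
      m₁ = ∑₃ (λ i → ⟦ s i (cyc i) ⟧)
      m₂ = ∑₃ (λ i → ⟦ s i (cyc (cyc i)) ⟧)

      split : nine ≡ m₀ + (m₁ + m₂)
      split = diagonals ⟦ s zero zero ⟧ ⟦ s zero (suc zero) ⟧ ⟦ s zero (suc (suc zero)) ⟧
                        ⟦ s (suc zero) zero ⟧ ⟦ s (suc zero) (suc zero) ⟧ ⟦ s (suc zero) (suc (suc zero)) ⟧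
                        ⟦ s (suc (suc zero)) zero ⟧ ⟦ s (suc (suc zero)) (suc zero) ⟧ ⟦ s (suc (suc zero)) (suc (suc zero)) ⟧
        where
        diagonals : ∀ x₀ x₁ x₂ y₀ y₁ y₂ z₀ z₁ z₂ →
          (x₀ + (x₁ + (x₂ + 0))) + ((y₀ + (y₁ + (y₂ + 0))) + ((z₀ + (z₁ + (z₂ + 0))) + 0))
          ≡ (x₀ + (y₁ + (z₂ + 0))) + ((x₁ + (y₂ + (z₀ + 0))) + (x₂ + (y₀ + (z₁ + 0))))
        diagonals = solve-∀

      bound : (σ : Fin 3 → Fin 3) → ∑₃ (v ∘ σ) ≡ ∑₃ v → ∑₃ (λ i → ⟦ s i (σ i) ⟧) * N ≤ N + 4 * p a
      bound σ eq = matching-bound u (v ∘ σ) (p a) (λ i → s i (σ i))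
        (subst (λ x → ∑₃ u + x ≤ N) (sym eq) uv≤N) (λ i → h {a})

      outside : ∑∑ (t a) ≤ 7 + nine
      outside = begin
        ∑∑ (t a)                                          ≡⟨ ∑-remove b₀ (λ b → ∑₄ (λ c → ⟦ t a b c ⟧)) ⟩
        ∑₄ (λ c → ⟦ t a b₀ c ⟧) + ∑₃ (λ i → ∑₄ (λ c → ⟦ t a (punchIn b₀ i) c ⟧))
          ≤⟨ +-mono-≤ (∑⟦⟧≤4 (t a b₀)) (∑-mono (allFin 3) (λ i → ≤-trans
               (≤-reflexive (∑-remove c₀ (λ c → ⟦ t a (punchIn b₀ i) c ⟧)))
               (+-monoˡ-≤ (∑₃ (λ j → ⟦ s i j ⟧)) (⟦⟧≤1 (t a (punchIn b₀ i) c₀))))) ⟩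
        4 + ∑₃ (λ i → 1 + ∑₃ (λ j → ⟦ s i j ⟧))           ≡⟨ cong (4 +_) (∑-+ (allFin 3) (λ _ → 1) (λ i → ∑₃ (λ j → ⟦ s i j ⟧))) ⟩
        7 + nine                                          ∎

      eq : ∀ N x → 7 * N + (N + 4 * x + (N + 4 * x + (N + 4 * x))) ≡ 10 * N + 12 * x
      eq = solve-∀

    -- Summing the slices gives `4 * 10 + 12`, as the weights `p a` add up to at most `N`.
    triples≤52 : ∀ {p q r : Fin 4 → ℕ} {t} → ∑₄ p ≤ N → ∑₄ q ≤ N → ∑₄ r ≤ N → Triples p q r t →
                 ∀ {b c} → N ≤ q b + r c → ∑∑∑ t ≤ 52
    triples≤52 {p} {q} {r} {t} p≤ q≤ r≤ h heavy = *-cancelʳ-≤ (∑∑∑ t) 52 N (begin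
      ∑∑∑ t * N                                ≡⟨ *-comm (∑∑∑ t) N ⟩
      N * ∑∑∑ t                                ≡⟨ ∑-* N (allFin 4) (λ a → ∑∑ (t a)) ⟨
      ∑₄ (λ a → N * ∑∑ (t a))                  ≤⟨ ∑-mono (allFin 4) (λ a → ≤-trans (≤-reflexive (*-comm N (∑∑ (t a)))) (slice-bound {p} {q} {r} {t} q≤ r≤ h heavy a)) ⟩
      ∑₄ (λ a → 10 * N + 12 * p a)             ≡⟨ ∑-+ (allFin 4) (λ _ → 10 * N) (λ a → 12 * p a) ⟩
      ∑₄ (λ _ → 10 * N) + ∑₄ (λ a → 12 * p a)  ≡⟨ cong₂ _+_ (∑-const (10 * N) (allFin 4)) (∑-* 12 (allFin 4) p) ⟩
      4 * (10 * N) + 12 * ∑₄ p                 ≤⟨ +-monoʳ-≤ (4 * (10 * N)) (*-monoʳ-≤ 12 p≤) ⟩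
      4 * (10 * N) + 12 * N                    ≡⟨ eq N ⟩
      52 * N                                   ∎)
      where
      open ≤-Reasoning
      eq : ∀ N → 4 * (10 * N) + 12 * N ≡ 52 * N
      eq = solve-∀

    -- The slice at the centre of the star is bounded by 16 instead, and the other three slices
    -- share at most a third of `N`: `16 + 3 * 10 + 4`.
    star⇒triples≤50 : ∀ {p q r : Fin 4 → ℕ} {t} → ∑₄ p ≤ N → ∑₄ q ≤ N → ∑₄ r ≤ N → Triples p q r t →
                 ∀ {b c} → N ≤ q b + r c → Star p → ∑∑∑ t ≤ 50
    star⇒triples≤50 {p} {q} {r} {t} p≤ q≤ r≤ h heavy (a₀ , 2N≤3p) = *-cancelʳ-≤ (∑∑∑ t) 50 N (begin
      ∑∑∑ t * N                                ≡⟨ cong (_* N) (∑-remove a₀ (λ a → ∑∑ (t a))) ⟩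
      (∑∑ (t a₀) + others) * N                 ≤⟨ *-monoˡ-≤ N (+-monoˡ-≤ others (∑∑≤16 (t a₀))) ⟩
      (16 + others) * N                        ≡⟨ trans (*-distribʳ-+ N 16 others) (cong (16 * N +_) (*-comm others N)) ⟩
      16 * N + N * others                      ≡⟨ cong (16 * N +_) (∑-* N (allFin 3) (λ i → ∑∑ (t (punchIn a₀ i)))) ⟨
      16 * N + ∑₃ (λ i → N * ∑∑ (t (punchIn a₀ i)))
        ≤⟨ +-monoʳ-≤ (16 * N) (∑-mono (allFin 3) (λ i → ≤-trans (≤-reflexive (*-comm N (∑∑ (t (punchIn a₀ i))))) (slice-bound {p} {q} {r} {t} q≤ r≤ h heavy (punchIn a₀ i)))) ⟩
      16 * N + ∑₃ (λ i → 10 * N + 12 * p (punchIn a₀ i))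
        ≡⟨ cong (16 * N +_) (trans (∑-+ (allFin 3) (λ _ → 10 * N) (λ i → 12 * p (punchIn a₀ i)))
             (cong₂ _+_ (∑-const (10 * N) (allFin 3)) (∑-* 12 (allFin 3) (p ∘ punchIn a₀)))) ⟩
      16 * N + (3 * (10 * N) + 12 * p′)        ≤⟨ lin 0 (+-mono-≤ (*-monoʳ-≤ 4 2N≤3p) (*-monoʳ-≤ 12 p+p′≤N)) (eq N (p a₀) p′) ⟩
      50 * N                                   ∎)
      where
      open ≤-Reasoning
      others p′ : ℕ
      others = ∑₃ (λ i → ∑∑ (t (punchIn a₀ i)))
      p′ = ∑₃ (p ∘ punchIn a₀)

      p+p′≤N : p a₀ + p′ ≤ N
      p+p′≤N = subst (_≤ N) (∑-remove a₀ p) p≤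

      eq : ∀ N p p′ → 16 * N + (3 * (10 * N) + 12 * p′) + (4 * (3 * p) + 12 * N) + 0 ≡ 50 * N + (4 * (2 * N) + 12 * (p + p′))
      eq = solve-∀

    zero-slice : ∀ {p q r : Fin 4 → ℕ} {t} → Triples p q r t → ∀ {a} → p a ≡ 0 → Pairs q r (t a)
    zero-slice {p} {q} {r} h {a} pa≡0 {b} {c} tabc = ≤-trans (proj₁ (h tabc))
      (≤-reflexive (trans (cong (λ x → x + (q b + r c) + x) pa≡0) (+-identityʳ (q b + r c))))

    -- Two slices have at most 16 edges each. In the other two `p` vanishes, so their edges are
    -- heavy pairs between `q` and `r`, at most four by `pair-structure`.
    twoSupported⇒triples≤40 : ∀ {p q r : Fin 4 → ℕ} {t} → ∑₄ q ≤ N → ∑₄ r ≤ N → Small q → Small r →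
      Triples p q r t → SupportedOnTwo p → ∑∑∑ t ≤ 40
    twoSupported⇒triples≤40 {p} {q} {r} {t} q≤ r≤ sq sr h (a , a′ , pzero) =
      ∑≤except 4 12 a a′ (λ x → ∑∑ (t x)) (λ x → ∑∑≤16 (t x)) λ x x≢a x≢a′ →
        proj₁ (pair-structure {q} {r} {t x} q≤ r≤ sq sr (zero-slice {p} {q} {r} {t} h (pzero x x≢a x≢a′)))

    -- Away from the vertex of full weight the slices consist of heavy pairs, hence `16 + 3 * 7`.
    heavy⇒triples≤37 : ∀ {p q r : Fin 4 → ℕ} {t} → ∑₄ p ≤ N → ∑₄ q ≤ N → ∑₄ r ≤ N →
      Triples p q r t → ∀ {a} → N ≤ p a → ∑∑∑ t ≤ 37
    heavy⇒triples≤37 {p} {q} {r} {t} p≤ q≤ r≤ h {a} N≤pa = begin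
      ∑∑∑ t                                       ≡⟨ ∑-remove a (λ x → ∑∑ (t x)) ⟩
      ∑∑ (t a) + ∑₃ (λ i → ∑∑ (t (punchIn a i)))  ≤⟨ +-mono-≤ (∑∑≤16 (t a)) (∑-≤const (allFin 3) 7 λ i →
        pairs≤7 {q} {r} {t (punchIn a i)} q≤ r≤ (zero-slice {p} {q} {r} {t} h (heavy⇒zero {p} p≤ N≤pa _ (punchInᵢ≢i a i)))) ⟩
      37                                          ∎
      where open ≤-Reasoning

    module _ {p q r : Fin 4 → ℕ} {t₁₂ t₁₃ t₂₃} {t} (p≤ : ∑₄ p ≤ N) (q≤ : ∑₄ q ≤ N) (r≤ : ∑₄ r ≤ N)
             (h₁₂ : Pairs p q t₁₂) (h₁₃ : Pairs p r t₁₃) (h₂₃ : Pairs q r t₂₃) (h : Triples p q r t) where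

      private
        S₂ : ℕ
        S₂ = ∑∑ t₁₂ + (∑∑ t₁₃ + ∑∑ t₂₃)

        t′ t″ : Fin 4 → Fin 4 → Fin 4 → Bool
        t′ = rotate t
        t″ = rotate t′

        h′ : Triples q r p t′
        h′ {b} {c} {a} = Triples-rotate {p} {q} {r} {t} h {b} {c} {a}

        h″ : Triples r p q t″
        h″ {c} {a} {b} = Triples-rotate {q} {r} {p} {t′} h′ {c} {a} {b}

        D′ : ∀ {k} → ∑∑∑ t′ ≤ k → ∑∑∑ t ≤ k
        D′ {k} = subst (_≤ k) (sym (∑∑∑-rotate t))

        D″ : ∀ {k} → ∑∑∑ t″ ≤ k → ∑∑∑ t ≤ k
        D″ {k} d = D′ (subst (_≤ k) (sym (∑∑∑-rotate t′)) d)

      some-heavy : (∃[ a ] N ≤ p a) ⊎ (∃[ b ] N ≤ q b) ⊎ (∃[ c ] N ≤ r c) → ∑∑∑ t ≤ 37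
      some-heavy (inj₁ (_ , N≤))        = heavy⇒triples≤37 {p} {q} {r} {t} p≤ q≤ r≤ h N≤
      some-heavy (inj₂ (inj₁ (_ , N≤))) = D′ (heavy⇒triples≤37 {q} {r} {p} {t′} q≤ r≤ p≤ h′ N≤)
      some-heavy (inj₂ (inj₂ (_ , N≤))) = D″ (heavy⇒triples≤37 {r} {p} {q} {t″} r≤ p≤ q≤ h″ N≤)

      S₂≤21 : S₂ ≤ 21
      S₂≤21 = +-mono-≤ (pairs≤7 {p} {q} {t₁₂} p≤ q≤ h₁₂)
        (+-mono-≤ (pairs≤7 {p} {r} {t₁₃} p≤ r≤ h₁₃) (pairs≤7 {q} {r} {t₂₃} q≤ r≤ h₂₃))

      heavy₂₃ : 0 < ∑∑ t₂₃ → ∃[ b ] ∃[ c ] N ≤ q b + r c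
      heavy₂₃ >0 with ∑∑>0⇒∃ t₂₃ >0
      ... | b , c , tbc = b , c , h₂₃ tbc

      heavy₁₃ : 0 < ∑∑ t₁₃ → ∃[ c ] ∃[ a ] N ≤ r c + p a
      heavy₁₃ >0 with ∑∑>0⇒∃ t₁₃ >0
      ... | a , c , tac = c , a , Pairs-swap {p} {r} {t₁₃} h₁₃ tac

      heavy₁₂ : 0 < ∑∑ t₁₂ → ∃[ a ] ∃[ b ] N ≤ p a + q b
      heavy₁₂ >0 with ∑∑>0⇒∃ t₁₂ >0
      ... | a , b , tab = a , b , h₁₂ tab

      -- 576 = 9 · 64, and 10 / 9 is just above the ratio u / m at which the two terms of extremal agree.
      all-small : Small p → Small q → Small r → 9 * ∑∑∑ t + 10 * S₂ ≤ 576
      all-small sp sq sr = byS₂ (S₂ ≤? 0) (S₂ ≤? 10)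
        where
        struct : Structure p q t₁₂
        struct = pair-structure {p} {q} {t₁₂} p≤ q≤ sp sq h₁₂

        d₁₃≤4 : ∑∑ t₁₃ ≤ 4
        d₁₃≤4 = proj₁ (pair-structure {p} {r} {t₁₃} p≤ r≤ sp sr h₁₃)

        d₂₃≤4 : ∑∑ t₂₃ ≤ 4
        d₂₃≤4 = proj₁ (pair-structure {q} {r} {t₂₃} q≤ r≤ sq sr h₂₃)

        D≤52 : 0 < S₂ → ∑∑∑ t ≤ 52
        D≤52 S₂>0 with ∑∑ t₁₂ in e₁₂ | ∑∑ t₁₃ in e₁₃
        ... | suc _ | _ = let _ , _ , heavy = heavy₁₂ (subst (0 <_) (sym e₁₂) (s≤s z≤n))
                          in D″ (triples≤52 {r} {p} {q} {t″} r≤ p≤ q≤ h″ heavy)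
        ... | zero | suc _ = let _ , _ , heavy = heavy₁₃ (subst (0 <_) (sym e₁₃) (s≤s z≤n))
                             in D′ (triples≤52 {q} {r} {p} {t′} q≤ r≤ p≤ h′ heavy)
        ... | zero | zero = let _ , _ , heavy = heavy₂₃ S₂>0
                            in triples≤52 {p} {q} {r} {t} p≤ q≤ r≤ h heavy

        weigh : ∀ {D S} k l → D ≤ k → S ≤ l → 9 * D + 10 * S ≤ 9 * k + 10 * l
        weigh k l D≤ S≤ = +-mono-≤ (*-monoʳ-≤ 9 D≤) (*-monoʳ-≤ 10 S≤)

        -- Up to ten heavy pairs, 52 triples are affordable; with eleven the total could already be
        -- 578. More than ten force more than two pairs between `p` and `q`, hence one of the
        -- concentrated forms in `Structure`.
        many : 10 < S₂ → ∑∑∑ t ≤ 50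
        many S₂>10 with proj₂ struct
        ... | inj₁ d₁₂≤2 = ⊥-elim (<⇒≱ S₂>10 (+-mono-≤ d₁₂≤2 (+-mono-≤ d₁₃≤4 d₂₃≤4)))
        -- The star bound needs a heavy pair between the two other copies; more than ten pairs do
        -- not fit into the remaining two times four.
        ... | inj₂ (inj₁ star) = let _ , _ , heavy = heavy₂₃ (positive S₂>10)
                                 in star⇒triples≤50 {p} {q} {r} {t} p≤ q≤ r≤ h heavy star
          where
          positive : 10 < S₂ → 0 < ∑∑ t₂₃
          positive S₂>10 with ∑∑ t₂₃
          ... | suc _ = s≤s z≤n
          ... | zero  = ⊥-elim (<⇒≱ S₂>10 (≤-trans (+-mono-≤ (proj₁ struct) (+-mono-≤ d₁₃≤4 (≤-refl {0}))) (m≤m+n 8 2)))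
        ... | inj₂ (inj₂ (inj₁ star)) = let _ , _ , heavy = heavy₁₃ (positive S₂>10)
                                        in D′ (star⇒triples≤50 {q} {r} {p} {t′} q≤ r≤ p≤ h′ heavy star)
          where
          positive : 10 < S₂ → 0 < ∑∑ t₁₃
          positive S₂>10 with ∑∑ t₁₃
          ... | suc _ = s≤s z≤n
          ... | zero  = ⊥-elim (<⇒≱ S₂>10 (≤-trans (+-mono-≤ (proj₁ struct) (+-mono-≤ (≤-refl {0}) d₂₃≤4)) (m≤m+n 8 2)))
        ... | inj₂ (inj₂ (inj₂ two)) = ≤-trans (twoSupported⇒triples≤40 {p} {q} {r} {t} q≤ r≤ sq sr h two) (m≤m+n 40 10)

        byS₂ : Dec (S₂ ≤ 0) → Dec (S₂ ≤ 10) → 9 * ∑∑∑ t + 10 * S₂ ≤ 576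
        byS₂ (yes S₂≤0) _ = weigh 64 0 (∑∑∑≤64 t) S₂≤0
        byS₂ (no S₂≰0) (yes S₂≤10) = ≤-trans (weigh 52 10 (D≤52 (≰⇒> S₂≰0)) S₂≤10) (m≤m+n 568 8)
        byS₂ (no S₂≰0) (no S₂≰10) = ≤-trans
          (weigh 50 12 (many (≰⇒> S₂≰10)) (+-mono-≤ (proj₁ struct) (+-mono-≤ d₁₃≤4 d₂₃≤4))) (m≤m+n 570 6)

-- Patterns of three copies and the linear programming dichotomy

module Patterns where
  open Sums
  open FourierMotzkin
  open LocalWeights

  open import Data.Integer as ℤ using (ℤ; 0ℤ; 1ℤ; -_; +_; -[1+_])
  import Data.Integer.Properties as ℤ
  import Data.Integer.Tactic.RingSolver as ℤ-Solver
  open import Data.Nat using (ℕ; zero; suc; _+_; _*_; _⊔_; _≤_; _<_; z≤n; s≤s)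
  open import Data.Nat.Properties
  open import Data.Nat.Tactic.RingSolver using (solve-∀)

  -- Which edges are present between three copies and the uncovered set: position suc a stands for the
  -- vertex a of the copy, position zero for many uncovered vertices.
  Pattern : Set
  Pattern = Fin 5 → Fin 5 → Fin 5 → Bool

  pattern ∗ = zero

  module _ {n : ℕ} where
    toVec : (Fin n → Fin n → Fin n → Bool) → Vec Bool (n * (n * n))
    toVec π = Vec.tabulate λ i → let x , yz = remQuot {n} (n * n) i ; y , z = remQuot {n} n yz in π x y z

    fromVec : Vec Bool (n * (n * n)) → Fin n → Fin n → Fin n → Bool
    fromVec v x y z = Vec.lookup v (combine x (combine y z))

    fromVec-toVec : ∀ π x y z → fromVec (toVec π) x y z ≡ π x y z
    fromVec-toVec π x y z = trans (Vec.lookup∘tabulate _ (combine x (combine y z)))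
      (trans (cong (λ p → π (proj₁ p) (proj₁ (remQuot {n} n (proj₂ p))) (proj₂ (remQuot {n} n (proj₂ p))))
               (remQuot-combine x (combine y z)))
             (cong (λ p → π x (proj₁ p) (proj₂ p)) (remQuot-combine y z)))

  maxVec : ∀ N → (Vec Bool N → ℕ) → ℕ
  maxVec zero    F = F []
  maxVec (suc N) F = maxVec N (F ∘ (true ∷_)) ⊔ maxVec N (F ∘ (false ∷_))

  ≤maxVec : ∀ N F v → F v ≤ maxVec N F
  ≤maxVec zero    F []          = ≤-refl
  ≤maxVec (suc N) F (true  ∷ v) = ≤-trans (≤maxVec N (F ∘ (true ∷_)) v) (m≤m⊔n _ _)
  ≤maxVec (suc N) F (false ∷ v) = ≤-trans (≤maxVec N (F ∘ (false ∷_)) v) (m≤n⊔m (maxVec N (F ∘ (true ∷_))) _)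

  -- The twelve unknowns of the linear program: one of three classes of copies, and a vertex
  -- position in a copy.
  Key : Set
  Key = Fin (3 * 4)

  key : Fin 3 → Fin 4 → Key
  key = combine

  group : Key → Fin 3
  group k = proj₁ (remQuot {3} 4 k)

  pattern 0F = zero
  pattern 1F = suc zero
  pattern 2F = suc (suc zero)

  -- The covered vertices, with repetition, that a `Y32` in the blow-up consumes. Uncovered vertices
  -- are free and not listed: a dense link needs one covered vertex, a large codegree two, and an
  -- edge on three copies is doubled at one of its vertices.
  data Piece (π : Pattern) : List Key → Set where
    single₀ : ∀ {a} → T (π (suc a) ∗ ∗) → Piece π (key 0F a ∷ [])
    single₁ : ∀ {b} → T (π ∗ (suc b) ∗) → Piece π (key 1F b ∷ [])
    single₂ : ∀ {c} → T (π ∗ ∗ (suc c)) → Piece π (key 2F c ∷ [])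
    pair₀₁  : ∀ {a b} → T (π (suc a) (suc b) ∗) → Piece π (key 0F a ∷ key 1F b ∷ [])
    pair₀₂  : ∀ {a c} → T (π (suc a) ∗ (suc c)) → Piece π (key 0F a ∷ key 2F c ∷ [])
    pair₁₂  : ∀ {b c} → T (π ∗ (suc b) (suc c)) → Piece π (key 1F b ∷ key 2F c ∷ [])
    triple₀ : ∀ {a b c} → T (π (suc a) (suc b) (suc c)) → Piece π (key 0F a ∷ key 0F a ∷ key 1F b ∷ key 2F c ∷ [])
    triple₁ : ∀ {a b c} → T (π (suc a) (suc b) (suc c)) → Piece π (key 1F b ∷ key 1F b ∷ key 0F a ∷ key 2F c ∷ [])
    triple₂ : ∀ {a b c} → T (π (suc a) (suc b) (suc c)) → Piece π (key 2F c ∷ key 2F c ∷ key 0F a ∷ key 1F b ∷ [])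

  SomePiece : Pattern → Set
  SomePiece π = Σ (List Key) (Piece π)

  private
    when : ∀ {A : Set} b → (T b → A) → List A
    when true  f = f tt ∷ []
    when false f = []

    ∈-when : ∀ {A : Set} b (f : T b → A) t → f t ∈ when b f
    ∈-when true f tt = here refl

    over : ∀ {A : Set} → (Fin 4 → List A) → List A
    over f = concatMap f (allFin 4)

    ∈-over : ∀ {A : Set} (f : Fin 4 → List A) a {x} → x ∈ f a → x ∈ over f
    ∈-over f a x∈ = ∈-concatMap⁺ f (lose (∈-allFin a) x∈)

    module _ (π : Pattern) where
      singlesAt : Fin 4 → List (SomePiece π)
      singlesAt a = when (π (suc a) ∗ ∗) (λ t → _ , single₀ t) ++
        (when (π ∗ (suc a) ∗) (λ t → _ , single₁ t) ++ when (π ∗ ∗ (suc a)) (λ t → _ , single₂ t))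

      pairsAt : Fin 4 → Fin 4 → List (SomePiece π)
      pairsAt a b = when (π (suc a) (suc b) ∗) (λ t → _ , pair₀₁ t) ++
        (when (π (suc a) ∗ (suc b)) (λ t → _ , pair₀₂ t) ++ when (π ∗ (suc a) (suc b)) (λ t → _ , pair₁₂ t))

      triplesAt : Fin 4 → Fin 4 → Fin 4 → List (SomePiece π)
      triplesAt a b c = when (π (suc a) (suc b) (suc c)) (λ t → _ , triple₀ t) ++
        (when (π (suc a) (suc b) (suc c)) (λ t → _ , triple₁ t) ++ when (π (suc a) (suc b) (suc c)) (λ t → _ , triple₂ t))

      allSingles allPairs allTriples pieces : List (SomePiece π)
      allSingles = over singlesAt
      allPairs   = over λ a → over (pairsAt a)
      allTriples = over λ a → over λ b → over (triplesAt a b)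
      pieces     = allSingles ++ (allPairs ++ allTriples)

      single∈ : ∀ a {p} → p ∈ singlesAt a → p ∈ pieces
      single∈ a p∈ = ∈-++⁺ˡ (∈-over singlesAt a p∈)

      pair∈ : ∀ a b {p} → p ∈ pairsAt a b → p ∈ pieces
      pair∈ a b p∈ = ∈-++⁺ʳ allSingles (∈-++⁺ˡ (∈-over (λ a → over (pairsAt a)) a (∈-over (pairsAt a) b p∈)))

      triple∈ : ∀ a b c {p} → p ∈ triplesAt a b c → p ∈ pieces
      triple∈ a b c p∈ = ∈-++⁺ʳ allSingles (∈-++⁺ʳ allPairs
        (∈-over (λ a → over λ b → over (triplesAt a b)) a (∈-over (λ b → over (triplesAt a b)) b (∈-over (triplesAt a b) c p∈))))

      ∈-pieces : ∀ {ks} (p : Piece π ks) → (ks , p) ∈ pieces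
      ∈-pieces (single₀ {a} t) = single∈ a (∈-++⁺ˡ (∈-when (π (suc a) ∗ ∗) _ t))
      ∈-pieces (single₁ {a} t) = single∈ a (∈-++⁺ʳ (when (π (suc a) ∗ ∗) _) (∈-++⁺ˡ (∈-when (π ∗ (suc a) ∗) _ t)))
      ∈-pieces (single₂ {a} t) = single∈ a (∈-++⁺ʳ (when (π (suc a) ∗ ∗) _)
        (∈-++⁺ʳ (when (π ∗ (suc a) ∗) _) (∈-when (π ∗ ∗ (suc a)) _ t)))
      ∈-pieces (pair₀₁ {a} {b} t) = pair∈ a b (∈-++⁺ˡ (∈-when (π (suc a) (suc b) ∗) _ t))
      ∈-pieces (pair₀₂ {a} {b} t) = pair∈ a b (∈-++⁺ʳ (when (π (suc a) (suc b) ∗) _) (∈-++⁺ˡ (∈-when (π (suc a) ∗ (suc b)) _ t)))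
      ∈-pieces (pair₁₂ {a} {b} t) = pair∈ a b (∈-++⁺ʳ (when (π (suc a) (suc b) ∗) _)
        (∈-++⁺ʳ (when (π (suc a) ∗ (suc b)) _) (∈-when (π ∗ (suc a) (suc b)) _ t)))
      ∈-pieces (triple₀ {a} {b} {c} t) = triple∈ a b c (∈-++⁺ˡ (∈-when (π (suc a) (suc b) (suc c)) _ t))
      ∈-pieces (triple₁ {a} {b} {c} t) = triple∈ a b c
        (∈-++⁺ʳ (when (π (suc a) (suc b) (suc c)) _) (∈-++⁺ˡ (∈-when (π (suc a) (suc b) (suc c)) _ t)))
      ∈-pieces (triple₂ {a} {b} {c} t) = triple∈ a b c
        (∈-++⁺ʳ (when (π (suc a) (suc b) (suc c)) _) (∈-++⁺ʳ (when (π (suc a) (suc b) (suc c)) _) (∈-when (π (suc a) (suc b) (suc c)) _ t)))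

  occ : ∀ {d} → List (Fin d) → Fin d → ℕ
  occ ks i = ∑ ks (λ k → ⟦ does (k ≟F i) ⟧)

  dot-zero : ∀ {d} (w : Fin d → ℕ) → dot (λ _ → 0ℤ) w ≡ 0ℤ
  dot-zero {zero}  w = refl
  dot-zero {suc d} w = trans (cong (λ s → 0ℤ ℤ.+ s) (dot-zero (w ∘ suc))) refl

  dot-cong : ∀ {d} {f g : Fin d → ℤ} (w : Fin d → ℕ) → (∀ i → f i ≡ g i) → dot f w ≡ dot g w
  dot-cong {zero}  w h = refl
  dot-cong {suc d} w h = cong₂ (λ x y → x ℤ.* + w zero ℤ.+ y) (h zero) (dot-cong (w ∘ suc) (h ∘ suc))

  dot-unit : ∀ {d} (k : Fin d) (w : Fin d → ℕ) → dot (λ i → + ⟦ does (k ≟F i) ⟧) w ≡ + w k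
  dot-unit zero w = trans (cong₂ ℤ._+_ (ℤ.*-identityˡ (+ w zero)) (dot-zero (w ∘ suc))) (ℤ.+-identityʳ _)
  dot-unit (suc k) w = trans (ℤ.+-identityˡ _) (trans (dot-cong (w ∘ suc) (λ i → refl)) (dot-unit k (w ∘ suc)))

  dot-occ : ∀ {d} s (ks : List (Fin d)) (w : Fin d → ℕ) → dot (λ i → s ℤ.* + occ ks i) w ≡ s ℤ.* + ∑ ks w
  dot-occ s [] w = trans (dot-cong w (λ _ → ℤ.*-zeroʳ s)) (trans (dot-zero w) (sym (ℤ.*-zeroʳ s)))
  dot-occ s (k ∷ ks) w = begin
    dot (λ i → s ℤ.* + occ (k ∷ ks) i) w
      ≡⟨ dot-cong w (λ i → trans (cong (s ℤ.*_) (ℤ.pos-+ _ (occ ks i))) (trans (ℤ.*-distribˡ-+ s _ _)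
           (cong (λ x → s ℤ.* + ⟦ does (k ≟F i) ⟧ ℤ.+ x) (sym (ℤ.*-identityˡ _))))) ⟩
    dot (λ i → s ℤ.* + ⟦ does (k ≟F i) ⟧ ℤ.+ 1ℤ ℤ.* (s ℤ.* + occ ks i)) w
      ≡⟨ dot-lin s 1ℤ (λ i → + ⟦ does (k ≟F i) ⟧) (λ i → s ℤ.* + occ ks i) w ⟩
    s ℤ.* dot (λ i → + ⟦ does (k ≟F i) ⟧) w ℤ.+ 1ℤ ℤ.* dot (λ i → s ℤ.* + occ ks i) w
      ≡⟨ cong₂ ℤ._+_ (cong (s ℤ.*_) (dot-unit k w)) (trans (ℤ.*-identityˡ _) (dot-occ s ks w)) ⟩
    s ℤ.* + w k ℤ.+ s ℤ.* + ∑ ks w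
      ≡⟨ ℤ.*-distribˡ-+ s (+ w k) (+ ∑ ks w) ⟨
    s ℤ.* (+ w k ℤ.+ + ∑ ks w)
      ≡⟨ cong (s ℤ.*_) (ℤ.pos-+ (w k) (∑ ks w)) ⟨
    s ℤ.* + ∑ (k ∷ ks) w ∎
    where open ≡-Reasoning

  members : Fin 3 → List Key
  members g = map (key g) (allFin 4)

  occ-members : ∀ g i → occ (members g) i ≡ ⟦ does (group i ≟F g) ⟧
  occ-members = from-yes (all? λ g → all? λ i → occ (members g) i ≟ ⟦ does (group i ≟F g) ⟧)

  ∑-key : ∀ g (w : Key → ℕ) → ∑ (members g) w ≡ ∑₄ (w ∘ key g)
  ∑-key g w = ∑-map (key g) (allFin 4) w

  private
    Element : Pattern → Set
    Element π = Fin 3 ⊎ SomePiece π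

    inequality : ∀ {π} → Element π → Constraint (3 * 4)
    inequality (inj₁ g)        = (λ i → -[1+ 0 ] ℤ.* + occ (members g) i) ⊕ 1ℤ
    inequality (inj₂ (ks , _)) = (λ i → 1ℤ ℤ.* + occ ks i) ⊕ -[1+ 0 ]

    elements : ∀ π → List (Element π)
    elements π = map inj₁ (allFin 3) ++ map inj₂ (pieces π)

    ∈-elements₁ : ∀ {π} g → inj₁ g ∈ elements π
    ∈-elements₁ g = ∈-++⁺ˡ (∈-map⁺ inj₁ (∈-allFin g))

    ∈-elements₂ : ∀ {π ks} (p : Piece π ks) → inj₂ (ks , p) ∈ elements π
    ∈-elements₂ {π} p = ∈-++⁺ʳ (map inj₁ (allFin 3)) (∈-map⁺ inj₂ (∈-pieces π p))

  record Weighting (π : Pattern) : Set where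
    field
      N       : ℕ
      N>0     : 0 < N
      w       : Key → ℕ
      balance : ∀ g → ∑₄ (w ∘ key g) ≤ N
      heavy   : ∀ {ks} → Piece π ks → N ≤ ∑ ks w

  -- Giving up `quota g` copies of class `g` frees that many vertices at each of its positions,
  -- which is why `fits` compares every key with the quota of its class.
  record Improvement (π : Pattern) : Set where
    field
      quota  : Fin 3 → ℕ
      packed : List (SomePiece π)
      fits   : ∀ k → occ (concatMap proj₁ packed) k ≤ quota (group k)
      gain   : quota 0F + (quota 1F + quota 2F) < length packed

  private
    weighting : ∀ {π} → Solution (map inequality (elements π)) → Weighting π
    weighting {π} (w , N , sat) = record
      { N = suc N ; N>0 = s≤s z≤n ; w = w
      ; balance = λ g → subst (_≤ suc N) (∑-key g w) (own g)
      ; heavy = piece }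
      where
      own : ∀ g → ∑ (members g) w ≤ suc N
      own g = ℤ.drop‿+≤+ (ℤ.0≤i-j⇒j≤i (subst (0ℤ ℤ.≤_)
        (trans (cong (λ x → x ℤ.+ 1ℤ ℤ.* + suc N) (dot-occ -[1+ 0 ] (members g) w)) (eq (+ ∑ (members g) w) (+ suc N)))
        (sat (∈-map⁺ inequality (∈-elements₁ g)))))
        where
        eq : ∀ a b → - 1ℤ ℤ.* a ℤ.+ 1ℤ ℤ.* b ≡ b ℤ.- a
        eq = ℤ-Solver.solve-∀
      piece : ∀ {ks} → Piece π ks → suc N ≤ ∑ ks w
      piece {ks} p = ℤ.drop‿+≤+ (ℤ.0≤i-j⇒j≤i (subst (0ℤ ℤ.≤_)
        (trans (cong (λ x → x ℤ.+ -[1+ 0 ] ℤ.* + suc N) (dot-occ 1ℤ ks w)) (eq (+ ∑ ks w) (+ suc N)))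
        (sat (∈-map⁺ inequality (∈-elements₂ p)))))
        where
        eq : ∀ a b → 1ℤ ℤ.* a ℤ.+ - 1ℤ ℤ.* b ≡ a ℤ.- b
        eq = ℤ-Solver.solve-∀

    preimages : ∀ {A B : Set} (f : A → B) xs (L : List B) → All (_∈ map f xs) L → Σ (List A) λ M → map f M ≡ L
    preimages f xs []      []         = [] , refl
    preimages f xs (y ∷ L) (y∈ ∷ L∈) with ∈-map⁻ f y∈ | preimages f xs L L∈
    ... | x , _ , refl | M , refl = x ∷ M , refl

    splitElements : ∀ {π} → List (Element π) → (Fin 3 → ℕ) × List (SomePiece π)
    splitElements []           = (λ _ → 0) , []
    splitElements (inj₁ g ∷ M) = (λ g′ → ⟦ does (g′ ≟F g) ⟧ + proj₁ (splitElements M) g′) , proj₂ (splitElements M)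
    splitElements (inj₂ p ∷ M) = proj₁ (splitElements M) , p ∷ proj₂ (splitElements M)

    occ-++ : ∀ {d} (ks ls : List (Fin d)) i → occ (ks ++ ls) i ≡ occ ks i + occ ls i
    occ-++ ks ls i = ∑-++ ks ls _

    total-coeff : ∀ {π} (M : List (Element π)) i →
      total (λ c → Constraint.coeff c i) (map inequality M)
        ≡ + occ (concatMap proj₁ (proj₂ (splitElements M))) i ℤ.- + proj₁ (splitElements M) (group i)
    total-coeff [] i = refl
    total-coeff (inj₁ g ∷ M) i = trans (cong₂ (λ x y → -[1+ 0 ] ℤ.* + x ℤ.+ y) (occ-members g i) (total-coeff M i))
      (trans (eq (+ ⟦ does (group i ≟F g) ⟧) (+ occ (concatMap proj₁ (proj₂ (splitElements M))) i) (+ proj₁ (splitElements M) (group i)))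
        (cong (λ x → + occ (concatMap proj₁ (proj₂ (splitElements M))) i ℤ.- x) (sym (ℤ.pos-+ ⟦ does (group i ≟F g) ⟧ _))))
      where
      eq : ∀ d o q → - 1ℤ ℤ.* d ℤ.+ (o ℤ.- q) ≡ o ℤ.- (d ℤ.+ q)
      eq = ℤ-Solver.solve-∀
    total-coeff (inj₂ (ks , p) ∷ M) i = trans (cong (λ y → 1ℤ ℤ.* + occ ks i ℤ.+ y) (total-coeff M i))
      (trans (eq (+ occ ks i) (+ occ rest′ i) (+ proj₁ (splitElements M) (group i)))
        (cong (λ x → x ℤ.- + proj₁ (splitElements M) (group i))
          (trans (sym (ℤ.pos-+ (occ ks i) (occ rest′ i))) (cong +_ (sym (occ-++ ks rest′ i))))))
      where
      rest′ : List Key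
      rest′ = concatMap proj₁ (proj₂ (splitElements M))
      eq : ∀ d o q → 1ℤ ℤ.* d ℤ.+ (o ℤ.- q) ≡ d ℤ.+ o ℤ.- q
      eq = ℤ-Solver.solve-∀

    total-const : ∀ {π} (M : List (Element π)) → let (q , ps) = splitElements M in
      total Constraint.const (map inequality M) ≡ + (q 0F + (q 1F + q 2F)) ℤ.- + length ps
    total-const [] = refl
    total-const (inj₁ g ∷ M) = trans (cong (λ y → 1ℤ ℤ.+ y) (total-const M))
      (trans (sym (ℤ.+-assoc 1ℤ (+ (proj₁ (splitElements M) 0F + (proj₁ (splitElements M) 1F + proj₁ (splitElements M) 2F))) (ℤ.- (+ length (proj₂ (splitElements M)))))) (cong (λ x → + x ℤ.- + length (proj₂ (splitElements M)))
        (bump g (proj₁ (splitElements M) 0F) (proj₁ (splitElements M) 1F) (proj₁ (splitElements M) 2F))))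
      where
      bump : ∀ g x y z → 1 + (x + (y + z)) ≡
        (⟦ does (0F ≟F g) ⟧ + x) + ((⟦ does (1F ≟F g) ⟧ + y) + (⟦ does (2F ≟F g) ⟧ + z))
      bump 0F x y z = refl
      bump 1F x y z = sym (+-suc x (y + z))
      bump 2F x y z = trans (sym (+-suc x (y + z))) (cong (λ s → x + s) (sym (+-suc y z)))
    total-const (inj₂ p ∷ M) = trans (cong (λ y → - 1ℤ ℤ.+ y) (total-const M))
      (eq (+ (proj₁ (splitElements M) 0F + (proj₁ (splitElements M) 1F + proj₁ (splitElements M) 2F))) (+ length (proj₂ (splitElements M))))
      where
      eq : ∀ q l → - 1ℤ ℤ.+ (q ℤ.- l) ≡ q ℤ.- (1ℤ ℤ.+ l)
      eq = ℤ-Solver.solve-∀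

    i-j<0⇒i<j : ∀ {i j} → i ℤ.- j ℤ.< 0ℤ → i ℤ.< j
    i-j<0⇒i<j {i} {j} h = subst₂ ℤ._<_ (eq i j) (ℤ.+-identityˡ j) (ℤ.+-monoˡ-< j h)
      where
      eq : ∀ i j → i ℤ.- j ℤ.+ j ≡ i
      eq = ℤ-Solver.solve-∀

    improvement : ∀ {π} → Refutation (map inequality (elements π)) → Improvement π
    improvement {π} (L , L∈ , coeff≤0 , const<0) with preimages inequality (elements π) L L∈
    ... | M , refl = record
      { quota  = proj₁ (splitElements M)
      ; packed = proj₂ (splitElements M)
      ; fits   = λ k → ℤ.drop‿+≤+ (ℤ.i-j≤0⇒i≤j (subst (ℤ._≤ 0ℤ) (total-coeff M k) (coeff≤0 k)))
      ; gain   = ℤ.drop‿+<+ (i-j<0⇒i<j (subst (ℤ._< 0ℤ) (total-const M) const<0)) }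

  opaque
    -- Farkas' lemma for copies of weight at most `N` and pieces of weight at least `N`. In a
    -- certificate, the coefficient of a key says that its uses do not exceed its supply, and the
    -- negative constant says that more pieces are packed than copies are given up.
    dichotomy : ∀ π → Weighting π ⊎ Improvement π
    dichotomy π = Sum.map weighting improvement (farkas (map inequality (elements π)))

-- The share of a triple of copies and its extremal value

module Shares where
  open Sums
  open LocalWeights
  open Patterns

  open import Data.Nat using (ℕ; suc; _+_; _*_; _⊔_; _≤_; _<_; z≤n; _≤?_)
  open import Data.Nat.Properties
  open import Data.Nat.Tactic.RingSolver using (solve-∀)

  singleBits : Pattern → Fin 3 → Fin 4 → Bool
  singleBits π 0F a = π (suc a) ∗ ∗
  singleBits π 1F b = π ∗ (suc b) ∗
  singleBits π 2F c = π ∗ ∗ (suc c)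

  pairBits : Pattern → Fin 3 → Fin 4 → Fin 4 → Bool
  pairBits π 0F b c = π ∗ (suc b) (suc c)
  pairBits π 1F a c = π (suc a) ∗ (suc c)
  pairBits π 2F a b = π (suc a) (suc b) ∗

  tripleBits : Pattern → Fin 4 → Fin 4 → Fin 4 → Bool
  tripleBits π a b c = π (suc a) (suc b) (suc c)

  singleCount pairCount tripleCount : Pattern → ℕ
  singleCount π = ∑₄ (λ a → ⟦ singleBits π 0F a ⟧) + (∑₄ (λ a → ⟦ singleBits π 1F a ⟧) + ∑₄ (λ a → ⟦ singleBits π 2F a ⟧))
  pairCount π   = ∑∑ (pairBits π 2F) + (∑∑ (pairBits π 1F) + ∑∑ (pairBits π 0F))
  tripleCount π = ∑∑∑ (tripleBits π)

  -- With m copies and u uncovered vertices, the shares of all triples of copies add up to m² times the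
  -- number of ordered edges, up to negligible classes.
  share : Pattern → ℕ → ℕ → ℕ
  share π u m = singleCount π * (u * u) + (pairCount π * (u * m) + tripleCount π * (m * m))

  -- `64` counts the triples on three copies. With one chosen vertex in each copy, 3 single vertices
  -- are chosen, and `21 = 3 * (16 - 9)` pairs and `37 = 64 - 27` triples contain a chosen vertex.
  extremal : ℕ → ℕ → ℕ
  extremal u m = 64 * (m * m) ⊔ (3 * (u * u) + (21 * (u * m) + 37 * (m * m)))

  share≤extremal₁ : ∀ {π} u m → singleCount π ≤ 3 → pairCount π ≤ 21 → tripleCount π ≤ 37 → share π u m ≤ extremal u m
  share≤extremal₁ {π} u m s≤ p≤ t≤ = ≤-trans
    (+-mono-≤ (*-monoˡ-≤ (u * u) s≤) (+-mono-≤ (*-monoˡ-≤ (u * m) p≤) (*-monoˡ-≤ (m * m) t≤)))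
    (m≤n⊔m (64 * (m * m)) _)

  -- For `9 * u ≤ 10 * m` the linear hypothesis bounds the share by the clique term. Otherwise put
  -- `9 * u = 10 * m + v`; the excess is charged to at most 21 pairs, and already at `v = 0` the
  -- cover term exceeds the clique term by `3 / 81` of `m * m`.
  share≤extremal₂ : ∀ {π} u m → singleCount π ≡ 0 → pairCount π ≤ 21 → 9 * tripleCount π + 10 * pairCount π ≤ 576 →
                    share π u m ≤ extremal u m
  share≤extremal₂ {π} u m s≡0 p≤ pt≤ with 9 * u ≤? 10 * m
  ... | yes 9u≤10m = ≤-trans (*-cancelˡ-≤ 9 (begin
    9 * share π u m                       ≡⟨ cong (λ s → 9 * (s * (u * u) + (P * (u * m) + D * (m * m)))) s≡0 ⟩
    9 * (P * (u * m) + D * (m * m))       ≡⟨ eq P D u m ⟩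
    P * m * (9 * u) + 9 * D * (m * m)     ≤⟨ +-monoˡ-≤ (9 * D * (m * m)) (*-monoʳ-≤ (P * m) 9u≤10m) ⟩
    P * m * (10 * m) + 9 * D * (m * m)    ≡⟨ eq′ P D m ⟩
    (9 * D + 10 * P) * (m * m)            ≤⟨ *-monoˡ-≤ (m * m) pt≤ ⟩
    576 * (m * m)                         ≡⟨ *-assoc 9 64 (m * m) ⟩
    9 * (64 * (m * m))                    ∎)) (m≤m⊔n (64 * (m * m)) _)
    where
    open ≤-Reasoning
    P D : ℕ
    P = pairCount π
    D = tripleCount π
    eq : ∀ P D u m → 9 * (P * (u * m) + D * (m * m)) ≡ P * m * (9 * u) + 9 * D * (m * m)
    eq = solve-∀
    eq′ : ∀ P D m → P * m * (10 * m) + 9 * D * (m * m) ≡ (9 * D + 10 * P) * (m * m)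
    eq′ = solve-∀
  ... | no 9u≰10m with m≤n⇒∃[o]m+o≡n (≰⇒≥ 9u≰10m) | m≤n⇒∃[o]m+o≡n p≤
  ... | v , 10m+v≡9u | c , P+c≡21 = ≤-trans (*-cancelˡ-≤ 81 (begin
    81 * share π u m                      ≡⟨ cong (λ s → 81 * (s * (u * u) + (P * (u * m) + D * (m * m)))) s≡0 ⟩
    81 * (P * (u * m) + D * (m * m))      ≡⟨ eq₁ P D u m ⟩
    9 * (P * (m * (9 * u))) + 9 * (9 * D) * (m * m)
      ≡⟨ cong (λ w → 9 * (P * (m * w)) + 9 * (9 * D) * (m * m)) (sym 10m+v≡9u) ⟩
    9 * (P * (m * (10 * m + v))) + 9 * (9 * D) * (m * m)
      ≡⟨ eq₂ P D m v ⟩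
    9 * (9 * D + 10 * P) * (m * m) + 9 * P * (m * v)
      ≤⟨ +-mono-≤ (*-monoˡ-≤ (m * m) (*-monoʳ-≤ 9 pt≤)) (*-monoˡ-≤ (m * v) (*-monoʳ-≤ 9 p≤)) ⟩
    9 * 576 * (m * m) + 9 * 21 * (m * v)  ≤⟨ lin (60 * (m * v) + 3 * (v * v) + 3 * (m * m)) z≤n (eq₃ m v) ⟩
    3 * ((10 * m + v) * (10 * m + v)) + 189 * ((10 * m + v) * m) + 81 * (37 * (m * m))
      ≡⟨ cong (λ w → 3 * (w * w) + 189 * (w * m) + 81 * (37 * (m * m))) 10m+v≡9u ⟩
    3 * ((9 * u) * (9 * u)) + 189 * ((9 * u) * m) + 81 * (37 * (m * m))
      ≡⟨ eq₄ u m ⟩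
    81 * (3 * (u * u) + (21 * (u * m) + 37 * (m * m))) ∎)) (m≤n⊔m (64 * (m * m)) _)
    where
    open ≤-Reasoning
    P D : ℕ
    P = pairCount π
    D = tripleCount π
    eq₁ : ∀ P D u m → 81 * (P * (u * m) + D * (m * m)) ≡ 9 * (P * (m * (9 * u))) + 9 * (9 * D) * (m * m)
    eq₁ = solve-∀
    eq₂ : ∀ P D m v → 9 * (P * (m * (10 * m + v))) + 9 * (9 * D) * (m * m) ≡ 9 * (9 * D + 10 * P) * (m * m) + 9 * P * (m * v)
    eq₂ = solve-∀
    eq₃ : ∀ m v → 9 * 576 * (m * m) + 9 * 21 * (m * v) + 0 + (60 * (m * v) + 3 * (v * v) + 3 * (m * m))
      ≡ 3 * ((10 * m + v) * (10 * m + v)) + 189 * ((10 * m + v) * m) + 81 * (37 * (m * m)) + 0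
    eq₃ = solve-∀
    eq₄ : ∀ u m → 3 * ((9 * u) * (9 * u)) + 189 * ((9 * u) * m) + 81 * (37 * (m * m))
      ≡ 81 * (3 * (u * u) + (21 * (u * m) + 37 * (m * m)))
    eq₄ = solve-∀

  module _ {π : Pattern} (W : Weighting π) where
    open Weighting W
    open Weights N N>0

    private
      p q r : Fin 4 → ℕ
      p = w ∘ key 0F
      q = w ∘ key 1F
      r = w ∘ key 2F

      pairs₂ : Pairs p q (pairBits π 2F)
      pairs₂ {a} {b} t = ≤-trans (heavy (pair₀₁ t)) (≤-reflexive (cong (p a +_) (+-identityʳ (q b))))

      pairs₁ : Pairs p r (pairBits π 1F)
      pairs₁ {a} {c} t = ≤-trans (heavy (pair₀₂ t)) (≤-reflexive (cong (p a +_) (+-identityʳ (r c))))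

      pairs₀ : Pairs q r (pairBits π 0F)
      pairs₀ {b} {c} t = ≤-trans (heavy (pair₁₂ t)) (≤-reflexive (cong (q b +_) (+-identityʳ (r c))))

      triples₃ : Triples p q r (tripleBits π)
      triples₃ {a} {b} {c} t =
        ≤-trans (heavy (triple₀ t)) (≤-reflexive (eq₀ (p a) (q b) (r c))) ,
        ≤-trans (heavy (triple₁ t)) (≤-reflexive (eq₁ (p a) (q b) (r c))) ,
        ≤-trans (heavy (triple₂ t)) (≤-reflexive (eq₂ (p a) (q b) (r c)))
        where
        eq₀ : ∀ a b c → a + (a + (b + (c + 0))) ≡ a + (b + c) + a
        eq₀ = solve-∀
        eq₁ : ∀ a b c → b + (b + (a + (c + 0))) ≡ a + (b + c) + b
        eq₁ = solve-∀
        eq₂ : ∀ a b c → c + (c + (a + (b + 0))) ≡ a + (b + c) + c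
        eq₂ = solve-∀

      single-heavy : ∀ g {a} → T (singleBits π g a) → N ≤ w (key g a)
      single-heavy 0F t = ≤-trans (heavy (single₀ t)) (≤-reflexive (+-identityʳ _))
      single-heavy 1F t = ≤-trans (heavy (single₁ t)) (≤-reflexive (+-identityʳ _))
      single-heavy 2F t = ≤-trans (heavy (single₂ t)) (≤-reflexive (+-identityʳ _))

      pairCount≤21 : pairCount π ≤ 21
      pairCount≤21 = S₂≤21 {p} {q} {r} {pairBits π 2F} {pairBits π 1F} {pairBits π 0F} {tripleBits π}
        (balance 0F) (balance 1F) (balance 2F) pairs₂ pairs₁ pairs₀ triples₃

      no-singles : ∀ g → Small (w ∘ key g) → ∑₄ (λ a → ⟦ singleBits π g a ⟧) ≡ 0
      no-singles g small = n≤0⇒n≡0 (∑-≤const (allFin 4) 0 λ a → ⟦⟧≤ (singleBits π g a) λ t →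
        ⊥-elim (<⇒≱ (small a) (single-heavy g t)))

      at-most-three : singleCount π ≤ 3
      at-most-three = +-mono-≤ (one 0F) (+-mono-≤ (one 1F) (one 2F))
        where
        one : ∀ g → ∑₄ (λ a → ⟦ singleBits π g a ⟧) ≤ 1
        one g = singles≤1 {w ∘ key g} (singleBits π g) (balance g) (single-heavy g)

      with-heavy : (∃[ a ] N ≤ p a) ⊎ (∃[ b ] N ≤ q b) ⊎ (∃[ c ] N ≤ r c) → ∀ u m → share π u m ≤ extremal u m
      with-heavy h u m = share≤extremal₁ {π} u m at-most-three pairCount≤21
        (some-heavy {p} {q} {r} {pairBits π 2F} {pairBits π 1F} {pairBits π 0F} {tripleBits π}
          (balance 0F) (balance 1F) (balance 2F) pairs₂ pairs₁ pairs₀ triples₃ h)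

    -- A vertex of full weight in some copy puts the share under the cover term. Without one, no
    -- vertex has a dense link, since a single piece needs full weight, and the balance between
    -- pairs and triples in `all-small` decides.
    share≤extremal : ∀ u m → share π u m ≤ extremal u m
    share≤extremal u m with small? p | small? q | small? r
    ... | inj₁ h | _ | _ = with-heavy (inj₁ h) u m
    ... | inj₂ _ | inj₁ h | _ = with-heavy (inj₂ (inj₁ h)) u m
    ... | inj₂ _ | inj₂ _ | inj₁ h = with-heavy (inj₂ (inj₂ h)) u m
    ... | inj₂ sp | inj₂ sq | inj₂ sr = share≤extremal₂ {π} u m
      (cong₂ _+_ (no-singles 0F sp) (cong₂ _+_ (no-singles 1F sq) (no-singles 2F sr))) pairCount≤21
      (all-small {p} {q} {r} {pairBits π 2F} {pairBits π 1F} {pairBits π 0F} {tripleBits π}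
          (balance 0F) (balance 1F) (balance 2F) pairs₂ pairs₁ pairs₀ triples₃ sp sq sr)

-- Building disjoint copies on prescribed covered vertices

module Realisation where
  open Sums
  open DenseTripartite using (∑⟦⟧>0⇒∃)
  open LocalWeights using (⟦⟧≤)
  open Patterns using (occ)

  open import Data.Nat using (ℕ; suc; _+_; _*_; _≤_; _<_; s≤s; _≤ᵇ_)
  open import Data.Nat.Properties
  open import Data.Nat.Tactic.RingSolver using (solve-∀)

  module _ {n : ℕ} where
    open DecMembership (_≟F_ {n}) using (_∈?_) public

    fresh : ∀ {xs : List (Fin n)} (P : Fin n → Bool) (F : List (Fin n)) → Unique xs →
            length F < ∑ xs (λ x → ⟦ P x ⟧) → ∃[ x ] x ∈ xs × T (P x) × x ∉ F
    fresh {xs} P F uxs many with filter (λ x → ¬? (x ∈? F)) (filterT P xs) in eq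
    ... | x ∷ _ with ∈-filter⁻ (λ x → ¬? (x ∈? F)) {xs = filterT P xs} (subst (x ∈_) (sym eq) (here refl))
    ...   | x∈ , x∉F with ∈-filter⁻ (T? ∘ P) {xs = xs} x∈
    ...     | x∈xs , Px = x , x∈xs , Px , x∉F
    fresh {xs} P F uxs many | [] = ⊥-elim (<⇒≱ many (begin
      ∑ xs (λ x → ⟦ P x ⟧)      ≡⟨ length-filterT P xs ⟨
      length (filterT P xs)     ≡⟨ length≡∑ (filterT P xs) ⟩
      ∑ (filterT P xs) (λ _ → 1) ≤⟨ ∑-⊆ (λ _ → 1) (Unique.filter⁺ (T? ∘ P) uxs) inF ⟩
      ∑ F (λ _ → 1)             ≡⟨ length≡∑ F ⟨
      length F                  ∎))
      where
      open ≤-Reasoning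
      inF : ∀ {x} → x ∈ filterT P xs → x ∈ F
      inF {x} x∈ with x ∈? F
      ... | yes x∈F = x∈F
      ... | no x∉F with subst (x ∈_) eq (∈-filter⁺ (λ x → ¬? (x ∈? F)) x∈ x∉F)
      ...   | ()

  module _ {n : ℕ} (H : ThreeGraph n) where

    toEdge : ∀ {x y z} → T (edge H x y z) → edge H x y z ≡ true
    toEdge = Equivalence.to T-≡

    rot : ∀ x y z → edge H x y z ≡ edge H y z x
    rot x y z = trans (sym₁₂ H x y z) (sym₂₃ H y x z)

    y32 : ∀ x y z z′ → T (edge H x y z) → T (edge H x y z′) → z ≢ z′ → Y32 H
    y32 x y z z′ e₁ e₂ z≢z′ with distinct H x y z (toEdge e₁) | distinct H x y z′ (toEdge e₂)
    ... | x≢y , y≢z , x≢z | _ , y≢z′ , x≢z′ = record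
      { a = x ; b = y ; c = z ; d = z′
      ; vertsDistinct = (x≢y ∷ x≢z ∷ x≢z′ ∷ []) ∷ (y≢z ∷ y≢z′ ∷ []) ∷ (z≢z′ ∷ []) ∷ [] ∷ []
      ; edge₁ = toEdge e₁ ; edge₂ = toEdge e₂ }

    module _ (U : List (Fin n)) where
      degree : Fin n → ℕ
      degree v = ∑ U (λ x → ∑ U (λ y → ⟦ edge H v x y ⟧))

      codegree : Fin n → Fin n → ℕ
      codegree v w = ∑ U (λ x → ⟦ edge H v w x ⟧)

  -- In the application `V k x` is the vertex at key `k` of the `x`-th copy given up in its class,
  -- and `bound k` is the number of copies given up there. A slot names such a vertex.
  module Packing {n d : ℕ} {H : ThreeGraph n} (U : List (Fin n)) (uU : Unique U)
    (V : Fin d → ℕ → Fin n) (bound : Fin d → ℕ)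
    (V-injective : ∀ {k k′ x x′} → x < bound k → x′ < bound k′ → V k x ≡ V k′ x′ → (k , x) ≡ (k′ , x′))
    (V∉U : ∀ {k x} → x < bound k → V k x ∉ U) where

    Slot : Set
    Slot = Fin d × ℕ

    at : Slot → Fin n
    at (k , x) = V k x

    Valid : List Slot → Set
    Valid S = Unique S × All (λ s → proj₂ s < bound (proj₁ s)) S

    Realises : List Slot → List (Fin n) → Y32 H → Set
    Realises S F Y = ∀ {z} → z ∈ Y32-vertices Y → z ∈ map at S ⊎ (z ∈ U × z ∉ F)

    -- The forbidden set `F` is arbitrary apart from its size, so that pieces can be realised one
    -- after another, each avoiding the uncovered vertices used before.
    Realisable : ℕ → List (Fin d) → Set
    Realisable B ks = ∀ S → map proj₁ S ≡ ks → Valid S → ∀ F → length F ≤ B → Σ (Y32 H) (Realises S F)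

    -- If at most `length F` vertices of `U` had codegree at least `length F + 2` with the given
    -- vertex, its degree would be at most `n * B + n * (B + 1)`. So there is such a centre outside
    -- `F`, and it leaves two further vertices outside `F`.
    single-realisable : ∀ {B k} → (∀ {x} → x < bound k → n * (2 * B + 1) < degree H U (V k x)) → Realisable B (k ∷ [])
    single-realisable {B} big ((k , x) ∷ []) refl (_ , x< ∷ []) F F≤B
      with fresh centre F uU many
      where
      open ≤-Reasoning
      centre : Fin n → Bool
      centre y = suc (suc (length F)) ≤ᵇ codegree H U (V k x) y

      pointwise : ∀ y → codegree H U (V k x) y ≤ n * ⟦ centre y ⟧ + suc (length F)
      pointwise y with centre y in eq
      ... | true  = ≤-trans (≤-trans (∑-≤const U 1 (λ z → ⟦⟧≤1 (edge H (V k x) y z)))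
                      (*-monoˡ-≤ 1 (Unique⇒length≤ uU))) (m≤m+n _ _)
      ... | false = ≤-trans (≤-pred (≰⇒> λ c≤ → subst T eq (≤⇒≤ᵇ c≤))) (m≤n+m _ (n * 0))

      many : length F < ∑ U (λ y → ⟦ centre y ⟧)
      many = ≰⇒> λ few → <⇒≱ (big x<) (begin
        degree H U (V k x)                               ≤⟨ ∑-mono U pointwise ⟩
        ∑ U (λ y → n * ⟦ centre y ⟧ + suc (length F))    ≡⟨ ∑-+ U _ _ ⟩
        ∑ U (λ y → n * ⟦ centre y ⟧) + ∑ U (λ _ → suc (length F))
          ≡⟨ cong₂ _+_ (∑-* n U _) (∑-const (suc (length F)) U) ⟩
        n * ∑ U (λ y → ⟦ centre y ⟧) + length U * suc (length F)
          ≤⟨ +-mono-≤ (*-monoʳ-≤ n (≤-trans few F≤B)) (*-mono-≤ (Unique⇒length≤ uU) (s≤s F≤B)) ⟩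
        n * B + n * suc B                                ≡⟨ eq n B ⟩
        n * (2 * B + 1)                                  ∎)
        where
        eq : ∀ n B → n * B + n * suc B ≡ n * (2 * B + 1)
        eq = solve-∀
    ... | y , y∈U , cy , y∉F with fresh (edge H (V k x) y) F uU (<-trans ≤-refl (≤ᵇ⇒≤ _ _ cy))
    ... | z , z∈U , ez , z∉F with fresh (edge H (V k x) y) (z ∷ F) uU (≤ᵇ⇒≤ _ _ cy)
    ... | z′ , z′∈U , ez′ , z′∉ = y32 H (V k x) y z z′ ez ez′ (λ z≡z′ → z′∉ (here (sym z≡z′))) ,
      λ { (here refl) → inj₁ (here refl)
        ; (there (here refl)) → inj₂ (y∈U , y∉F)
        ; (there (there (here refl))) → inj₂ (z∈U , z∉F)
        ; (there (there (there (here refl)))) → inj₂ (z′∈U , z′∉ ∘ there) }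

    pair-realisable : ∀ {B k l} → (∀ {x y} → x < bound k → y < bound l → suc B < codegree H U (V k x) (V l y)) →
                      Realisable B (k ∷ l ∷ [])
    pair-realisable {B} big ((k , x) ∷ (l , y) ∷ []) refl (_ , x< ∷ y< ∷ []) F F≤B
      with fresh (edge H (V k x) (V l y)) F uU (≤-trans (s≤s (m≤n⇒m≤1+n F≤B)) (big x< y<))
    ... | z , z∈U , ez , z∉F with fresh (edge H (V k x) (V l y)) (z ∷ F) uU (≤-trans (s≤s (s≤s F≤B)) (big x< y<))
    ... | z′ , z′∈U , ez′ , z′∉ = y32 H (V k x) (V l y) z z′ ez ez′ (λ z≡z′ → z′∉ (here (sym z≡z′))) ,
      λ { (here refl) → inj₁ (here refl)
        ; (there (here refl)) → inj₁ (there (here refl))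
        ; (there (there (here refl))) → inj₂ (z∈U , z∉F)
        ; (there (there (there (here refl)))) → inj₂ (z′∈U , z′∉ ∘ there) }

    -- The repeated key supplies the two vertices outside the common pair; they differ because their
    -- slots do.
    triple-realisable : ∀ {B k l j} → (∀ {x y z} → x < bound k → y < bound l → z < bound j → T (edge H (V l y) (V j z) (V k x))) →
                        Realisable B (k ∷ k ∷ l ∷ j ∷ [])
    triple-realisable {B} edges ((k , x) ∷ (_ , x′) ∷ (l , y) ∷ (j , z) ∷ []) refl ((s≢s′ ∷ _) ∷ _ , x< ∷ x′< ∷ y< ∷ z< ∷ []) F F≤B =
      y32 H (V l y) (V j z) (V k x) (V k x′) (edges x< y< z<) (edges x′< y< z<) (s≢s′ ∘ V-injective x< x′<) ,
      λ { (here refl) → inj₁ (there (there (here refl)))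
        ; (there (here refl)) → inj₁ (there (there (there (here refl))))
        ; (there (there (here refl))) → inj₁ (here refl)
        ; (there (there (there (here refl)))) → inj₁ (there (here refl)) }

    -- A key is indexed by the number of its occurrences further down the list, so equal keys
    -- receive different indices below their total number.
    allocate : ∀ (K : List (Fin d)) → (∀ k → occ K k ≤ bound k) → Σ (List Slot) λ S → map proj₁ S ≡ K × Valid S
    allocate K fits = let S , keys , uS , below = go K in
      S , keys , uS , All.map (λ {s} x< → ≤-trans x< (fits (proj₁ s))) below
      where
      go : ∀ K → Σ (List Slot) λ S → map proj₁ S ≡ K × Unique S × All (λ s → proj₂ s < occ K (proj₁ s)) S
      go [] = [] , refl , [] , []
      go (k ∷ K) with go K
      ... | S , refl , uS , below = (k , occ K k) ∷ S , refl ,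
        All.map (λ {s} x< eq → <-irrefl (sym (cong proj₂ eq)) (subst (λ k → proj₂ s < occ (map proj₁ S) k) (sym (cong proj₁ eq)) x<)) below ∷ uS ,
        ≤-reflexive (cong (λ b → ⟦ b ⟧ + occ (map proj₁ S) k) (sym (dec-true (k ≟F k) refl))) ∷
        All.map (λ {s} x< → ≤-trans x< (m≤n+m _ ⟦ does (k ≟F proj₁ s) ⟧)) below

    split : ∀ {A C : Set} (f : A → C) S ks ls → map f S ≡ ks ++ ls →
            ∃[ S₁ ] ∃[ S₂ ] S ≡ S₁ ++ S₂ × map f S₁ ≡ ks × map f S₂ ≡ ls
    split f S [] ls eq = [] , S , refl , refl , eq
    split f (s ∷ S) (k ∷ ks) ls eq with split f S ks ls (∷-injectiveʳ eq)
    ... | S₁ , S₂ , refl , eq₁ , eq₂ = s ∷ S₁ , S₂ , refl , cong₂ _∷_ (∷-injectiveˡ eq) eq₁ , eq₂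

    Valid-++ : ∀ S₁ {S₂} → Valid (S₁ ++ S₂) → Valid S₁ × Valid S₂ × Disjoint S₁ S₂
    Valid-++ [] v = ([] , []) , v , λ ()
    Valid-++ (s ∷ S₁) (s≢ ∷ u , s< ∷ b) with Valid-++ S₁ (u , b)
    ... | (u₁ , b₁) , v₂ , dis = (All.++⁻ˡ S₁ s≢ ∷ u₁ , s< ∷ b₁) , v₂ ,
      λ { (here refl , s∈) → All.lookup (All.++⁻ʳ S₁ s≢) s∈ refl ; (there s∈₁ , s∈₂) → dis (s∈₁ , s∈₂) }

    -- The last pieces are built first, and `F` collects their vertices. `B` allows for four
    -- vertices in every piece, so it stays fixed through the induction. Covered vertices cannot
    -- clash, since different pieces own disjoint slots.
    realise : ∀ {B} (ps : List (List (Fin d))) → All (Realisable B) ps → 4 * length ps ≤ B →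
      ∀ S → map proj₁ S ≡ concatMap (λ ks → ks) ps → Valid S →
      Σ (List (Y32 H)) λ Ys → length Ys ≡ length ps × AllPairs (λ Y Z → Disjoint (Y32-vertices Y) (Y32-vertices Z)) Ys ×
        All (λ Y → ∀ z → z ∈ Y32-vertices Y → z ∈ map at S ⊎ z ∈ U) Ys
    realise [] _ _ S _ _ = [] , refl , [] , []
    realise {B} (ks ∷ ps) (r ∷ rs) B≥ S keys valid with split proj₁ S ks (concatMap (λ ks → ks) ps) keys
    ... | S₁ , S₂ , refl , keys₁ , keys₂ with Valid-++ S₁ valid
    ... | v₁ , v₂ , dis with realise ps rs (≤-trans (*-monoʳ-≤ 4 (n≤1+n (length ps))) B≥) S₂ keys₂ v₂
    ... | Ys , len , apart , inside = Y ∷ Ys , cong suc len , All.tabulate separate ∷ apart ,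
        (λ _ z∈ → grow₁ (Y-in z∈)) ∷ All.map (λ ins z z∈ → grow₂ (ins z z∈)) inside
      where
      F : List (Fin n)
      F = concatMap Y32-vertices Ys

      length-F : ∀ (Zs : List (Y32 H)) → length (concatMap Y32-vertices Zs) ≡ 4 * length Zs
      length-F [] = refl
      length-F (Z ∷ Zs) = trans (cong (4 +_) (length-F Zs)) (sym (*-suc 4 (length Zs)))

      realised : Σ (Y32 H) (Realises S₁ F)
      realised = r S₁ keys₁ v₁ F (≤-trans (≤-reflexive (trans (length-F Ys) (cong (4 *_) len)))
        (≤-trans (*-monoʳ-≤ 4 (n≤1+n (length ps))) B≥))

      Y : Y32 H
      Y = proj₁ realised

      Y-in : Realises S₁ F Y
      Y-in = proj₂ realised

      grow₁ : ∀ {z} → z ∈ map at S₁ ⊎ (z ∈ U × z ∉ F) → z ∈ map at (S₁ ++ S₂) ⊎ z ∈ U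
      grow₁ (inj₁ z∈) with ∈-map⁻ at z∈
      ... | s , s∈ , refl = inj₁ (∈-map⁺ at (∈-++⁺ˡ s∈))
      grow₁ (inj₂ (z∈U , _)) = inj₂ z∈U

      grow₂ : ∀ {z} → z ∈ map at S₂ ⊎ z ∈ U → z ∈ map at (S₁ ++ S₂) ⊎ z ∈ U
      grow₂ (inj₁ z∈) with ∈-map⁻ at z∈
      ... | s , s∈ , refl = inj₁ (∈-map⁺ at (∈-++⁺ʳ S₁ s∈))
      grow₂ (inj₂ z∈U) = inj₂ z∈U

      separate : ∀ {Z} → Z ∈ Ys → Disjoint (Y32-vertices Y) (Y32-vertices Z)
      separate {Z} Z∈ {z} (z∈Y , z∈Z) with Y-in z∈Y
      ... | inj₂ (_ , z∉F) = z∉F (∈-concatMap⁺ Y32-vertices (lose Z∈ z∈Z))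
      ... | inj₁ z∈₁ with ∈-map⁻ at z∈₁ | All.lookup inside Z∈ z z∈Z
      ...   | s , s∈ , refl | inj₂ z∈U = V∉U (All.lookup (proj₂ v₁) s∈) z∈U
      ...   | s , s∈ , refl | inj₁ z∈₂ with ∈-map⁻ at z∈₂
      ...     | s′ , s′∈ , eq with V-injective (All.lookup (proj₂ v₁) s∈) (All.lookup (proj₂ v₂) s′∈) eq
      ...       | refl = dis (s∈ , s′∈)

-- Families of disjoint copies and their augmentation through a blow-up

module BlowUp where
  open Sums
  open Patterns
  open Realisation

  open import Data.Nat using (ℕ; zero; suc; _+_; _*_; _≤_; _<_; z≤n; s≤s; _≤ᵇ_; >-nonZero)
  open import Data.Nat.Properties
  open import Data.Nat.Tactic.RingSolver using (solve-∀)

  -- Lists are read with a default value so that positions need not carry bounds.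
  nth : ∀ {A : Set} → A → List A → ℕ → A
  nth d []       _       = d
  nth d (x ∷ xs) zero    = x
  nth d (x ∷ xs) (suc i) = nth d xs i

  nth-∈ : ∀ {A : Set} d (xs : List A) {i} → i < length xs → nth d xs i ∈ xs
  nth-∈ d (x ∷ xs) {zero}  _         = here refl
  nth-∈ d (x ∷ xs) {suc i} (s≤s i<) = there (nth-∈ d xs i<)

  nth-injective : ∀ {A : Set} d {xs : List A} → Unique xs → ∀ {i j} → i < length xs → j < length xs →
                  nth d xs i ≡ nth d xs j → i ≡ j
  nth-injective d {x ∷ xs} (x∉ ∷ u) {zero}  {zero}  _ _ _ = refl
  nth-injective d {x ∷ xs} (x∉ ∷ u) {zero}  {suc j} _ (s≤s j<) eq = ⊥-elim (All.lookup x∉ (nth-∈ d xs j<) eq)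
  nth-injective d {x ∷ xs} (x∉ ∷ u) {suc i} {zero}  (s≤s i<) _ eq = ⊥-elim (All.lookup x∉ (nth-∈ d xs i<) (sym eq))
  nth-injective d {x ∷ xs} (x∉ ∷ u) {suc i} {suc j} (s≤s i<) (s≤s j<) eq = cong suc (nth-injective d u i< j< eq)

  AllPairs-lookup : ∀ {A : Set} {R : A → A → Set} → (∀ {x y} → R x y → R y x) →
                    ∀ {xs} → AllPairs R xs → ∀ {i j} → i ≢ j → R (lookup xs i) (lookup xs j)
  AllPairs-lookup sy {x ∷ xs} (r ∷ rs) {zero}  {zero}  i≢j = ⊥-elim (i≢j refl)
  AllPairs-lookup sy {x ∷ xs} (r ∷ rs) {zero}  {suc j} i≢j = All.lookup r (∈-lookup j)
  AllPairs-lookup sy {x ∷ xs} (r ∷ rs) {suc i} {zero}  i≢j = sy (All.lookup r (∈-lookup i))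
  AllPairs-lookup sy {x ∷ xs} (r ∷ rs) {suc i} {suc j} i≢j = AllPairs-lookup sy rs (i≢j ∘ cong suc)

  length≤filter+ : ∀ {n} (R : List (Fin n)) → n ≤ length (filter (λ x → ¬? (x ∈? R)) (allFin n)) + length R
  length≤filter+ {n} R = begin
    n                                     ≡⟨ length-allFin n ⟨
    length (allFin n)                     ≡⟨ length≡∑ (allFin n) ⟩
    ∑ (allFin n) (λ _ → 1)                ≤⟨ ∑-⊆ (λ _ → 1) (Unique.allFin⁺ n) (λ {x} _ → covers x) ⟩
    ∑ (kept ++ R) (λ _ → 1)               ≡⟨ length≡∑ (kept ++ R) ⟨
    length (kept ++ R)                    ≡⟨ length-++ kept ⟩
    length kept + length R                ∎
    where
    open ≤-Reasoning
    kept : List (Fin n)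
    kept = filter (λ x → ¬? (x ∈? R)) (allFin n)
    covers : ∀ x → x ∈ kept ++ R
    covers x with x ∈? R
    ... | yes x∈R = ∈-++⁺ʳ kept x∈R
    ... | no x∉R  = ∈-++⁺ˡ (∈-filter⁺ (λ x → ¬? (x ∈? R)) (∈-allFin x) x∉R)

  position : Key → Fin 4
  position k = proj₂ (remQuot {3} 4 k)

  group-key : ∀ g a → group (key g a) ≡ g
  group-key g a = cong proj₁ (remQuot-combine {3} {4} g a)

  position-key : ∀ g a → position (key g a) ≡ a
  position-key g a = cong proj₂ (remQuot-combine {3} {4} g a)

  key-injective : ∀ {k k′} → group k ≡ group k′ → position k ≡ position k′ → k ≡ k′
  key-injective {k} {k′} g≡ p≡ = trans (sym (combine-remQuot {3} 4 k)) (trans (cong₂ (combine {3} {4}) g≡ p≡) (combine-remQuot {3} 4 k′))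

  module _ {n : ℕ} {H : ThreeGraph n} where

    Apart : Y32 H → Y32 H → Set
    Apart Y Z = Disjoint (Y32-vertices Y) (Y32-vertices Z)

    Apart-sym : ∀ {Y Z} → Apart Y Z → Apart Z Y
    Apart-sym YZ (z∈ , y∈) = YZ (y∈ , z∈)

    vert : Y32 H → Fin 4 → Fin n
    vert Y = lookup (Y32-vertices Y)

    vert-∈ : ∀ Y a → vert Y a ∈ Y32-vertices Y
    vert-∈ Y a = ∈-lookup a

    vert-injective : ∀ Y {a b} → vert Y a ≡ vert Y b → a ≡ b
    vert-injective Y {x} {y} eq with x ≟F y
    ... | yes x≡y = x≡y
    ... | no x≢y = ⊥-elim (AllPairs-lookup (λ f → f ∘ sym) (vertsDistinct Y) x≢y eq)

  record Copies {n : ℕ} (H : ThreeGraph n) (m : ℕ) : Set where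
    field
      copy  : Fin m → Y32 H
      apart : ∀ {i j} → i ≢ j → Apart (copy i) (copy j)

    at : Fin m → Fin 4 → Fin n
    at i = vert (copy i)

    cover : List (Fin n)
    cover = concatMap (λ i → Y32-vertices (copy i)) (allFin m)

    uncovered : List (Fin n)
    uncovered = filter (λ x → ¬? (x ∈? cover)) (allFin n)

    uncovered-unique : Unique uncovered
    uncovered-unique = Unique.filter⁺ (λ x → ¬? (x ∈? cover)) (Unique.allFin⁺ n)

    copy⊆cover : ∀ {i z} → z ∈ Y32-vertices (copy i) → z ∈ cover
    copy⊆cover {i} z∈ = ∈-concatMap⁺ (λ i → Y32-vertices (copy i)) (lose (∈-allFin i) z∈)

    copy∉uncovered : ∀ {i z} → z ∈ Y32-vertices (copy i) → z ∉ uncovered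
    copy∉uncovered z∈ z∈U = proj₂ (∈-filter⁻ (λ x → ¬? (x ∈? cover)) {xs = allFin n} z∈U) (copy⊆cover z∈)

  fromList : ∀ {n} {H : ThreeGraph n} (Ys : List (Y32 H)) → AllPairs Apart Ys → Copies H (length Ys)
  fromList Ys ap = record { copy = lookup Ys ; apart = AllPairs-lookup (λ {Y} {Z} → Apart-sym {Y = Y} {Z}) ap }

  module _ {n m : ℕ} {H : ThreeGraph n} (C : Copies H m) (K : ℕ) where
    open Copies C

    -- `1 / K` is the density below which links and codegrees are left to the error term; above it
    -- they outlast the deletion of boundedly many vertices once `n` is large.
    bigVertex : Fin n → Bool
    bigVertex v = n * n ≤ᵇ K * degree H uncovered v

    bigPair : Fin n → Fin n → Bool
    bigPair v w = n ≤ᵇ K * codegree H uncovered v w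

    patternOf : Fin m → Fin m → Fin m → Pattern
    patternOf i j k (suc a) (suc b) (suc c) = edge H (at i a) (at j b) (at k c)
    patternOf i j k (suc a) (suc b) ∗       = bigPair (at i a) (at j b)
    patternOf i j k (suc a) ∗ (suc c)       = bigPair (at i a) (at k c)
    patternOf i j k (suc a) ∗ ∗             = bigVertex (at i a)
    patternOf i j k ∗ (suc b) (suc c)       = bigPair (at j b) (at k c)
    patternOf i j k ∗ (suc b) ∗             = bigVertex (at j b)
    patternOf i j k ∗ ∗ (suc c)             = bigVertex (at k c)
    -- Edges inside the uncovered set are treated apart, by `sparse-or-more`.
    patternOf i j k ∗ ∗ ∗                   = false

    -- `large` serves links and codegrees alike: with `B` four times the number of pieces, it makes
    -- `n * n / K` exceed `n * (2 * B + 1)` and `n / K` exceed `B + 1`, as the realisation of pieces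
    -- requires.
    module Augment (π : Pattern) (I : Improvement π) (rows : Fin 3 → List (Fin m))
      (rows-unique : ∀ g → Unique (rows g)) (rows-apart : ∀ {g h} → g ≢ h → Disjoint (rows g) (rows h))
      (rows-long : ∀ g → length (Improvement.packed I) ≤ length (rows g))
      (homogeneous : ∀ {i j k} → i ∈ rows 0F → j ∈ rows 1F → k ∈ rows 2F → ∀ x y z → patternOf i j k x y z ≡ π x y z)
      (large : K * (2 * (4 * length (Improvement.packed I)) + 2) < n) where
      open Improvement I

      private
        U : List (Fin n)
        U = uncovered

        quota≤ : ∀ g → quota g < length packed
        quota≤ 0F = ≤-trans (s≤s (m≤m+n (quota 0F) _)) gain
        quota≤ 1F = ≤-trans (s≤s (≤-trans (m≤m+n (quota 1F) (quota 2F)) (m≤n+m _ (quota 0F)))) gain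
        quota≤ 2F = ≤-trans (s≤s (≤-trans (m≤n+m (quota 2F) (quota 1F)) (m≤n+m _ (quota 0F)))) gain

        -- Strictness makes every family nonempty, which provides the default entries below.
        quota<rows : ∀ g → quota g < length (rows g)
        quota<rows g = ≤-trans (quota≤ g) (rows-long g)

        head∈ : ∀ (xs : List (Fin m)) → 0 < length xs → ∃[ x ] x ∈ xs
        head∈ (x ∷ _) _ = x , here refl

        default : ∀ g → ∃[ i ] i ∈ rows g
        default g = head∈ (rows g) (≤-trans (s≤s z≤n) (quota<rows g))

        row : Fin 3 → ℕ → Fin m
        row g = nth (proj₁ (default g)) (rows g)

        row-∈ : ∀ {g x} → x < quota g → row g x ∈ rows g
        row-∈ {g} x< = nth-∈ _ (rows g) (<-trans x< (quota<rows g))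

        V : Key → ℕ → Fin n
        V k x = at (row (group k) x) (position k)

        bound : Key → ℕ
        bound k = quota (group k)

        V-key : ∀ g a x → V (key g a) x ≡ at (row g x) a
        V-key g a x = cong₂ (λ h b → at (row h x) b) (group-key g a) (position-key g a)

        bound-key : ∀ g a {x} → x < bound (key g a) → x < quota g
        bound-key g a = subst (λ h → _ < quota h) (group-key g a)

        row-injective : ∀ {g h x y} → x < quota g → y < quota h → row g x ≡ row h y → g ≡ h × x ≡ y
        row-injective {g} {h} {x} {y} x< y< eq with g ≟F h
        ... | yes refl = refl , nth-injective _ (rows-unique g) (<-trans x< (quota<rows g)) (<-trans y< (quota<rows g)) eq
        ... | no g≢h = ⊥-elim (rows-apart g≢h (row-∈ {g} x< , subst (_∈ rows h) (sym eq) (row-∈ {h} y<)))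

        -- Disjointness of copies identifies the copy, disjointness of families the class and the
        -- index, and distinctness of the vertices of a copy the position.
        V-injective : ∀ {k k′ x x′} → x < bound k → x′ < bound k′ → V k x ≡ V k′ x′ → (k , x) ≡ (k′ , x′)
        V-injective {k} {k′} {x} {x′} x< x′< eq with row (group k) x ≟F row (group k′) x′
        ... | no r≢ = ⊥-elim (apart r≢ (vert-∈ (copy (row (group k) x)) (position k) ,
                subst (_∈ Y32-vertices (copy (row (group k′) x′))) (sym eq) (vert-∈ (copy (row (group k′) x′)) (position k′))))
        ... | yes r≡ with row-injective {group k} {group k′} x< x′< r≡
        ... | g≡ , refl = cong (_, x) (key-injective g≡
                (vert-injective (copy (row (group k) x)) (trans eq (cong (λ r → at r (position k′)) (sym r≡)))))

        V∉U : ∀ {k x} → x < bound k → V k x ∉ U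
        V∉U {k} {x} _ = copy∉uncovered (vert-∈ (copy (row (group k) x)) (position k))

      open Packing {H = H} U uncovered-unique V bound (λ {k} {k′} → V-injective {k} {k′}) (λ {k} → V∉U {k}) hiding (at)

      private
        B : ℕ
        B = 4 * length packed

        n>0 : 0 < n
        n>0 = ≤-trans (s≤s z≤n) large

        big⇒degree : ∀ {v} → T (bigVertex v) → n * (2 * B + 1) < degree H U v
        big⇒degree {v} t = ≰⇒> λ le → <⇒≱ large (*-cancelˡ-≤ n {{>-nonZero n>0}} (begin
          n * n                                  ≤⟨ ≤ᵇ⇒≤ _ _ t ⟩
          K * degree H U v                       ≤⟨ *-monoʳ-≤ K le ⟩
          K * (n * (2 * B + 1))                  ≡⟨ swap K n (2 * B + 1) ⟩
          n * (K * (2 * B + 1))                  ≤⟨ *-monoʳ-≤ n (*-monoʳ-≤ K (+-monoʳ-≤ (2 * B) (n≤1+n 1))) ⟩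
          n * (K * (2 * B + 2))                  ∎))
          where
          open ≤-Reasoning
          swap : ∀ a b c → a * (b * c) ≡ b * (a * c)
          swap = solve-∀

        big⇒codegree : ∀ {v w} → T (bigPair v w) → suc B < codegree H U v w
        big⇒codegree {v} {w} t = ≰⇒> λ le → <⇒≱ large (begin
          n                          ≤⟨ ≤ᵇ⇒≤ _ _ t ⟩
          K * codegree H U v w       ≤⟨ *-monoʳ-≤ K le ⟩
          K * suc B                  ≤⟨ *-monoʳ-≤ K (lin (B + 1) z≤n (eq B)) ⟩
          K * (2 * B + 2)            ∎)
          where
          open ≤-Reasoning
          eq : ∀ B → suc B + 0 + (B + 1) ≡ 2 * B + 2 + 0
          eq = solve-∀

        d₀ : Fin 3 → Fin m
        d₀ g = proj₁ (default g)

        d₀∈ : ∀ g → d₀ g ∈ rows g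
        d₀∈ g = proj₂ (default g)

        single-at : ∀ g a → (∀ {i} → i ∈ rows g → T (bigVertex (at i a))) → Realisable B (key g a ∷ [])
        single-at g a big = single-realisable {k = key g a} λ {x} x< →
          subst (λ v → n * (2 * B + 1) < degree H U v) (sym (V-key g a x)) (big⇒degree (big (row-∈ {g} (bound-key g a x<))))

        pair-at : ∀ g h a b → (∀ {i j} → i ∈ rows g → j ∈ rows h → T (bigPair (at i a) (at j b))) → Realisable B (key g a ∷ key h b ∷ [])
        pair-at g h a b big = pair-realisable {k = key g a} {l = key h b} λ {x} {y} x< y< →
          subst₂ (λ v w → suc B < codegree H U v w) (sym (V-key g a x)) (sym (V-key h b y))
            (big⇒codegree (big (row-∈ {g} (bound-key g a x<)) (row-∈ {h} (bound-key h b y<))))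

        triple-at : ∀ f g h a b c → (∀ {i j k} → i ∈ rows f → j ∈ rows g → k ∈ rows h → T (edge H (at j b) (at k c) (at i a))) →
                    Realisable B (key f a ∷ key f a ∷ key g b ∷ key h c ∷ [])
        triple-at f g h a b c edges = triple-realisable {k = key f a} {l = key g b} {j = key h c} λ {x} {y} {z} x< y< z< →
          subst T (sym (trans (cong₂ (λ v w → edge H v w (V (key f a) x)) (V-key g b y) (V-key h c z))
                              (cong (edge H (at (row g y) b) (at (row h z) c)) (V-key f a x))))
            (edges (row-∈ {f} (bound-key f a x<)) (row-∈ {g} (bound-key g b y<)) (row-∈ {h} (bound-key h c z<)))

        realisable : ∀ {ks} → Piece π ks → Realisable B ks
        realisable (single₀ {a} t) = single-at 0F a λ i∈ → subst T (sym (homogeneous i∈ (d₀∈ 1F) (d₀∈ 2F) (suc a) ∗ ∗)) t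
        realisable (single₁ {b} t) = single-at 1F b λ j∈ → subst T (sym (homogeneous (d₀∈ 0F) j∈ (d₀∈ 2F) ∗ (suc b) ∗)) t
        realisable (single₂ {c} t) = single-at 2F c λ k∈ → subst T (sym (homogeneous (d₀∈ 0F) (d₀∈ 1F) k∈ ∗ ∗ (suc c))) t
        realisable (pair₀₁ {a} {b} t) = pair-at 0F 1F a b λ i∈ j∈ → subst T (sym (homogeneous i∈ j∈ (d₀∈ 2F) (suc a) (suc b) ∗)) t
        realisable (pair₀₂ {a} {c} t) = pair-at 0F 2F a c λ i∈ k∈ → subst T (sym (homogeneous i∈ (d₀∈ 1F) k∈ (suc a) ∗ (suc c))) t
        realisable (pair₁₂ {b} {c} t) = pair-at 1F 2F b c λ j∈ k∈ → subst T (sym (homogeneous (d₀∈ 0F) j∈ k∈ ∗ (suc b) (suc c))) t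
        realisable (triple₀ {a} {b} {c} t) = triple-at 0F 1F 2F a b c λ i∈ j∈ k∈ →
          subst T (trans (sym (homogeneous i∈ j∈ k∈ (suc a) (suc b) (suc c))) (rot H _ _ _)) t
        realisable (triple₁ {a} {b} {c} t) = triple-at 1F 0F 2F b a c λ j∈ i∈ k∈ →
          subst T (trans (sym (homogeneous i∈ j∈ k∈ (suc a) (suc b) (suc c))) (sym₂₃ H _ _ _)) t
        realisable (triple₂ {a} {b} {c} t) = triple-at 2F 0F 1F c a b λ k∈ i∈ j∈ →
          subst T (sym (homogeneous i∈ j∈ k∈ (suc a) (suc b) (suc c))) t

        concatMap-proj₁ : ∀ (ps : List (SomePiece π)) → concatMap (λ ks → ks) (map proj₁ ps) ≡ concatMap proj₁ ps
        concatMap-proj₁ []       = refl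
        concatMap-proj₁ (p ∷ ps) = cong (proj₁ p ++_) (concatMap-proj₁ ps)

        opaque
          slots : Σ (List Slot) λ S → map proj₁ S ≡ concatMap proj₁ packed × Valid S
          slots = allocate (concatMap proj₁ packed) fits

        S : List Slot
        S = proj₁ slots

        opaque
          new : Σ (List (Y32 H)) λ Ys → length Ys ≡ length (map proj₁ packed) × AllPairs Apart Ys ×
                  All (λ Y → ∀ z → z ∈ Y32-vertices Y → z ∈ map (λ s → V (proj₁ s) (proj₂ s)) S ⊎ z ∈ U) Ys
          new = realise {B} (map proj₁ packed) (All.map⁺ (All.tabulate λ {p} _ → realisable (proj₂ p)))
            (≤-reflexive (cong (4 *_) (length-map proj₁ packed))) S
            (trans (proj₁ (proj₂ slots)) (sym (concatMap-proj₁ packed))) (proj₂ (proj₂ slots))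

        removed : List (Fin m)
        removed = map (row 0F) (upTo (quota 0F)) ++ (map (row 1F) (upTo (quota 1F)) ++ map (row 2F) (upTo (quota 2F)))

        length-removed : length removed ≡ quota 0F + (quota 1F + quota 2F)
        length-removed = trans (length-++ (map (row 0F) (upTo (quota 0F)))) (cong₂ _+_ (len 0F)
          (trans (length-++ (map (row 1F) (upTo (quota 1F)))) (cong₂ _+_ (len 1F) (len 2F))))
          where
          len : ∀ g → length (map (row g) (upTo (quota g))) ≡ quota g
          len g = trans (length-map (row g) (upTo (quota g))) (length-upTo (quota g))

        removed-∋ : ∀ g {x} → x < quota g → row g x ∈ removed
        removed-∋ 0F x< = ∈-++⁺ˡ (∈-map⁺ (row 0F) (∈-upTo⁺ x<))
        removed-∋ 1F x< = ∈-++⁺ʳ (map (row 0F) (upTo (quota 0F))) (∈-++⁺ˡ (∈-map⁺ (row 1F) (∈-upTo⁺ x<)))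
        removed-∋ 2F x< = ∈-++⁺ʳ (map (row 0F) (upTo (quota 0F))) (∈-++⁺ʳ (map (row 1F) (upTo (quota 1F))) (∈-map⁺ (row 2F) (∈-upTo⁺ x<)))

        kept : List (Fin m)
        kept = filter (λ i → ¬? (i ∈? removed)) (allFin m)

        Ys Zs : List (Y32 H)
        Ys = proj₁ new
        Zs = map copy kept ++ Ys

        row∉ : ∀ {i} → i ∈ kept → ∀ {s} → s ∈ S → i ≢ row (group (proj₁ s)) (proj₂ s)
        row∉ i∈ {s} s∈ i≡ = proj₂ (∈-filter⁻ (λ i → ¬? (i ∈? removed)) {xs = allFin m} i∈)
          (subst (_∈ removed) (sym i≡) (removed-∋ (group (proj₁ s)) (All.lookup (proj₂ (proj₂ (proj₂ slots))) s∈)))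

        cross : ∀ {i} → i ∈ kept → ∀ {Y} → Y ∈ Ys → Apart (copy i) Y
        cross {i} i∈ {Y} Y∈ {z} (z∈i , z∈Y) = case (All.lookup (proj₂ (proj₂ (proj₂ new))) Y∈ z z∈Y)
          where
          case : z ∈ map (λ s → V (proj₁ s) (proj₂ s)) S ⊎ z ∈ U → ⊥
          case (inj₂ z∈U) = copy∉uncovered z∈i z∈U
          case (inj₁ z∈S) = let s , s∈ , eq = ∈-map⁻ (λ s → V (proj₁ s) (proj₂ s)) z∈S in
            apart (row∉ i∈ s∈) (z∈i , subst (_∈ Y32-vertices (copy (row (group (proj₁ s)) (proj₂ s)))) (sym eq)
              (vert-∈ (copy (row (group (proj₁ s)) (proj₂ s))) (position (proj₁ s))))

        Zs-apart : AllPairs Apart Zs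
        Zs-apart = AllPairs.++⁺
          (AllPairs.map⁺ (AllPairs.map apart (Unique.filter⁺ (λ i → ¬? (i ∈? removed)) (Unique.allFin⁺ m))))
          (proj₁ (proj₂ (proj₂ new)))
          (All.map⁺ (All.tabulate λ i∈ → All.tabulate λ Y∈ → cross i∈ Y∈))

        gained : ∀ {m k r p z} → m ≤ k + r → r < p → z ≡ k + p → m < z
        gained {k = k} m≤ r<p z≡ = ≤-trans (s≤s m≤) (≤-trans (+-monoʳ-< k r<p) (≤-reflexive (sym z≡)))

        length-Zs : length Zs ≡ length kept + length packed
        length-Zs = trans (length-++ (map copy kept)) (cong₂ _+_ (length-map copy kept)
          (trans (proj₁ (proj₂ new)) (length-map proj₁ packed)))

        -- Only a lower bound on the number of kept copies enters, which repetitions in `removed`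
        -- could only improve.
        more : m < length Zs
        more = gained {k = length kept} (length≤filter+ removed) (subst (_< length packed) (sym length-removed) gain) length-Zs

      augmented : ∃[ m′ ] m < m′ × Copies H m′
      augmented = length Zs , more , fromList Zs Zs-apart

-- Edges counted as ordered triples

module EdgeCount where
  open Sums
  open Realisation
  open BlowUp
  open LocalWeights using (∑₄)

  open import Data.Nat using (ℕ; suc; _+_; _*_; _≤_; _<_; _<ᵇ_; _≤ᵇ_)
  open import Data.Nat.Properties
  open import Data.Nat.Tactic.RingSolver using (solve-∀)

  ∑³ : ∀ {A : Set} → List A → List A → List A → (A → A → A → ℕ) → ℕ
  ∑³ xs ys zs f = ∑ xs (λ x → ∑ ys (λ y → ∑ zs (f x y)))

  module _ {A : Set} where
    ∑³-cong : ∀ (xs ys zs : List A) {f g : A → A → A → ℕ} → (∀ x y z → f x y z ≡ g x y z) → ∑³ xs ys zs f ≡ ∑³ xs ys zs g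
    ∑³-cong xs ys zs h = ∑-cong xs λ x → ∑-cong ys λ y → ∑-cong zs (h x y)

    ∑³-mono : ∀ (xs ys zs : List A) {f g : A → A → A → ℕ} → (∀ x y z → f x y z ≤ g x y z) → ∑³ xs ys zs f ≤ ∑³ xs ys zs g
    ∑³-mono xs ys zs h = ∑-mono xs λ x → ∑-mono ys λ y → ∑-mono zs (h x y)

    ∑³-+ : ∀ (xs ys zs : List A) (f g : A → A → A → ℕ) →
           ∑³ xs ys zs (λ x y z → f x y z + g x y z) ≡ ∑³ xs ys zs f + ∑³ xs ys zs g
    ∑³-+ xs ys zs f g = trans
      (∑-cong xs λ x → trans (∑-cong ys λ y → ∑-+ zs (f x y) (g x y)) (∑-+ ys _ _))
      (∑-+ xs _ _)

    ∑³-* : ∀ c (xs ys zs : List A) (f : A → A → A → ℕ) → ∑³ xs ys zs (λ x y z → c * f x y z) ≡ c * ∑³ xs ys zs f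
    ∑³-* c xs ys zs f = trans
      (∑-cong xs λ x → trans (∑-cong ys λ y → ∑-* c zs (f x y)) (∑-* c ys _))
      (∑-* c xs _)

    ∑³-swap₁₂ : ∀ (xs ys zs : List A) f → ∑³ xs ys zs f ≡ ∑³ ys xs zs (λ y x z → f x y z)
    ∑³-swap₁₂ xs ys zs f = ∑-swap xs ys (λ x y → ∑ zs (f x y))

    ∑³-swap₂₃ : ∀ (xs ys zs : List A) f → ∑³ xs ys zs f ≡ ∑³ xs zs ys (λ x z y → f x y z)
    ∑³-swap₂₃ xs ys zs f = ∑-cong xs λ x → ∑-swap ys zs (f x)

  length-filter : ∀ {A : Set} {P : A → Set} (P? : ∀ x → Dec (P x)) xs → length (filter P? xs) ≡ ∑ xs (λ x → ⟦ does (P? x) ⟧)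
  length-filter P? []       = refl
  length-filter P? (x ∷ xs) with does (P? x)
  ... | true  = cong suc (length-filter P? xs)
  ... | false = length-filter P? xs

  ∑-triples : ∀ n (f : Fin n × Fin n × Fin n → ℕ) →
              ∑ (triples n) f ≡ ∑³ (allFin n) (allFin n) (allFin n) (λ x y z → f (x , y , z))
  ∑-triples n f = trans (∑-concatMap _ (allFin n) f)
    (∑-cong (allFin n) λ x → trans (∑-concatMap _ (allFin n) f)
      (∑-cong (allFin n) λ y → ∑-map (λ z → (x , y , z)) (allFin n) f))

  private
    both : (Bool → Bool) → Bool
    both f = f true ∧ f false

    both-sound : ∀ f → T (both f) → ∀ b → T (f b)
    both-sound f t true  = proj₁ (Equivalence.to (T-∧ {f true}) t)
    both-sound f t false = proj₂ (Equivalence.to (T-∧ {f true}) t)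

    _⇒ᵇ_ : Bool → Bool → Bool
    true  ⇒ᵇ b = b
    false ⇒ᵇ b = true

    ⇒ᵇ-mp : ∀ {a b} → T (a ⇒ᵇ b) → T a → T b
    ⇒ᵇ-mp {true} t _ = t

    orders : Bool → Bool → Bool → Bool → Bool → Bool → ℕ
    orders xy yx yz zy xz zx =
      ⟦ xy ∧ yz ⟧ + (⟦ xz ∧ zy ⟧ + (⟦ yx ∧ xz ⟧ + (⟦ yz ∧ zx ⟧ + (⟦ zx ∧ xy ⟧ + ⟦ zy ∧ yx ⟧))))

    consistent : Bool → Bool → Bool → Bool → Bool → Bool → Bool
    consistent xy yx yz zy xz zx =
      not (xy ∧ yx) ∧ (not (yz ∧ zy) ∧ (not (xz ∧ zx) ∧ (not (xy ∧ (yz ∧ zx)) ∧ not (yx ∧ (zy ∧ xz)))))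

    -- Six comparisons decide which orderings of three numbers are increasing. Asymmetry and the
    -- absence of 3-cycles leave at most one, which is checked over all 64 truth assignments by
    -- evaluation.
    orders≤1 : ∀ xy yx yz zy xz zx → T (consistent xy yx yz zy xz zx) → orders xy yx yz zy xz zx ≤ 1
    orders≤1 xy yx yz zy xz zx t = ≤ᵇ⇒≤ _ 1 (⇒ᵇ-mp
      (both-sound (λ zx → consistent xy yx yz zy xz zx ⇒ᵇ (orders xy yx yz zy xz zx ≤ᵇ 1))
      (both-sound (λ xz → both λ zx → consistent xy yx yz zy xz zx ⇒ᵇ (orders xy yx yz zy xz zx ≤ᵇ 1))
      (both-sound (λ zy → both λ xz → both λ zx → consistent xy yx yz zy xz zx ⇒ᵇ (orders xy yx yz zy xz zx ≤ᵇ 1))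
      (both-sound (λ yz → both λ zy → both λ xz → both λ zx → consistent xy yx yz zy xz zx ⇒ᵇ (orders xy yx yz zy xz zx ≤ᵇ 1))
      (both-sound (λ yx → both λ yz → both λ zy → both λ xz → both λ zx → consistent xy yx yz zy xz zx ⇒ᵇ (orders xy yx yz zy xz zx ≤ᵇ 1))
      (both-sound (λ xy → both λ yx → both λ yz → both λ zy → both λ xz → both λ zx → consistent xy yx yz zy xz zx ⇒ᵇ (orders xy yx yz zy xz zx ≤ᵇ 1))
      tt xy) yx) yz) zy) xz) zx) t)

    T-not : ∀ {b} → (T b → ⊥) → T (not b)
    T-not {true}  h = h tt
    T-not {false} h = tt

    <ᵇ-consistent : ∀ x y z → T (consistent (x <ᵇ y) (y <ᵇ x) (y <ᵇ z) (z <ᵇ y) (x <ᵇ z) (z <ᵇ x))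
    <ᵇ-consistent x y z = from (T-not (λ t → let p , q = to t in <-asym (<ᵇ⇒< x y p) (<ᵇ⇒< y x q)) ,
      from (T-not (λ t → let p , q = to t in <-asym (<ᵇ⇒< y z p) (<ᵇ⇒< z y q)) ,
      from (T-not (λ t → let p , q = to t in <-asym (<ᵇ⇒< x z p) (<ᵇ⇒< z x q)) ,
      from (T-not (λ t → let p , qr = to t ; q , r = to qr in
                         <-asym (<-trans (<ᵇ⇒< x y p) (<ᵇ⇒< y z q)) (<ᵇ⇒< z x r)) ,
            T-not (λ t → let p , qr = to t ; q , r = to qr in
                         <-asym (<-trans (<ᵇ⇒< z y q) (<ᵇ⇒< y x p)) (<ᵇ⇒< x z r))))))
      where
      to : ∀ {a b} → T (a ∧ b) → T a × T b
      to {a} = Equivalence.to (T-∧ {a})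
      from : ∀ {a b} → T a × T b → T (a ∧ b)
      from {a} = Equivalence.from (T-∧ {a})

  module _ {n : ℕ} (H : ThreeGraph n) where

    private
      V : List (Fin n)
      V = allFin n

      increasing : Fin n → Fin n → Fin n → Bool
      increasing x y z = (toℕ x <ᵇ toℕ y) ∧ (toℕ y <ᵇ toℕ z)

      ordered : Fin n → Fin n → Fin n → ℕ
      ordered x y z = ⟦ increasing x y z ⟧ * ⟦ edge H x y z ⟧

    e≡∑ : e H ≡ ∑³ V V V ordered
    e≡∑ = trans (length-filter _ (triples n)) (trans
      (∑-cong (triples n) λ t → split (increasing (proj₁ t) (proj₁ (proj₂ t)) (proj₂ (proj₂ t))) (edge H (proj₁ t) (proj₁ (proj₂ t)) (proj₂ (proj₂ t))))
      (∑-triples n (λ t → ordered (proj₁ t) (proj₁ (proj₂ t)) (proj₂ (proj₂ t)))))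
      where
      split : ∀ p q → ⟦ p ∧ does (q ≟B true) ⟧ ≡ ⟦ p ⟧ * ⟦ q ⟧
      split true  true  = refl
      split true  false = refl
      split false q     = refl

    -- All six sums over reordered increasing triples equal `e H`, and at each ordered triple at
    -- most one of them contributes, by `orders≤1`.
    6e≤∑ : 6 * e H ≤ ∑³ V V V (λ x y z → ⟦ edge H x y z ⟧)
    6e≤∑ = begin
      6 * e H                                  ≡⟨ cong (6 *_) e≡∑ ⟩
      6 * E                                    ≡⟨ sixfold E ⟩
      E + (E + (E + (E + (E + E))))            ≡⟨ cong (E +_) (cong₂ _+_ xzy (cong₂ _+_ yxz (cong₂ _+_ yzx (cong₂ _+_ zxy zyx)))) ⟩
      ∑³ V V V f₁ + (∑³ V V V f₂ + (∑³ V V V f₃ + (∑³ V V V f₄ + (∑³ V V V f₅ + ∑³ V V V f₆))))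
        ≡⟨ collect ⟨
      ∑³ V V V (λ x y z → f₁ x y z + (f₂ x y z + (f₃ x y z + (f₄ x y z + (f₅ x y z + f₆ x y z)))))
        ≤⟨ ∑³-mono V V V pointwise ⟩
      ∑³ V V V (λ x y z → ⟦ edge H x y z ⟧)    ∎
      where
      open ≤-Reasoning
      E : ℕ
      E = ∑³ V V V ordered
      sixfold : ∀ e → 6 * e ≡ e + (e + (e + (e + (e + e))))
      sixfold = solve-∀
      f₁ f₂ f₃ f₄ f₅ f₆ : Fin n → Fin n → Fin n → ℕ
      f₁ x y z = ordered x y z
      f₂ x y z = ordered x z y
      f₃ x y z = ordered y x z
      f₄ x y z = ordered y z x
      f₅ x y z = ordered z x y
      f₆ x y z = ordered z y x
      xzy : E ≡ ∑³ V V V f₂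
      xzy = ∑³-swap₂₃ V V V ordered
      yxz : E ≡ ∑³ V V V f₃
      yxz = ∑³-swap₁₂ V V V ordered
      yzx : E ≡ ∑³ V V V f₄
      yzx = trans xzy (∑³-swap₁₂ V V V f₂)
      zxy : E ≡ ∑³ V V V f₅
      zxy = trans yxz (∑³-swap₂₃ V V V f₃)
      zyx : E ≡ ∑³ V V V f₆
      zyx = trans yzx (∑³-swap₂₃ V V V f₄)
      collect : ∑³ V V V (λ x y z → f₁ x y z + (f₂ x y z + (f₃ x y z + (f₄ x y z + (f₅ x y z + f₆ x y z)))))
              ≡ ∑³ V V V f₁ + (∑³ V V V f₂ + (∑³ V V V f₃ + (∑³ V V V f₄ + (∑³ V V V f₅ + ∑³ V V V f₆))))
      collect = trans (∑³-+ V V V f₁ _) (cong (∑³ V V V f₁ +_)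
        (trans (∑³-+ V V V f₂ _) (cong (∑³ V V V f₂ +_)
        (trans (∑³-+ V V V f₃ _) (cong (∑³ V V V f₃ +_)
        (trans (∑³-+ V V V f₄ _) (cong (∑³ V V V f₄ +_) (∑³-+ V V V f₅ f₆))))))))
      pointwise : ∀ x y z → f₁ x y z + (f₂ x y z + (f₃ x y z + (f₄ x y z + (f₅ x y z + f₆ x y z)))) ≤ ⟦ edge H x y z ⟧
      pointwise x y z = begin
        f₁ x y z + (f₂ x y z + (f₃ x y z + (f₄ x y z + (f₅ x y z + f₆ x y z))))
          ≡⟨ cong (f₁ x y z +_) (cong₂ _+_ (sameEdge (increasing x z y) (sym₂₃ H x z y)) (cong₂ _+_ (sameEdge (increasing y x z) (sym₁₂ H y x z))
             (cong₂ _+_ (sameEdge (increasing y z x) (trans (sym₂₃ H y z x) (sym₁₂ H y x z)))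
             (cong₂ _+_ (sameEdge (increasing z x y) (trans (sym₁₂ H z x y) (sym₂₃ H x z y)))
             (sameEdge (increasing z y x) (trans (sym₁₂ H z y x) (trans (sym₂₃ H y z x) (sym₁₂ H y x z)))))))) ⟩
        _ ≡⟨ factor ⟦ increasing x y z ⟧ ⟦ increasing x z y ⟧ ⟦ increasing y x z ⟧ ⟦ increasing y z x ⟧ ⟦ increasing z x y ⟧ ⟦ increasing z y x ⟧ ⟦ edge H x y z ⟧ ⟩
        orders (toℕ x <ᵇ toℕ y) (toℕ y <ᵇ toℕ x) (toℕ y <ᵇ toℕ z) (toℕ z <ᵇ toℕ y) (toℕ x <ᵇ toℕ z) (toℕ z <ᵇ toℕ x) * ⟦ edge H x y z ⟧
          ≤⟨ *-monoˡ-≤ ⟦ edge H x y z ⟧ (orders≤1 (toℕ x <ᵇ toℕ y) (toℕ y <ᵇ toℕ x) (toℕ y <ᵇ toℕ z) (toℕ z <ᵇ toℕ y) (toℕ x <ᵇ toℕ z) (toℕ z <ᵇ toℕ x) (<ᵇ-consistent (toℕ x) (toℕ y) (toℕ z))) ⟩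
        1 * ⟦ edge H x y z ⟧ ≡⟨ *-identityˡ _ ⟩
        ⟦ edge H x y z ⟧ ∎
        where
        sameEdge : ∀ p {b c} → b ≡ c → ⟦ p ⟧ * ⟦ b ⟧ ≡ ⟦ p ⟧ * ⟦ c ⟧
        sameEdge p eq = cong (λ b → ⟦ p ⟧ * ⟦ b ⟧) eq
        factor : ∀ a b c d e f g → a * g + (b * g + (c * g + (d * g + (e * g + f * g)))) ≡ (a + (b + (c + (d + (e + f))))) * g
        factor = solve-∀

-- Edges sorted by the number of covered vertices

module CoverCount where
  open Sums
  open LocalWeights using (∑₄; ∑∑; ∑∑∑; ⟦⟧≤)
  open Patterns
  open Shares
  open Realisation
  open BlowUp
  open EdgeCount

  open import Data.Nat using (ℕ; suc; _+_; _*_; _≤_; _<_; _≤ᵇ_; _<?_)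
  open import Data.Nat.Properties
  open import Data.Nat.Tactic.RingSolver using (solve-∀)

  module _ {A : Set} where
    ∑³-++₁ : ∀ (xs xs′ ys zs : List A) f → ∑³ (xs ++ xs′) ys zs f ≡ ∑³ xs ys zs f + ∑³ xs′ ys zs f
    ∑³-++₁ xs xs′ ys zs f = ∑-++ xs xs′ _

    ∑³-++₂ : ∀ (xs ys ys′ zs : List A) f → ∑³ xs (ys ++ ys′) zs f ≡ ∑³ xs ys zs f + ∑³ xs ys′ zs f
    ∑³-++₂ xs ys ys′ zs f = trans (∑-cong xs λ x → ∑-++ ys ys′ _) (∑-+ xs _ _)

    ∑³-++₃ : ∀ (xs ys zs zs′ : List A) f → ∑³ xs ys (zs ++ zs′) f ≡ ∑³ xs ys zs f + ∑³ xs ys zs′ f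
    ∑³-++₃ xs ys zs zs′ f = trans (∑-cong xs λ x → trans (∑-cong ys λ y → ∑-++ zs zs′ (f x y)) (∑-+ ys _ _)) (∑-+ xs _ _)

    module _ (f : A → A → A → ℕ) (f₁₂ : ∀ x y z → f x y z ≡ f y x z) (f₂₃ : ∀ x y z → f x y z ≡ f x z y) where
      ∑³-sym₁₂ : ∀ xs ys zs → ∑³ xs ys zs f ≡ ∑³ ys xs zs f
      ∑³-sym₁₂ xs ys zs = trans (∑³-swap₁₂ xs ys zs f) (∑³-cong ys xs zs λ y x z → f₁₂ x y z)

      ∑³-sym₂₃ : ∀ xs ys zs → ∑³ xs ys zs f ≡ ∑³ xs zs ys f
      ∑³-sym₂₃ xs ys zs = trans (∑³-swap₂₃ xs ys zs f) (∑³-cong xs zs ys λ x z y → f₂₃ x y z)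

      -- By symmetry the eight blocks of the cube collapse to four, according to the number of
      -- entries from `U`.
      ∑³-cube : ∀ (S U : List A) → ∑³ (S ++ U) (S ++ U) (S ++ U) f
              ≡ ∑³ S S S f + (3 * ∑³ S S U f + (3 * ∑³ S U U f + ∑³ U U U f))
      ∑³-cube S U = begin
        ∑³ (S ++ U) W W f                           ≡⟨ ∑³-++₁ S U W W f ⟩
        ∑³ S W W f + ∑³ U W W f                     ≡⟨ cong₂ _+_ (slice S) (slice U) ⟩
        (∑³ S S S f + 2 * ∑³ S S U f + ∑³ S U U f) + (∑³ U S S f + 2 * ∑³ U S U f + ∑³ U U U f)
          ≡⟨ cong₂ (λ x y → (∑³ S S S f + 2 * ∑³ S S U f + ∑³ S U U f) + (x + 2 * y + ∑³ U U U f))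
               (trans (∑³-sym₁₂ U S S) (∑³-sym₂₃ S U S)) (∑³-sym₁₂ U S U) ⟩
        (∑³ S S S f + 2 * ∑³ S S U f + ∑³ S U U f) + (∑³ S S U f + 2 * ∑³ S U U f + ∑³ U U U f)
          ≡⟨ eq (∑³ S S S f) (∑³ S S U f) (∑³ S U U f) (∑³ U U U f) ⟩
        ∑³ S S S f + (3 * ∑³ S S U f + (3 * ∑³ S U U f + ∑³ U U U f)) ∎
        where
        open ≡-Reasoning
        W : List A
        W = S ++ U
        eq : ∀ a b c d → (a + 2 * b + c) + (b + 2 * c + d) ≡ a + (3 * b + (3 * c + d))
        eq = solve-∀
        slice : ∀ X → ∑³ X W W f ≡ ∑³ X S S f + 2 * ∑³ X S U f + ∑³ X U U f
        slice X = begin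
          ∑³ X (S ++ U) W f                         ≡⟨ ∑³-++₂ X S U W f ⟩
          ∑³ X S W f + ∑³ X U W f                   ≡⟨ cong₂ _+_ (∑³-++₃ X S S U f) (∑³-++₃ X U S U f) ⟩
          (∑³ X S S f + ∑³ X S U f) + (∑³ X U S f + ∑³ X U U f)
            ≡⟨ cong (λ y → (∑³ X S S f + ∑³ X S U f) + (y + ∑³ X U U f)) (∑³-sym₂₃ X U S) ⟩
          (∑³ X S S f + ∑³ X S U f) + (∑³ X S U f + ∑³ X U U f)
            ≡⟨ eq′ (∑³ X S S f) (∑³ X S U f) (∑³ X U U f) ⟩
          ∑³ X S S f + 2 * ∑³ X S U f + ∑³ X U U f  ∎
          where
          eq′ : ∀ a b c → (a + b) + (b + c) ≡ a + 2 * b + c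
          eq′ = solve-∀

  ∑³-⊆ : ∀ {n} {W : List (Fin n)} (f : Fin n → Fin n → Fin n → ℕ) → (∀ x → x ∈ W) →
         ∑³ (allFin n) (allFin n) (allFin n) f ≤ ∑³ W W W f
  ∑³-⊆ {n} {W} f all = ≤-trans (∑-mono (allFin n) λ x → ≤-trans (∑-mono (allFin n) λ y → sub _) (sub _)) (sub _)
    where
    sub : ∀ g → ∑ (allFin n) g ≤ ∑ W g
    sub g = ∑-⊆ g (Unique.allFin⁺ n) (λ {x} _ → all x)

  module _ {n m : ℕ} {H : ThreeGraph n} (C : Copies H m) where
    open Copies C

    ∑-cover : ∀ f → ∑ cover f ≡ ∑ (allFin m) (λ i → ∑₄ (λ a → f (at i a)))
    ∑-cover f = ∑-concatMap (λ i → Y32-vertices (copy i)) (allFin m) f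

    length-cover : length cover ≡ 4 * m
    length-cover = trans (length≡∑ cover) (trans (∑-cover (λ _ → 1)) (trans (∑-const 4 (allFin m))
      (trans (cong (_* 4) (length-allFin m)) (*-comm m 4))))

    cover-unique : Unique cover
    cover-unique = Unique.concat⁺ (All.map⁺ (All.tabulate λ {i} _ → vertsDistinct (copy i)))
      (AllPairs.map⁺ (AllPairs.map apart (Unique.allFin⁺ m)))

    everywhere : ∀ x → x ∈ cover ++ uncovered
    everywhere x with x ∈? cover
    ... | yes x∈ = ∈-++⁺ˡ x∈
    ... | no x∉  = ∈-++⁺ʳ cover (∈-filter⁺ (λ x → ¬? (x ∈? cover)) (∈-allFin x) x∉)

    4m+u≤n : 4 * m + length uncovered ≤ n
    4m+u≤n = subst (_≤ n) (trans (length-++ cover) (cong (_+ length uncovered) length-cover))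
      (Unique⇒length≤ (Unique.++⁺ cover-unique uncovered-unique λ (x∈ , x∉) →
        proj₂ (∈-filter⁻ (λ x → ¬? (x ∈? cover)) {xs = allFin n} x∉) x∈))

    toTiling : Tiling H
    toTiling = record { copies = map copy (allFin m)
                      ; disjoint = subst Unique (cong concat (map-∘ (allFin m))) cover-unique }

    covered-toTiling : covered toTiling ≡ 4 * m
    covered-toTiling = trans (cong (length ∘ concat) (sym (map-∘ (allFin m)))) length-cover

    private
      U : List (Fin n)
      U = uncovered

      u : ℕ
      u = length uncovered

      E : Fin n → Fin n → Fin n → ℕ
      E x y z = ⟦ edge H x y z ⟧

    -- A pair of uncovered vertices with two common uncovered neighbours is a new copy by itself.
    -- The first alternative leaves at most `n * n` ordered edges inside the uncovered set.
    sparse-or-more : (∀ x y → x ∈ U → y ∈ U → codegree H U x y ≤ 1) ⊎ (∃[ m′ ] m < m′ × Copies H m′)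
    sparse-or-more with any? (λ x → any? (λ y → (x ∈? U ×-dec y ∈? U) ×-dec 1 <? codegree H U x y))
    ... | no ∄ = inj₁ λ x y x∈ y∈ → ≮⇒≥ λ 1< → ∄ (x , y , (x∈ , y∈) , 1<)
    ... | yes (x , y , (x∈ , y∈) , 1<) with fresh (edge H x y) [] uncovered-unique (<-trans ≤-refl 1<)
    ... | z , z∈ , ez , _ with fresh (edge H x y) (z ∷ []) uncovered-unique 1<
    ... | z′ , z′∈ , ez′ , z′∉ = inj₂ (_ , ≤-reflexive (cong suc (sym (trans (length-map copy (allFin m)) (length-allFin m)))) ,
          fromList (Y ∷ map copy (allFin m)) (All.map⁺ (All.tabulate λ {i} _ → new i) ∷ AllPairs.map⁺ (AllPairs.map apart (Unique.allFin⁺ m))))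
      where
      Y : Y32 H
      Y = y32 H x y z z′ ez ez′ (λ eq → z′∉ (here (sym eq)))
      new : ∀ i → Apart Y (copy i)
      new i (here refl , v∈) = copy∉uncovered v∈ x∈
      new i (there (here refl) , v∈) = copy∉uncovered v∈ y∈
      new i (there (there (here refl)) , v∈) = copy∉uncovered v∈ z∈
      new i (there (there (there (here refl))) , v∈) = copy∉uncovered v∈ z′∈

    module _ (K : ℕ) where

      -- The counts are over ordered tuples, so edges with one or two covered vertices appear in
      -- three arrangements. In `mainTerm` a big link or codegree is charged its maximum, `u * u` or
      -- `u`.
      A₁ A₂ A₃ mainTerm : ℕ
      A₁ = ∑ cover (λ v → ⟦ bigVertex C K v ⟧)
      A₂ = ∑ cover (λ v → ∑ cover (λ w → ⟦ bigPair C K v w ⟧))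
      A₃ = ∑³ cover cover cover E
      mainTerm = 3 * (A₁ * (u * u)) + (3 * (A₂ * u) + A₃)

      private
        notBig : ∀ {x c} N → x ≤ c → K * x ≤ K * c * ⟦ N ≤ᵇ K * x ⟧ + N
        notBig {x} {c} N x≤c with N ≤ᵇ K * x in eq
        ... | true  = ≤-trans (*-monoʳ-≤ K x≤c) (≤-trans (≤-reflexive (sym (*-identityʳ (K * c)))) (m≤m+n (K * c * 1) N))
        ... | false = ≤-trans (≰⇒≥ λ N≤ → subst T eq (≤⇒≤ᵇ N≤)) (m≤n+m N (K * c * 0))

        codegree≤ : ∀ v w → codegree H U v w ≤ u
        codegree≤ v w = ≤-trans (∑-≤const U 1 (λ x → ⟦⟧≤1 (edge H v w x))) (≤-reflexive (*-identityʳ u))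

        degree≤ : ∀ v → degree H U v ≤ u * u
        degree≤ v = ∑-≤const U u (codegree≤ v)

      one-covered : K * ∑³ cover U U E ≤ K * (A₁ * (u * u)) + 4 * m * (n * n)
      one-covered = begin
        K * ∑ cover (degree H U)                                            ≡⟨ ∑-* K cover (degree H U) ⟨
        ∑ cover (λ v → K * degree H U v)                                    ≤⟨ ∑-mono cover (λ v → notBig (n * n) (degree≤ v)) ⟩
        ∑ cover (λ v → K * (u * u) * ⟦ bigVertex C K v ⟧ + n * n)           ≡⟨ ∑-+ cover (λ v → K * (u * u) * ⟦ bigVertex C K v ⟧) (λ _ → n * n) ⟩
        ∑ cover (λ v → K * (u * u) * ⟦ bigVertex C K v ⟧) + ∑ cover (λ _ → n * n)
          ≡⟨ cong₂ _+_ (∑-* (K * (u * u)) cover (λ v → ⟦ bigVertex C K v ⟧)) (trans (∑-const (n * n) cover) (cong (_* (n * n)) length-cover)) ⟩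
        K * (u * u) * A₁ + 4 * m * (n * n)                                  ≡⟨ cong (_+ 4 * m * (n * n)) (trans (*-assoc K (u * u) A₁) (cong (K *_) (*-comm (u * u) A₁))) ⟩
        K * (A₁ * (u * u)) + 4 * m * (n * n)                                ∎
        where open ≤-Reasoning

      two-covered : K * ∑³ cover cover U E ≤ K * (A₂ * u) + 4 * m * (4 * m * n)
      two-covered = begin
        K * ∑ cover (λ v → ∑ cover (codegree H U v))                        ≡⟨ ∑-* K cover _ ⟨
        ∑ cover (λ v → K * ∑ cover (codegree H U v))                        ≤⟨ ∑-mono cover inner ⟩
        ∑ cover (λ v → K * u * ∑ cover (λ w → ⟦ bigPair C K v w ⟧) + 4 * m * n) ≡⟨ ∑-+ cover (λ v → K * u * ∑ cover (λ w → ⟦ bigPair C K v w ⟧)) (λ _ → 4 * m * n) ⟩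
        ∑ cover (λ v → K * u * ∑ cover (λ w → ⟦ bigPair C K v w ⟧)) + ∑ cover (λ _ → 4 * m * n)
          ≡⟨ cong₂ _+_ (∑-* (K * u) cover (λ v → ∑ cover (λ w → ⟦ bigPair C K v w ⟧))) (trans (∑-const (4 * m * n) cover) (cong (_* (4 * m * n)) length-cover)) ⟩
        K * u * A₂ + 4 * m * (4 * m * n)                                    ≡⟨ cong (_+ 4 * m * (4 * m * n)) (trans (*-assoc K u A₂) (cong (K *_) (*-comm u A₂))) ⟩
        K * (A₂ * u) + 4 * m * (4 * m * n)                                  ∎
        where
        open ≤-Reasoning
        inner : ∀ v → K * ∑ cover (codegree H U v) ≤ K * u * ∑ cover (λ w → ⟦ bigPair C K v w ⟧) + 4 * m * n
        inner v = begin
          K * ∑ cover (codegree H U v)                                      ≡⟨ ∑-* K cover (codegree H U v) ⟨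
          ∑ cover (λ w → K * codegree H U v w)                              ≤⟨ ∑-mono cover (λ w → notBig n (codegree≤ v w)) ⟩
          ∑ cover (λ w → K * u * ⟦ bigPair C K v w ⟧ + n)                   ≡⟨ ∑-+ cover (λ w → K * u * ⟦ bigPair C K v w ⟧) (λ _ → n) ⟩
          ∑ cover (λ w → K * u * ⟦ bigPair C K v w ⟧) + ∑ cover (λ _ → n)
            ≡⟨ cong₂ _+_ (∑-* (K * u) cover (λ w → ⟦ bigPair C K v w ⟧)) (trans (∑-const n cover) (cong (_* n) length-cover)) ⟩
          K * u * ∑ cover (λ w → ⟦ bigPair C K v w ⟧) + 4 * m * n           ∎

      -- After multiplication by `K`, small links cost at most `3 * (4 * m) * n²` and small
      -- codegrees `3 * (4 * m)² * n`; as `4 * m ≤ n`, together at most `6 * n³`. The last term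
      -- stands for the edges inside the uncovered set.
      edges≤main : (∀ x y → x ∈ U → y ∈ U → codegree H U x y ≤ 1) →
                   6 * e H * K ≤ K * mainTerm + (6 * (n * (n * n)) + K * (n * n))
      edges≤main sparse = begin
        6 * e H * K
          ≤⟨ *-monoˡ-≤ K (≤-trans (6e≤∑ H) (∑³-⊆ E everywhere)) ⟩
        ∑³ (cover ++ U) (cover ++ U) (cover ++ U) E * K
          ≡⟨ cong (_* K) (∑³-cube E (λ x y z → cong ⟦_⟧ (sym₁₂ H x y z)) (λ x y z → cong ⟦_⟧ (sym₂₃ H x y z)) cover U) ⟩
        (A₃ + (3 * B + (3 * D + F))) * K
          ≡⟨ distribute A₃ B D F K ⟩
        K * A₃ + (3 * (K * B) + (3 * (K * D) + K * F))
          ≤⟨ +-monoʳ-≤ (K * A₃) (+-mono-≤ (*-monoʳ-≤ 3 two-covered) (+-mono-≤ (*-monoʳ-≤ 3 one-covered) (*-monoʳ-≤ K uncoveredEdges))) ⟩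
        K * A₃ + (3 * (K * (A₂ * u) + 4 * m * (4 * m * n)) + (3 * (K * (A₁ * (u * u)) + 4 * m * (n * n)) + K * (n * n)))
          ≤⟨ +-monoʳ-≤ (K * A₃) (+-mono-≤ (*-monoʳ-≤ 3 (+-monoʳ-≤ (K * (A₂ * u)) (*-mono-≤ 4m≤n (*-monoˡ-≤ n 4m≤n))))
               (+-monoˡ-≤ (K * (n * n)) (*-monoʳ-≤ 3 (+-monoʳ-≤ (K * (A₁ * (u * u))) (*-monoˡ-≤ (n * n) 4m≤n))))) ⟩
        K * A₃ + (3 * (K * (A₂ * u) + n * (n * n)) + (3 * (K * (A₁ * (u * u)) + n * (n * n)) + K * (n * n)))
          ≡⟨ collect K A₃ (A₂ * u) (A₁ * (u * u)) (n * (n * n)) (n * n) ⟩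
        K * mainTerm + (6 * (n * (n * n)) + K * (n * n)) ∎
        where
        open ≤-Reasoning
        B D F : ℕ
        B = ∑³ cover cover U E
        D = ∑³ cover U U E
        F = ∑³ U U U E
        4m≤n : 4 * m ≤ n
        4m≤n = ≤-trans (m≤m+n (4 * m) u) 4m+u≤n
        uncoveredEdges : F ≤ n * n
        uncoveredEdges = ≤-trans (∑-mono∈ U λ x x∈ → ≤-trans (∑-mono∈ U λ y y∈ → sparse x y x∈ y∈)
            (≤-trans (≤-reflexive (sym (length≡∑ U))) (Unique⇒length≤ uncovered-unique)))
          (≤-trans (≤-reflexive (∑-const n U)) (*-monoˡ-≤ n (Unique⇒length≤ uncovered-unique)))
        distribute : ∀ a b d f k → (a + (3 * b + (3 * d + f))) * k ≡ k * a + (3 * (k * b) + (3 * (k * d) + k * f))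
        distribute = solve-∀
        collect : ∀ k a b d c s → k * a + (3 * (k * b + c) + (3 * (k * d + c) + k * s)) ≡ k * (3 * d + (3 * b + a)) + (6 * c + k * s)
        collect = solve-∀

-- Averaging over triples of copies

module ShareCount where
  open Sums
  open DenseTripartite
  open LocalWeights using (∑₄; ∑∑; ∑∑∑; ⟦⟧≤; ∑∑≤16; ∑∑∑≤64; ∑⟦⟧≤4)
  open Patterns
  open Shares
  open Realisation
  open BlowUp
  open EdgeCount
  open CoverCount

  open import Data.Nat using (ℕ; suc; _+_; _*_; _^_; _≤_; _<_; z≤n; s≤s; _≤ᵇ_; NonZero; >-nonZero)
  open import Data.Nat.Properties
  open import Data.Nat.Tactic.RingSolver using (solve-∀)

  -- A frequent colour is fixed by `pigeonhole` before the tripartite family is sought, at the cost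
  -- of a factor `2 ^ N` in density, so that the family is monochromatic from the outset.
  homogeneous-tripartite : ∀ {A : Set} (xs : List A) (R : A → A → A → Bool) {N} (f : A → A → A → Vec Bool N) k s .{{_ : NonZero k}} →
    0 < s → Unique xs → tripartiteBound (k * 2 ^ N) s ≤ length xs →
    length xs * (length xs * length xs) ≤ k * ∑³ xs xs xs (λ x y z → ⟦ R x y z ⟧) →
    Σ (Vec Bool N) λ v → ∃[ as ] ∃[ bs ] Σ (List A) λ cs →
      (Unique as × s ≤ length as) × (Unique bs × s ≤ length bs) × (Unique cs × s ≤ length cs) ×
      (∀ x y z → x ∈ as → y ∈ bs → z ∈ cs → T (R x y z) × f x y z ≡ v)
  homogeneous-tripartite {A} xs R {N} f k s s>0 uxs large dense =
    let v , q , q⇒ , bound = pigeonhole N (λ t → f (proj₁ t) (proj₁ (proj₂ t)) (proj₂ (proj₂ t))) ts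
                               (λ t → R (proj₁ t) (proj₁ (proj₂ t)) (proj₂ (proj₂ t)))
        as , bs , cs , ua , ub , uc , complete =
          dense⇒complete-tripartite xs (λ x y z → q (x , y , z)) (k * 2 ^ N) s {{m*n≢0 k (2 ^ N)}} s>0 uxs large (begin
            length xs * (length xs * length xs)                    ≤⟨ dense ⟩
            k * ∑³ xs xs xs (λ x y z → ⟦ R x y z ⟧)                ≡⟨ cong (k *_) (∑-ts (λ t → ⟦ R (proj₁ t) (proj₁ (proj₂ t)) (proj₂ (proj₂ t)) ⟧)) ⟨
            k * ∑ ts (λ t → ⟦ R (proj₁ t) (proj₁ (proj₂ t)) (proj₂ (proj₂ t)) ⟧) ≤⟨ *-monoʳ-≤ k bound ⟩
            k * (2 ^ N * ∑ ts (λ t → ⟦ q t ⟧))                     ≡⟨ *-assoc k (2 ^ N) _ ⟨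
            k * 2 ^ N * ∑ ts (λ t → ⟦ q t ⟧)                       ≡⟨ cong (k * 2 ^ N *_) (∑-ts (λ t → ⟦ q t ⟧)) ⟩
            k * 2 ^ N * ∑³ xs xs xs (λ x y z → ⟦ q (x , y , z) ⟧)  ∎)
    in v , as , bs , cs , ua , ub , uc , λ x y z x∈ y∈ z∈ → q⇒ (x , y , z) (complete x y z x∈ y∈ z∈)
    where
    open ≤-Reasoning
    instance
      2^N≢0 : NonZero (2 ^ N)
      2^N≢0 = m^n≢0 2 N
    ts : List (A × A × A)
    ts = cartesianProduct xs (cartesianProduct xs xs)
    ∑-ts : ∀ (g : A × A × A → ℕ) → ∑ ts g ≡ ∑³ xs xs xs (λ x y z → g (x , y , z))
    ∑-ts g = trans (∑-cartesianProduct xs (cartesianProduct xs xs) g)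
                   (∑-cong xs λ x → ∑-cartesianProduct xs xs (λ yz → g (x , yz)))

  true⇒ : ∀ {P : Set} (P? : Dec P) → T (does P?) → P
  true⇒ (yes p) _ = p

  ∑-diagonal : ∀ {m} (i : Fin m) → ∑ (allFin m) (λ j → ⟦ does (i ≟F j) ⟧) ≤ 1
  ∑-diagonal {m} i = begin
    ∑ (allFin m) (λ j → ⟦ does (i ≟F j) ⟧)        ≡⟨ length-filterT (λ j → does (i ≟F j)) (allFin m) ⟨
    length equal                                  ≡⟨ length≡∑ equal ⟩
    ∑ equal (λ _ → 1)                             ≤⟨ ∑-⊆ {ys = i ∷ []} (λ _ → 1) (Unique.filter⁺ _ (Unique.allFin⁺ m)) (λ {j} → only j) ⟩
    1                                             ∎
    where
    open ≤-Reasoning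
    equal : List (Fin m)
    equal = filterT (λ j → does (i ≟F j)) (allFin m)
    only : ∀ j → j ∈ equal → j ∈ i ∷ []
    only j j∈ = here (sym (true⇒ (i ≟F j) (proj₂ (∈-filter⁻ (λ j → T? (does (i ≟F j))) {xs = allFin m} j∈))))

  share-cong : ∀ {π ρ : Pattern} → (∀ x y z → π x y z ≡ ρ x y z) → ∀ u m → share π u m ≡ share ρ u m
  share-cong {π} {ρ} eq u m = cong₂ (λ s pt → s * (u * u) + pt) singles (cong₂ (λ p t → p * (u * m) + t * (m * m)) pairs triples′)
    where
    Q : List (Fin 4)
    Q = allFin 4
    singles : singleCount π ≡ singleCount ρ
    singles = cong₂ _+_ (∑-cong Q λ a → cong ⟦_⟧ (eq (suc a) ∗ ∗))
      (cong₂ _+_ (∑-cong Q λ b → cong ⟦_⟧ (eq ∗ (suc b) ∗)) (∑-cong Q λ c → cong ⟦_⟧ (eq ∗ ∗ (suc c))))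
    pairs : pairCount π ≡ pairCount ρ
    pairs = cong₂ _+_ (∑-cong Q λ a → ∑-cong Q λ b → cong ⟦_⟧ (eq (suc a) (suc b) ∗))
      (cong₂ _+_ (∑-cong Q λ a → ∑-cong Q λ c → cong ⟦_⟧ (eq (suc a) ∗ (suc c)))
                 (∑-cong Q λ b → ∑-cong Q λ c → cong ⟦_⟧ (eq ∗ (suc b) (suc c))))
    triples′ : tripleCount π ≡ tripleCount ρ
    triples′ = ∑³-cong Q Q Q λ a b c → cong ⟦_⟧ (eq (suc a) (suc b) (suc c))

  -- A crude bound for the triples that do not obey `extremal`: replacing `u` and `4 * m` by `n`
  -- gives `12 + 12 + 4`.
  share≤ : ∀ π {u m n} → 4 * m + u ≤ n → share π u m ≤ 28 * (n * n)
  share≤ π {u} {m} {n} 4m+u≤n = begin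
    share π u m                                     ≤⟨ +-mono-≤ (*-monoˡ-≤ (u * u) s≤) (+-mono-≤ (*-monoˡ-≤ (u * m) p≤) (*-monoˡ-≤ (m * m) (∑∑∑≤64 (tripleBits π)))) ⟩
    12 * (u * u) + (48 * (u * m) + 64 * (m * m))    ≡⟨ eq u m ⟩
    12 * (u * u) + (12 * (u * (4 * m)) + 4 * ((4 * m) * (4 * m)))
      ≤⟨ +-mono-≤ (*-monoʳ-≤ 12 (*-mono-≤ u≤n u≤n)) (+-mono-≤ (*-monoʳ-≤ 12 (*-mono-≤ u≤n 4m≤n)) (*-monoʳ-≤ 4 (*-mono-≤ 4m≤n 4m≤n))) ⟩
    12 * (n * n) + (12 * (n * n) + 4 * (n * n))     ≡⟨ eq′ (n * n) ⟩
    28 * (n * n)                                    ∎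
    where
    open ≤-Reasoning
    u≤n : u ≤ n
    u≤n = ≤-trans (m≤n+m u (4 * m)) 4m+u≤n
    4m≤n : 4 * m ≤ n
    4m≤n = ≤-trans (m≤m+n (4 * m) u) 4m+u≤n
    s≤ : singleCount π ≤ 12
    s≤ = +-mono-≤ (∑⟦⟧≤4 (singleBits π 0F)) (+-mono-≤ (∑⟦⟧≤4 (singleBits π 1F)) (∑⟦⟧≤4 (singleBits π 2F)))
    p≤ : pairCount π ≤ 48
    p≤ = +-mono-≤ (∑∑≤16 (pairBits π 2F)) (+-mono-≤ (∑∑≤16 (pairBits π 1F)) (∑∑≤16 (pairBits π 0F)))
    eq : ∀ u m → 12 * (u * u) + (48 * (u * m) + 64 * (m * m)) ≡ 12 * (u * u) + (12 * (u * (4 * m)) + 4 * ((4 * m) * (4 * m)))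
    eq = solve-∀
    eq′ : ∀ s → 12 * s + (12 * s + 4 * s) ≡ 28 * s
    eq′ = solve-∀

  module _ {n m : ℕ} {H : ThreeGraph n} (C : Copies H m) (K : ℕ) where
    open Copies C

    private
      I : List (Fin m)
      I = allFin m

      u : ℕ
      u = length uncovered

      d₁ : Fin m → ℕ
      d₁ i = ∑₄ (λ a → ⟦ bigVertex C K (at i a) ⟧)

      d₂ : Fin m → Fin m → ℕ
      d₂ i j = ∑∑ (λ a b → bigPair C K (at i a) (at j b))

      d₃ : Fin m → Fin m → Fin m → ℕ
      d₃ i j k = ∑∑∑ (λ a b c → edge H (at i a) (at j b) (at k c))

      ∑I : ∀ c → ∑ I (λ _ → c) ≡ m * c
      ∑I c = trans (∑-const c I) (cong (_* c) (length-allFin m))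

      ∑d₁ : ∑ I d₁ ≡ A₁ C K
      ∑d₁ = sym (∑-cover C (λ v → ⟦ bigVertex C K v ⟧))

      ∑d₂ : ∑ I (λ i → ∑ I (d₂ i)) ≡ A₂ C K
      ∑d₂ = sym (begin
        ∑ cover (λ v → ∑ cover (λ w → ⟦ bigPair C K v w ⟧))
          ≡⟨ ∑-cover C _ ⟩
        ∑ I (λ i → ∑₄ (λ a → ∑ cover (λ w → ⟦ bigPair C K (at i a) w ⟧)))
          ≡⟨ ∑-cong I (λ i → ∑-cong (allFin 4) λ a → ∑-cover C (λ w → ⟦ bigPair C K (at i a) w ⟧)) ⟩
        ∑ I (λ i → ∑₄ (λ a → ∑ I (λ j → ∑₄ (λ b → ⟦ bigPair C K (at i a) (at j b) ⟧))))
          ≡⟨ ∑-cong I (λ i → ∑-swap (allFin 4) I (λ a j → ∑₄ (λ b → ⟦ bigPair C K (at i a) (at j b) ⟧))) ⟩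
        ∑ I (λ i → ∑ I (d₂ i)) ∎)
        where open ≡-Reasoning

      ∑d₃ : ∑³ I I I d₃ ≡ A₃ C K
      ∑d₃ = sym (begin
        ∑³ cover cover cover E
          ≡⟨ ∑-cover C _ ⟩
        ∑ I (λ i → ∑₄ (λ a → ∑ cover (λ w → ∑ cover (E (at i a) w))))
          ≡⟨ ∑-cong I (λ i → ∑-cong (allFin 4) λ a → ∑-cover C (λ w → ∑ cover (E (at i a) w))) ⟩
        ∑ I (λ i → ∑₄ (λ a → ∑ I (λ j → ∑₄ (λ b → ∑ cover (E (at i a) (at j b))))))
          ≡⟨ ∑-cong I (λ i → ∑-swap (allFin 4) I (λ a j → ∑₄ (λ b → ∑ cover (E (at i a) (at j b))))) ⟩
        ∑ I (λ i → ∑ I (λ j → ∑₄ (λ a → ∑₄ (λ b → ∑ cover (E (at i a) (at j b))))))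
          ≡⟨ ∑-cong I (λ i → ∑-cong I λ j → inner i j) ⟩
        ∑³ I I I d₃ ∎)
        where
        open ≡-Reasoning
        E : Fin n → Fin n → Fin n → ℕ
        E x y z = ⟦ edge H x y z ⟧
        inner : ∀ i j → ∑₄ (λ a → ∑₄ (λ b → ∑ cover (E (at i a) (at j b)))) ≡ ∑ I (d₃ i j)
        inner i j = begin
          ∑₄ (λ a → ∑₄ (λ b → ∑ cover (E (at i a) (at j b))))
            ≡⟨ ∑-cong (allFin 4) (λ a → ∑-cong (allFin 4) λ b → ∑-cover C (E (at i a) (at j b))) ⟩
          ∑₄ (λ a → ∑₄ (λ b → ∑ I (λ k → ∑₄ (λ c → E (at i a) (at j b) (at k c)))))
            ≡⟨ ∑-cong (allFin 4) (λ a → ∑-swap (allFin 4) I (λ b k → ∑₄ (λ c → E (at i a) (at j b) (at k c)))) ⟩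
          ∑₄ (λ a → ∑ I (λ k → ∑₄ (λ b → ∑₄ (λ c → E (at i a) (at j b) (at k c)))))
            ≡⟨ ∑-swap (allFin 4) I (λ a k → ∑₄ (λ b → ∑₄ (λ c → E (at i a) (at j b) (at k c)))) ⟩
          ∑ I (d₃ i j) ∎

      shareOf : Fin m → Fin m → Fin m → ℕ
      shareOf i j k = share (patternOf C K i j k) u m

      ∑-singles : ∑³ I I I (λ i j k → d₁ i + (d₁ j + d₁ k)) ≡ 3 * (m * m * A₁ C K)
      ∑-singles = begin
        ∑³ I I I (λ i j k → d₁ i + (d₁ j + d₁ k))
          ≡⟨ trans (∑³-+ I I I (λ i _ _ → d₁ i) _) (cong (∑³ I I I (λ i _ _ → d₁ i) +_) (∑³-+ I I I (λ _ j _ → d₁ j) (λ _ _ k → d₁ k))) ⟩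
        ∑³ I I I (λ i _ _ → d₁ i) + (∑³ I I I (λ _ j _ → d₁ j) + ∑³ I I I (λ _ _ k → d₁ k))
          ≡⟨ cong₂ (λ x y → x + (y + ∑³ I I I (λ _ _ k → d₁ k)))
               (trans (∑³-swap₁₂ I I I (λ i _ _ → d₁ i)) (∑³-swap₂₃ I I I (λ _ i _ → d₁ i))) (∑³-swap₂₃ I I I (λ _ j _ → d₁ j)) ⟩
        D + (D + D)
          ≡⟨ cong (λ d → d + (d + d)) (trans (∑I (∑ I (λ _ → ∑ I d₁))) (cong (m *_) (trans (∑I (∑ I d₁)) (cong (m *_) ∑d₁)))) ⟩
        m * (m * A₁ C K) + (m * (m * A₁ C K) + m * (m * A₁ C K))
          ≡⟨ eq m (A₁ C K) ⟩
        3 * (m * m * A₁ C K) ∎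
        where
        open ≡-Reasoning
        D : ℕ
        D = ∑³ I I I (λ _ _ k → d₁ k)
        eq : ∀ m a → m * (m * a) + (m * (m * a) + m * (m * a)) ≡ 3 * (m * m * a)
        eq = solve-∀

      ∑-pairs : ∑³ I I I (λ i j k → d₂ i j + (d₂ i k + d₂ j k)) ≡ 3 * (m * A₂ C K)
      ∑-pairs = begin
        ∑³ I I I (λ i j k → d₂ i j + (d₂ i k + d₂ j k))
          ≡⟨ trans (∑³-+ I I I (λ i j _ → d₂ i j) _) (cong (∑³ I I I (λ i j _ → d₂ i j) +_) (∑³-+ I I I (λ i _ k → d₂ i k) (λ _ j k → d₂ j k))) ⟩
        ∑³ I I I (λ i j _ → d₂ i j) + (∑³ I I I (λ i _ k → d₂ i k) + ∑³ I I I (λ _ j k → d₂ j k))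
          ≡⟨ cong₂ (λ x y → x + (y + ∑³ I I I (λ _ j k → d₂ j k)))
               (trans (∑³-swap₂₃ I I I (λ i j _ → d₂ i j)) (∑³-swap₁₂ I I I (λ i _ j → d₂ i j))) (∑³-swap₁₂ I I I (λ i _ k → d₂ i k)) ⟩
        D + (D + D)
          ≡⟨ cong (λ d → d + (d + d)) (trans (∑I (∑ I (λ j → ∑ I (d₂ j)))) (cong (m *_) ∑d₂)) ⟩
        m * A₂ C K + (m * A₂ C K + m * A₂ C K)
          ≡⟨ eq (m * A₂ C K) ⟩
        3 * (m * A₂ C K) ∎
        where
        open ≡-Reasoning
        D : ℕ
        D = ∑³ I I I (λ _ j k → d₂ j k)
        eq : ∀ a → a + (a + a) ≡ 3 * a
        eq = solve-∀

    -- A big vertex is seen by `3 * m²` ordered triples of copies, a big pair by `3 * m`, and an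
    -- edge on covered vertices by one. The factors `u * u`, `u * m`, `m * m` in `share` make up for
    -- these multiplicities.
    ∑-share : ∑³ I I I shareOf ≡ m * m * mainTerm C K
    ∑-share = begin
      ∑³ I I I shareOf
        ≡⟨ ∑³-cong I I I (λ i j k → cong₂ _+_ (*-comm (d₁ i + (d₁ j + d₁ k)) (u * u))
             (cong₂ _+_ (*-comm (d₂ i j + (d₂ i k + d₂ j k)) (u * m)) (*-comm (d₃ i j k) (m * m)))) ⟩
      ∑³ I I I (λ i j k → u * u * (d₁ i + (d₁ j + d₁ k)) + (u * m * (d₂ i j + (d₂ i k + d₂ j k)) + m * m * d₃ i j k))
        ≡⟨ trans (∑³-+ I I I (λ i j k → u * u * (d₁ i + (d₁ j + d₁ k))) _)
             (cong (∑³ I I I (λ i j k → u * u * (d₁ i + (d₁ j + d₁ k))) +_)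
               (∑³-+ I I I (λ i j k → u * m * (d₂ i j + (d₂ i k + d₂ j k))) (λ i j k → m * m * d₃ i j k))) ⟩
      ∑³ I I I (λ i j k → u * u * (d₁ i + (d₁ j + d₁ k))) +
        (∑³ I I I (λ i j k → u * m * (d₂ i j + (d₂ i k + d₂ j k))) + ∑³ I I I (λ i j k → m * m * d₃ i j k))
        ≡⟨ cong₂ _+_ (trans (∑³-* (u * u) I I I _) (cong (u * u *_) ∑-singles))
             (cong₂ _+_ (trans (∑³-* (u * m) I I I _) (cong (u * m *_) ∑-pairs)) (trans (∑³-* (m * m) I I I d₃) (cong (m * m *_) ∑d₃))) ⟩
      u * u * (3 * (m * m * A₁ C K)) + (u * m * (3 * (m * A₂ C K)) + m * m * A₃ C K)
        ≡⟨ eq u m (A₁ C K) (A₂ C K) (A₃ C K) ⟩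
      m * m * mainTerm C K ∎
      where
      open ≡-Reasoning
      eq : ∀ u m a b c → u * u * (3 * (m * m * a)) + (u * m * (3 * (m * b)) + m * m * c) ≡ m * m * (3 * (a * (u * u)) + (3 * (b * u) + c))
      eq = solve-∀

    bad : Fin m → Fin m → Fin m → Bool
    bad i j k = not (shareOf i j k ≤ᵇ extremal u m)

    coincide : Fin m → Fin m → Fin m → Bool
    coincide i j k = does (i ≟F j) ∨ (does (j ≟F k) ∨ does (i ≟F k))

    -- Augmentation needs three disjoint families of copies, so bad triples with a repeated copy are
    -- set aside; they number at most `3 * (m * m)` and go to the error term.
    exceptional : Fin m → Fin m → Fin m → Bool
    exceptional i j k = bad i j k ∧ not (coincide i j k)

    exceptionalCount : ℕ
    exceptionalCount = ∑³ I I I (λ i j k → ⟦ exceptional i j k ⟧)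

    badCount≤ : ∑³ I I I (λ i j k → ⟦ bad i j k ⟧) ≤ exceptionalCount + 3 * (m * m)
    badCount≤ = begin
      ∑³ I I I (λ i j k → ⟦ bad i j k ⟧)
        ≤⟨ ∑³-mono I I I (λ i j k → split (bad i j k) (does (i ≟F j)) (does (j ≟F k)) (does (i ≟F k))) ⟩
      ∑³ I I I (λ i j k → ⟦ exceptional i j k ⟧ + (⟦ does (i ≟F j) ⟧ + (⟦ does (j ≟F k) ⟧ + ⟦ does (i ≟F k) ⟧)))
        ≡⟨ trans (∑³-+ I I I (λ i j k → ⟦ exceptional i j k ⟧) _) (cong (exceptionalCount +_)
             (trans (∑³-+ I I I (λ i j _ → ⟦ does (i ≟F j) ⟧) _) (cong (∑³ I I I (λ i j _ → ⟦ does (i ≟F j) ⟧) +_)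
               (∑³-+ I I I (λ _ j k → ⟦ does (j ≟F k) ⟧) (λ i _ k → ⟦ does (i ≟F k) ⟧))))) ⟩
      exceptionalCount + (∑³ I I I (λ i j _ → ⟦ does (i ≟F j) ⟧) + (∑³ I I I (λ _ j k → ⟦ does (j ≟F k) ⟧) + ∑³ I I I (λ i _ k → ⟦ does (i ≟F k) ⟧)))
        ≤⟨ +-monoʳ-≤ exceptionalCount (+-mono-≤ ij (+-mono-≤ jk ik)) ⟩
      exceptionalCount + (m * (m * 1) + (m * (m * 1) + m * (m * 1)))
        ≡⟨ cong (exceptionalCount +_) (eq m) ⟩
      exceptionalCount + 3 * (m * m) ∎
      where
      open ≤-Reasoning
      eq : ∀ m → m * (m * 1) + (m * (m * 1) + m * (m * 1)) ≡ 3 * (m * m)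
      eq = solve-∀
      split : ∀ b x y z → ⟦ b ⟧ ≤ ⟦ b ∧ not (x ∨ (y ∨ z)) ⟧ + (⟦ x ⟧ + (⟦ y ⟧ + ⟦ z ⟧))
      split false x y z = z≤n
      split true true y z = s≤s z≤n
      split true false true z = s≤s z≤n
      split true false false true = s≤s z≤n
      split true false false false = s≤s z≤n
      bounded : ∀ {f : Fin m → ℕ} c → (∀ i → f i ≤ c) → ∑ I f ≤ m * c
      bounded c f≤ = ≤-trans (∑-≤const I c f≤) (≤-reflexive (cong (_* c) (length-allFin m)))
      jk : ∑³ I I I (λ _ j k → ⟦ does (j ≟F k) ⟧) ≤ m * (m * 1)
      jk = bounded (m * 1) λ i → bounded 1 ∑-diagonal
      ik : ∑³ I I I (λ i _ k → ⟦ does (i ≟F k) ⟧) ≤ m * (m * 1)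
      ik = bounded (m * 1) λ i → bounded 1 λ j → ∑-diagonal i
      ij : ∑³ I I I (λ i j _ → ⟦ does (i ≟F j) ⟧) ≤ m * (m * 1)
      ij = ≤-trans (≤-reflexive (∑³-swap₂₃ I I I (λ i j _ → ⟦ does (i ≟F j) ⟧))) ik

    -- Triples of copies above `extremal` cost at most `28 * (n * n)` each. There are at most
    -- `m³ / K` exceptional ones, which yields `7 * n³` through `4 * m ≤ n`, and at most `3 * m²`
    -- with a repetition, which yields `84 = 28 * 3`.
    main≤few-exceptional : 0 < m → K * exceptionalCount ≤ m * (m * m) →
      K * mainTerm C K ≤ K * (m * extremal u m) + (7 * (n * (n * n)) + 84 * (K * (n * n)))
    main≤few-exceptional m>0 few = *-cancelˡ-≤ (m * m) {{m*n≢0 m m {{>-nonZero m>0}} {{>-nonZero m>0}}}} (begin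
      m * m * (K * mainTerm C K)                    ≡⟨ swap (m * m) K (mainTerm C K) ⟩
      K * (m * m * mainTerm C K)                    ≡⟨ cong (K *_) ∑-share ⟨
      K * ∑³ I I I shareOf                          ≤⟨ *-monoʳ-≤ K (∑³-mono I I I pointwise) ⟩
      K * ∑³ I I I (λ i j k → 28 * (n * n) * ⟦ bad i j k ⟧ + extremal u m)
        ≡⟨ cong (K *_) (trans (∑³-+ I I I (λ i j k → 28 * (n * n) * ⟦ bad i j k ⟧) (λ _ _ _ → extremal u m))
             (cong₂ _+_ (∑³-* (28 * (n * n)) I I I (λ i j k → ⟦ bad i j k ⟧))
               (trans (∑I _) (cong (m *_) (trans (∑I _) (cong (m *_) (∑I (extremal u m)))))))) ⟩
      K * (28 * (n * n) * ∑³ I I I (λ i j k → ⟦ bad i j k ⟧) + m * (m * (m * extremal u m)))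
        ≤⟨ *-monoʳ-≤ K (+-monoˡ-≤ (m * (m * (m * extremal u m))) (*-monoʳ-≤ (28 * (n * n)) badCount≤)) ⟩
      K * (28 * (n * n) * (exceptionalCount + 3 * (m * m)) + m * (m * (m * extremal u m)))
        ≡⟨ expand K (n * n) exceptionalCount m (extremal u m) ⟩
      28 * (n * n) * (K * exceptionalCount) + m * m * (K * (m * extremal u m) + 84 * (K * (n * n)))
        ≤⟨ +-monoˡ-≤ (m * m * (K * (m * extremal u m) + 84 * (K * (n * n)))) (*-monoʳ-≤ (28 * (n * n)) few) ⟩
      28 * (n * n) * (m * (m * m)) + m * m * (K * (m * extremal u m) + 84 * (K * (n * n)))
        ≡⟨ regroup (n * n) m (K * (m * extremal u m)) (84 * (K * (n * n))) ⟩
      m * m * (K * (m * extremal u m) + (7 * (4 * m * (n * n)) + 84 * (K * (n * n))))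
        ≤⟨ *-monoʳ-≤ (m * m) (+-monoʳ-≤ (K * (m * extremal u m)) (+-monoˡ-≤ (84 * (K * (n * n)))
             (*-monoʳ-≤ 7 (*-monoˡ-≤ (n * n) (≤-trans (m≤m+n (4 * m) u) (4m+u≤n C)))))) ⟩
      m * m * (K * (m * extremal u m) + (7 * (n * (n * n)) + 84 * (K * (n * n)))) ∎)
      where
      open ≤-Reasoning
      swap : ∀ a b c → a * (b * c) ≡ b * (a * c)
      swap = solve-∀
      expand : ∀ K s x m e → K * (28 * s * (x + 3 * (m * m)) + m * (m * (m * e))) ≡ 28 * s * (K * x) + m * m * (K * (m * e) + 84 * (K * s))
      expand = solve-∀
      regroup : ∀ s m a b → 28 * s * (m * (m * m)) + m * m * (a + b) ≡ m * m * (a + (7 * (4 * m * s) + b))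
      regroup = solve-∀
      pointwise : ∀ i j k → shareOf i j k ≤ 28 * (n * n) * ⟦ bad i j k ⟧ + extremal u m
      pointwise i j k with shareOf i j k ≤ᵇ extremal u m in eq
      ... | true  = ≤-trans (≤ᵇ⇒≤ _ _ (subst T (sym eq) _)) (m≤n+m (extremal u m) (28 * (n * n) * 0))
      ... | false = ≤-trans (share≤ (patternOf C K i j k) {u} {m} {n} (4m+u≤n C)) (≤-trans (≤-reflexive (sym (*-identityʳ (28 * (n * n))))) (m≤m+n (28 * (n * n) * 1) (extremal u m)))

    -- The substitute for small `m`, when there are too few copies for the tripartite argument.
    main≤few-copies : mainTerm C K ≤ 28 * (m * (n * n))
    main≤few-copies = begin
      mainTerm C K
        ≤⟨ +-mono-≤ (*-monoʳ-≤ 3 (*-mono-≤ A₁≤ (*-mono-≤ u≤n u≤n))) (+-mono-≤ (*-monoʳ-≤ 3 (*-mono-≤ A₂≤ u≤n)) A₃≤) ⟩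
      3 * (4 * m * 1 * (n * n)) + (3 * (4 * m * (4 * m * 1) * n) + 4 * m * (4 * m * (4 * m * 1)))
        ≡⟨ eq m n ⟩
      12 * (m * (n * n)) + (12 * (m * ((4 * m) * n)) + 4 * (m * ((4 * m) * (4 * m))))
        ≤⟨ +-monoʳ-≤ (12 * (m * (n * n))) (+-mono-≤ (*-monoʳ-≤ 12 (*-monoʳ-≤ m (*-monoˡ-≤ n 4m≤n))) (*-monoʳ-≤ 4 (*-monoʳ-≤ m (*-mono-≤ 4m≤n 4m≤n)))) ⟩
      12 * (m * (n * n)) + (12 * (m * (n * n)) + 4 * (m * (n * n)))
        ≡⟨ eq′ (m * (n * n)) ⟩
      28 * (m * (n * n)) ∎
      where
      open ≤-Reasoning
      u≤n : u ≤ n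
      u≤n = ≤-trans (m≤n+m u (4 * m)) (4m+u≤n C)
      4m≤n : 4 * m ≤ n
      4m≤n = ≤-trans (m≤m+n (4 * m) u) (4m+u≤n C)
      bounded : ∀ {f : Fin n → ℕ} c → (∀ v → f v ≤ c) → ∑ cover f ≤ 4 * m * c
      bounded c f≤ = ≤-trans (∑-≤const cover c f≤) (≤-reflexive (cong (_* c) (length-cover C)))
      A₁≤ : A₁ C K ≤ 4 * m * 1
      A₁≤ = bounded 1 λ v → ⟦⟧≤1 (bigVertex C K v)
      A₂≤ : A₂ C K ≤ 4 * m * (4 * m * 1)
      A₂≤ = bounded (4 * m * 1) λ v → bounded 1 λ w → ⟦⟧≤1 (bigPair C K v w)
      A₃≤ : A₃ C K ≤ 4 * m * (4 * m * (4 * m * 1))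
      A₃≤ = bounded _ λ x → bounded _ λ y → bounded 1 λ z → ⟦⟧≤1 (edge H x y z)
      eq : ∀ m n → 3 * (4 * m * 1 * (n * n)) + (3 * (4 * m * (4 * m * 1) * n) + 4 * m * (4 * m * (4 * m * 1)))
         ≡ 12 * (m * (n * n)) + (12 * (m * ((4 * m) * n)) + 4 * (m * ((4 * m) * (4 * m))))
      eq = solve-∀
      eq′ : ∀ x → 12 * x + (12 * x + 4 * x) ≡ 28 * x
      eq′ = solve-∀

-- An upper bound on the edges or a larger tiling

module Augmentation where
  open Sums
  open DenseTripartite
  open Patterns
  open Shares
  open Realisation
  open BlowUp
  open EdgeCount
  open CoverCount
  open ShareCount

  open import Data.Nat using (ℕ; suc; _+_; _*_; _^_; _≤_; _<_; z≤n; s≤s; _≤ᵇ_; _<?_; _≤?_; NonZero)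
  open import Data.Nat.Properties
  open import Data.Nat.Tactic.RingSolver using (solve-∀)

  private
    size : ∀ {π} → Weighting π ⊎ Improvement π → ℕ
    size (inj₁ _) = 0
    size (inj₂ I) = length (Improvement.packed I)

    -- The size of the tripartite family has to be chosen before its pattern is known, so it is
    -- taken above the number of pieces for every pattern; bit vectors make this a finite maximum.
    -- The successor keeps it positive.
    sizeBound : ∀ N → (Vec Bool N → Pattern) → ℕ
    sizeBound N d = suc (maxVec N (λ v → size (dichotomy (d v))))

    bounded : ∀ N (d : Vec Bool N → Pattern) v (D : Weighting (d v) ⊎ Improvement (d v)) → size D < sizeBound N d →
              Weighting (d v) ⊎ (Σ (Improvement (d v)) λ I → length (Improvement.packed I) ≤ sizeBound N d)
    bounded N d v (inj₁ W) _  = inj₁ W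
    bounded N d v (inj₂ I) I< = inj₂ (I , <⇒≤ I<)

  opaque
    patternBits : ℕ
    patternBits = 5 * (5 * 5)

    encode : Pattern → Vec Bool patternBits
    encode = toVec

    decode : Vec Bool patternBits → Pattern
    decode = fromVec

    decode-encode : ∀ π x y z → decode (encode π) x y z ≡ π x y z
    decode-encode = fromVec-toVec

  opaque
    pieceBound : ℕ
    pieceBound = sizeBound patternBits decode

    pieceBound>0 : 0 < pieceBound
    pieceBound>0 = s≤s z≤n

    bounded-dichotomy : ∀ v → Weighting (decode v) ⊎ (Σ (Improvement (decode v)) λ I → length (Improvement.packed I) ≤ pieceBound)
    bounded-dichotomy v = bounded patternBits decode v (dichotomy (decode v))
      (s≤s (≤maxVec patternBits (λ v → size (dichotomy (decode v))) v))

  -- Exceptional triples of density `1 / K` leave density `1 / (K * 2 ^ patternBits)` in some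
  -- pattern class.
  copiesNeeded : ℕ → ℕ
  copiesNeeded K = tripartiteBound (K * 2 ^ patternBits) pieceBound

  module _ {n m : ℕ} {H : ThreeGraph n} (C : Copies H m) (K : ℕ) .{{_ : NonZero K}} where
    open Copies C

    More : Set
    More = ∃[ m′ ] m < m′ × Copies H m′

    private
      I : List (Fin m)
      I = allFin m

      ∧-T : ∀ {a b} → T (a ∧ b) → T a × T b
      ∧-T {a} = Equivalence.to (T-∧ {a})

      not-T : ∀ {b} → T (not b) → ¬ T b
      not-T {false} _ ()

      exceptional⇒bad : ∀ {i j k} → T (exceptional C K i j k) → ¬ share (patternOf C K i j k) (length uncovered) m ≤ extremal (length uncovered) m
      exceptional⇒bad {i} {j} {k} t le = not-T (proj₁ (∧-T {bad C K i j k} t)) (≤⇒≤ᵇ le)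

      does-refl : ∀ (i : Fin m) → does (i ≟F i) ≡ true
      does-refl i = dec-true (i ≟F i) refl

      exceptional⇒distinct : ∀ {i j k} → T (exceptional C K i j k) → i ≢ j × j ≢ k × i ≢ k
      exceptional⇒distinct {i} {j} {k} t = (λ { refl → absurd (does-refl i) }) , (λ { refl → absurd₂ (does-refl j) }) , (λ { refl → absurd₃ (does-refl i) })
        where
        ¬coincide : ¬ T (coincide C K i j k)
        ¬coincide = not-T (proj₂ (∧-T {bad C K i j k} t))
        absurd : does (i ≟F j) ≡ true → ⊥
        absurd eq = ¬coincide (subst (λ b → T (b ∨ (does (j ≟F k) ∨ does (i ≟F k)))) (sym eq) _)
        absurd₂ : does (j ≟F k) ≡ true → ⊥
        absurd₂ eq = ¬coincide (subst (λ b → T (does (i ≟F j) ∨ (b ∨ does (i ≟F k)))) (sym eq) (∨-true (does (i ≟F j))))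
          where
          ∨-true : ∀ b → T (b ∨ true)
          ∨-true true  = _
          ∨-true false = _
        absurd₃ : does (i ≟F k) ≡ true → ⊥
        absurd₃ eq = ¬coincide (subst (λ b → T (does (i ≟F j) ∨ (does (j ≟F k) ∨ b))) (sym eq) (∨-true (does (i ≟F j)) (does (j ≟F k))))
          where
          ∨-true : ∀ b c → T (b ∨ (c ∨ true))
          ∨-true true  _     = _
          ∨-true false true  = _
          ∨-true false false = _

      member : ∀ {A : Set} {xs : List A} → pieceBound ≤ length xs → ∃[ x ] x ∈ xs
      member {xs = []}     le = ⊥-elim (<⇒≱ pieceBound>0 le)
      member {xs = x ∷ xs} _  = x , here refl

    -- Many exceptional triples contain a tripartite family with one pattern. A weighting of it
    -- would bound the share by `extremal`, against the choice of bad triples, so the pattern has an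
    -- improvement and the tiling grows.
    few-or-more : copiesNeeded K ≤ m → K * (2 * (4 * pieceBound) + 2) < n →
                  K * exceptionalCount C K ≤ m * (m * m) ⊎ More
    few-or-more large n-large with K * exceptionalCount C K ≤? m * (m * m)
    ... | yes few = inj₁ few
    ... | no many = inj₂ (fromBlowup (homogeneous-tripartite I (exceptional C K) (λ i j k → encode (patternOf C K i j k)) K pieceBound
        pieceBound>0 (Unique.allFin⁺ m) (subst (copiesNeeded K ≤_) (sym (length-allFin m)) large)
        (subst (λ l → l * (l * l) ≤ K * exceptionalCount C K) (sym (length-allFin m)) (≰⇒≥ many))))
      where
      fromBlowup : (Σ (Vec Bool patternBits) λ v → ∃[ as ] ∃[ bs ] Σ (List (Fin m)) λ cs →
        (Unique as × pieceBound ≤ length as) × (Unique bs × pieceBound ≤ length bs) × (Unique cs × pieceBound ≤ length cs) ×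
        (∀ i j k → i ∈ as → j ∈ bs → k ∈ cs → T (exceptional C K i j k) × encode (patternOf C K i j k) ≡ v)) → More
      fromBlowup (v , as , bs , cs , (ua , la) , (ub , lb) , (uc , lc) , complete) = byDichotomy (bounded-dichotomy v)
        where
        i₀ : ∃[ i ] i ∈ as
        i₀ = member la
        j₀ : ∃[ j ] j ∈ bs
        j₀ = member lb
        k₀ : ∃[ k ] k ∈ cs
        k₀ = member lc

        same : ∀ {i j k} → i ∈ as → j ∈ bs → k ∈ cs → ∀ x y z → patternOf C K i j k x y z ≡ decode v x y z
        same {i} {j} {k} i∈ j∈ k∈ x y z = trans (sym (decode-encode (patternOf C K i j k) x y z))
          (cong (λ w → decode w x y z) (proj₂ (complete i j k i∈ j∈ k∈)))

        rows : Fin 3 → List (Fin m)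
        rows 0F = as
        rows 1F = bs
        rows 2F = cs

        rows-unique : ∀ g → Unique (rows g)
        rows-unique 0F = ua
        rows-unique 1F = ub
        rows-unique 2F = uc

        rows-long : ∀ g → pieceBound ≤ length (rows g)
        rows-long 0F = la
        rows-long 1F = lb
        rows-long 2F = lc

        ab : Disjoint as bs
        ab (i∈ , j∈) = proj₁ (exceptional⇒distinct (proj₁ (complete _ _ _ i∈ j∈ (proj₂ k₀)))) refl
        bc : Disjoint bs cs
        bc (j∈ , k∈) = proj₁ (proj₂ (exceptional⇒distinct (proj₁ (complete _ _ _ (proj₂ i₀) j∈ k∈)))) refl
        ac : Disjoint as cs
        ac (i∈ , k∈) = proj₂ (proj₂ (exceptional⇒distinct (proj₁ (complete _ _ _ i∈ (proj₂ j₀) k∈)))) refl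

        rows-apart : ∀ {g h} → g ≢ h → Disjoint (rows g) (rows h)
        rows-apart {0F} {0F} g≢h = ⊥-elim (g≢h refl)
        rows-apart {0F} {1F} _   = ab
        rows-apart {0F} {2F} _   = ac
        rows-apart {1F} {0F} _ (x∈ , y∈) = ab (y∈ , x∈)
        rows-apart {1F} {1F} g≢h = ⊥-elim (g≢h refl)
        rows-apart {1F} {2F} _   = bc
        rows-apart {2F} {0F} _ (x∈ , y∈) = ac (y∈ , x∈)
        rows-apart {2F} {1F} _ (x∈ , y∈) = bc (y∈ , x∈)
        rows-apart {2F} {2F} g≢h = ⊥-elim (g≢h refl)

        byDichotomy : Weighting (decode v) ⊎ (Σ (Improvement (decode v)) λ I → length (Improvement.packed I) ≤ pieceBound) → More
        byDichotomy (inj₁ W) = ⊥-elim (exceptional⇒bad (proj₁ (complete _ _ _ (proj₂ i₀) (proj₂ j₀) (proj₂ k₀)))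
          (≤-trans (≤-reflexive (share-cong (same (proj₂ i₀) (proj₂ j₀) (proj₂ k₀)) (length uncovered) m)) (share≤extremal W (length uncovered) m)))
        byDichotomy (inj₂ (I , I≤)) = Augment.augmented C K (decode v) I rows rows-unique rows-apart
          (λ g → ≤-trans I≤ (rows-long g)) same
          (≤-trans (s≤s (*-monoʳ-≤ K (+-monoˡ-≤ 2 (*-monoʳ-≤ 2 (*-monoʳ-≤ 4 I≤))))) n-large)

    -- `13 = 6 + 7` and `85 = 1 + 84` add the errors of `edges≤main` and `main≤few-exceptional`.
    EdgeBound : Set
    EdgeBound = 6 * e H * K ≤ K * (m * extremal (length uncovered) m) + (13 * (n * (n * n)) + 85 * (K * (n * n)))

    bound-or-more : K * (2 * (4 * pieceBound) + 2) < n → 4 * (K * copiesNeeded K) ≤ n → EdgeBound ⊎ More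
    bound-or-more n-large n-large′ with sparse-or-more C
    ... | inj₂ more = inj₂ more
    ... | inj₁ sparse = byCopies (copiesNeeded K <? m)
      where
      open ≤-Reasoning
      N³ N² X : ℕ
      N³ = n * (n * n)
      N² = n * n
      X = K * (m * extremal (length uncovered) m)

      finish : K * mainTerm C K ≤ X + (7 * N³ + 84 * (K * N²)) → EdgeBound
      finish main≤ = ≤-trans (edges≤main C K sparse) (≤-trans (+-monoˡ-≤ (6 * N³ + K * N²) main≤) (≤-reflexive (eq X N³ (K * N²))))
        where
        eq : ∀ x a b → x + (7 * a + 84 * b) + (6 * a + b) ≡ x + (13 * a + 85 * b)
        eq = solve-∀

      byCopies : Dec (copiesNeeded K < m) → EdgeBound ⊎ More
      byCopies (yes many) with few-or-more (<⇒≤ many) n-large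
      ... | inj₂ more = inj₂ more
      ... | inj₁ few  = inj₁ (finish (main≤few-exceptional C K (≤-trans (s≤s z≤n) many) few))
      -- With few copies the whole main term is at most `7 * n³ / K` and fits into the same error.
      byCopies (no few) = inj₁ (finish (begin
        K * mainTerm C K                           ≤⟨ *-monoʳ-≤ K (main≤few-copies C K) ⟩
        K * (28 * (m * N²))                        ≡⟨ eq K m N² ⟩
        7 * (4 * (K * m) * N²)                     ≤⟨ *-monoʳ-≤ 7 (*-monoˡ-≤ N² (≤-trans (*-monoʳ-≤ 4 (*-monoʳ-≤ K (≮⇒≥ few))) n-large′)) ⟩
        7 * N³                                     ≤⟨ ≤-trans (m≤m+n (7 * N³) (84 * (K * N²))) (m≤n+m _ X) ⟩
        X + (7 * N³ + 84 * (K * N²))               ∎))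
        where
        eq : ∀ K m s → K * (28 * (m * s)) ≡ 7 * (4 * (K * m) * s)
        eq = solve-∀

-- Estimates over the rationals

module RationalEstimates where
  open Shares using (extremal)

  open import Data.Integer as ℤ using (+_; -[1+_])
  import Data.Integer.Properties as ℤ
  open import Data.Nat as ℕ using (ℕ; zero; suc)
  import Data.Nat.Properties as ℕ
  open import Data.Rational using (ℚ; mkℚ; _<_; _≤_; _*_; _-_; _+_; -_; _/_; 0ℚ; 1ℚ; toℚᵘ; ↧ₙ_; nonNegative; Positive; positive; *<*)
  open import Data.Rational.Properties
  import Data.Rational.Unnormalised as ℚᵘ
  import Data.Rational.Unnormalised.Properties as ℚᵘ
  open import Level using (0ℓ)
  open import Tactic.RingSolver using (solve-∀)
  open import Tactic.RingSolver.Core.AlmostCommutativeRing using (AlmostCommutativeRing; fromCommutativeRing)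

  ℕ→ℚ-≃ : ∀ m → toℚᵘ (ℕ→ℚ m) ℚᵘ.≃ ℚᵘ.mkℚᵘ (+ m) 0
  ℕ→ℚ-≃ m = toℚᵘ-fromℚᵘ (ℚᵘ.mkℚᵘ (+ m) 0)

  ℕ→ℚ-+ : ∀ m n → ℕ→ℚ (m ℕ.+ n) ≡ ℕ→ℚ m + ℕ→ℚ n
  ℕ→ℚ-+ m n = toℚᵘ-injective (begin-equality
    toℚᵘ (ℕ→ℚ (m ℕ.+ n))                         ≃⟨ ℕ→ℚ-≃ (m ℕ.+ n) ⟩
    ℚᵘ.mkℚᵘ (+ (m ℕ.+ n)) 0                        ≃⟨ ℚᵘ.*≡* (cong (ℤ._* + 1) (sym (cong₂ ℤ._+_ (ℤ.*-identityʳ (+ m)) (ℤ.*-identityʳ (+ n))))) ⟩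
    ℚᵘ.mkℚᵘ (+ m) 0 ℚᵘ.+ ℚᵘ.mkℚᵘ (+ n) 0           ≃⟨ ℚᵘ.+-cong (ℕ→ℚ-≃ m) (ℕ→ℚ-≃ n) ⟨
    toℚᵘ (ℕ→ℚ m) ℚᵘ.+ toℚᵘ (ℕ→ℚ n)               ≃⟨ toℚᵘ-homo-+ (ℕ→ℚ m) (ℕ→ℚ n) ⟨
    toℚᵘ (ℕ→ℚ m + ℕ→ℚ n)                         ∎)
    where open ℚᵘ.≤-Reasoning

  ℕ→ℚ-* : ∀ m n → ℕ→ℚ (m ℕ.* n) ≡ ℕ→ℚ m * ℕ→ℚ n
  ℕ→ℚ-* m n = toℚᵘ-injective (begin-equality
    toℚᵘ (ℕ→ℚ (m ℕ.* n))                         ≃⟨ ℕ→ℚ-≃ (m ℕ.* n) ⟩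
    ℚᵘ.mkℚᵘ (+ (m ℕ.* n)) 0                        ≃⟨ ℚᵘ.*≡* (cong (ℤ._* + 1) (ℤ.pos-* m n)) ⟩
    ℚᵘ.mkℚᵘ (+ m) 0 ℚᵘ.* ℚᵘ.mkℚᵘ (+ n) 0           ≃⟨ ℚᵘ.*-cong (ℕ→ℚ-≃ m) (ℕ→ℚ-≃ n) ⟨
    toℚᵘ (ℕ→ℚ m) ℚᵘ.* toℚᵘ (ℕ→ℚ n)               ≃⟨ toℚᵘ-homo-* (ℕ→ℚ m) (ℕ→ℚ n) ⟨
    toℚᵘ (ℕ→ℚ m * ℕ→ℚ n)                         ∎)
    where open ℚᵘ.≤-Reasoning

  ℕ→ℚ-mono-≤ : ∀ {m n} → m ℕ.≤ n → ℕ→ℚ m ≤ ℕ→ℚ n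
  ℕ→ℚ-mono-≤ {m} {n} m≤n = toℚᵘ-cancel-≤ (begin
    toℚᵘ (ℕ→ℚ m)       ≃⟨ ℕ→ℚ-≃ m ⟩
    ℚᵘ.mkℚᵘ (+ m) 0    ≤⟨ ℚᵘ.*≤* (ℤ.*-monoʳ-≤-nonNeg (+ 1) (ℤ.+≤+ m≤n)) ⟩
    ℚᵘ.mkℚᵘ (+ n) 0    ≃⟨ ℕ→ℚ-≃ n ⟨
    toℚᵘ (ℕ→ℚ n)       ∎)
    where open ℚᵘ.≤-Reasoning

  0≤ℕ→ℚ : ∀ n → 0ℚ ≤ ℕ→ℚ n
  0≤ℕ→ℚ n = ℕ→ℚ-mono-≤ {0} {n} ℕ.z≤n

  -- The numerator of a positive fraction is at least 1, so its denominator is a natural number `q`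
  -- with `q * γ ≥ 1`, found without rounding.
  1≤denominator* : ∀ γ → 0ℚ < γ → 1ℚ ≤ ℕ→ℚ (↧ₙ γ) * γ
  1≤denominator* γ@(mkℚ (+ zero) d-1 _) (*<* (ℤ.+<+ ()))
  1≤denominator* γ@(mkℚ (+ suc k) d-1 _) _ = toℚᵘ-cancel-≤ (begin
    toℚᵘ 1ℚ                                          ≤⟨ ℚᵘ.*≤* (subst₂ ℤ._≤_
          (sym (trans (ℤ.*-identityˡ (+ suc (d-1 ℕ.+ 0))) (cong (λ d → + suc d) (ℕ.+-identityʳ d-1))))
          (sym (trans (ℤ.*-identityʳ (+ suc d-1 ℤ.* + suc k)) (sym (ℤ.pos-* (suc d-1) (suc k)))))
          (ℤ.+≤+ (ℕ.m≤m*n (suc d-1) (suc k)))) ⟩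
    ℚᵘ.mkℚᵘ (+ suc d-1) 0 ℚᵘ.* ℚᵘ.mkℚᵘ (+ suc k) d-1  ≃⟨ ℚᵘ.*-cong (ℕ→ℚ-≃ (suc d-1)) ℚᵘ.≃-refl ⟨
    toℚᵘ (ℕ→ℚ (suc d-1)) ℚᵘ.* toℚᵘ γ                 ≃⟨ toℚᵘ-homo-* (ℕ→ℚ (suc d-1)) γ ⟨
    toℚᵘ (ℕ→ℚ (suc d-1) * γ)                         ∎)
    where open ℚᵘ.≤-Reasoning
  1≤denominator* (mkℚ (-[1+ k ]) d-1 _) (*<* ())

  ℚ-ring : AlmostCommutativeRing 0ℓ 0ℓ
  ℚ-ring = fromCommutativeRing +-*-commutativeRing (λ x → dec⇒maybe (0ℚ ≟ x))

  infixl 6 _⊕_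
  infixl 7 _⊗_

  _⊕_ : ∀ {p q} → 0ℚ ≤ p → 0ℚ ≤ q → 0ℚ ≤ p + q
  _⊕_ = +-mono-≤

  _⊗_ : ∀ {p q} → 0ℚ ≤ p → 0ℚ ≤ q → 0ℚ ≤ p * q
  _⊗_ {p} {q} p≥0 q≥0 = nonNegative⁻¹ (p * q) {{nonNeg*nonNeg⇒nonNeg p {{nonNegative p≥0}} q {{nonNegative q≥0}}}}

  gap : ∀ {p q} → p ≤ q → 0ℚ ≤ q - p
  gap {p} {q} p≤q = subst (_≤ q - p) (+-inverseʳ p) (+-monoˡ-≤ (- p) p≤q)

  cube : ℚ → ℚ
  cube x = x * x * x

  falling : ℚ → ℚ
  falling x = x * (x - 1ℚ) * (x - (1ℚ + 1ℚ))

  six : ℚ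
  six = ℕ→ℚ 6

  six*choose3 : ∀ x → six * choose3 x ≡ falling x
  six*choose3 x = trans (*-comm six (choose3 x)) (trans (*-assoc (falling x) (+ 1 / 6) six) (*-identityʳ (falling x)))

  cube-mono : ∀ {x y} → 0ℚ ≤ x → x ≤ y → 0ℚ ≤ cube y - cube x
  cube-mono {x} {y} x≥0 x≤y = subst (0ℚ ≤_) (eq x y) (gap x≤y ⊗ (y≥0 ⊗ y≥0 ⊕ y≥0 ⊗ x≥0 ⊕ x≥0 ⊗ x≥0))
    where
    y≥0 : 0ℚ ≤ y
    y≥0 = ≤-trans x≥0 x≤y
    eq : ∀ x y → (y - x) * (y * y + y * x + x * x) ≡ y * y * y - x * x * x
    eq = solve-∀ ℚ-ring

  square-mono : ∀ {x y} → 0ℚ ≤ x → x ≤ y → 0ℚ ≤ y * y - x * x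
  square-mono {x} {y} x≥0 x≤y = subst (0ℚ ≤_) (eq x y) (gap x≤y ⊗ (≤-trans x≥0 x≤y ⊕ x≥0))
    where
    eq : ∀ x y → (y - x) * (y + x) ≡ y * y - x * x
    eq = solve-∀ ℚ-ring

  -- In both cases the slacks of the hypotheses, suitably weighted, add up to 4 N³ − 6 N³.
  module _ {N Q E g : ℚ} (N>0 : 0ℚ < N) (Q≥0 : 0ℚ ≤ Q) (Q≤N : Q ≤ N) (Qg≥1 : 1ℚ ≤ Q * g) where

    private
      N≥0 : 0ℚ ≤ N
      N≥0 = <⇒≤ N>0

      six≥0 : 0ℚ ≤ six
      six≥0 = 0≤ℕ→ℚ 6

      impossible : 0ℚ ≤ cube N + (cube N + cube N + cube N) - six * cube N → ⊥
      impossible h = <-irrefl refl (<-≤-trans (positive⁻¹ (cube N + cube N) {{pos+pos⇒pos (cube N) {{N³>0}} (cube N) {{N³>0}}}})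
        (subst₂ _≤_ (+-identityˡ (cube N + cube N)) (eq (cube N)) (+-monoˡ-≤ (cube N + cube N) h)))
        where
        instance
          N⁺ : Positive N
          N⁺ = positive N>0
        N³>0 : Positive (cube N)
        N³>0 = pos*pos⇒pos (N * N) {{pos*pos⇒pos N N}} N
        eq : ∀ c → c + (c + c + c) - (1ℚ + 1ℚ + 1ℚ + 1ℚ + 1ℚ + 1ℚ) * c + (c + c) ≡ 0ℚ
        eq = solve-∀ ℚ-ring

      scaled : ∀ c h → c + g * cube N ≤ E → six * c ≡ h → 0ℚ ≤ six * E - (h + six * g * cube N)
      scaled c h lower 6c≡h = subst (0ℚ ≤_) (trans (eq six E c g (cube N)) (cong (λ x → six * E - (x + six * g * cube N)) 6c≡h)) (six≥0 ⊗ gap lower)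
        where
        eq : ∀ s E c g n → s * (E - (c + g * n)) ≡ s * E - (s * c + s * g * n)
        eq = solve-∀ ℚ-ring

      scaled-g : 0ℚ ≤ Q * (six * g) - six
      scaled-g = subst (0ℚ ≤_) (eq six Q g) (six≥0 ⊗ gap Qg≥1)
        where
        eq : ∀ s Q g → s * (Q * g - 1ℚ) ≡ Q * (s * g) - s
        eq = solve-∀ ℚ-ring

      triple≥0 : ∀ {x} → 0ℚ ≤ x → 0ℚ ≤ x + x + x
      triple≥0 x≥0 = x≥0 ⊕ x≥0 ⊕ x≥0

    -- Against the gain of at least `6 * N³` from `g` stand the error `N³` and the loss in passing
    -- from `X³` to the falling factorial, at most `3 * X²` times `Q` and hence at most `3 * N³`.
    clique-contradiction : ∀ {X Y} → 0ℚ ≤ Y → Y ≤ X → X ≤ N → choose3 X + g * cube N ≤ E →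
                           six * E * Q ≤ Q * cube Y + cube N → ⊥
    clique-contradiction {X} {Y} Y≥0 Y≤X X≤N lower upper = impossible (subst (0ℚ ≤_) (eq N Q (six * E) (six * g) six X Y)
      (Q≥0 ⊗ scaled (choose3 X) (falling X) lower (six*choose3 X) ⊕ gap upper ⊕ Q≥0 ⊗ cube-mono Y≥0 Y≤X
        ⊕ scaled-g ⊗ (N≥0 ⊗ N≥0 ⊗ N≥0) ⊕ Q≥0 ⊗ triple≥0 (square-mono X≥0 X≤N)
        ⊕ triple≥0 (gap Q≤N ⊗ (N≥0 ⊗ N≥0)) ⊕ Q≥0 ⊗ (X≥0 ⊕ X≥0)))
      where
      X≥0 : 0ℚ ≤ X
      X≥0 = ≤-trans Y≥0 Y≤X
      eq : ∀ N Q E g s X Y →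
        Q * (E - (X * (X - 1ℚ) * (X - (1ℚ + 1ℚ)) + g * (N * N * N))) + (Q * (Y * Y * Y) + N * N * N - E * Q) + Q * (X * X * X - Y * Y * Y)
          + (Q * g - s) * (N * N * N) + Q * ((N * N - X * X) + (N * N - X * X) + (N * N - X * X))
          + ((N - Q) * (N * N) + (N - Q) * (N * N) + (N - Q) * (N * N)) + Q * (X + X)
        ≡ N * N * N + (N * N * N + N * N * N + N * N * N) - s * (N * N * N)
      eq = solve-∀ ℚ-ring

    -- The same balance for the cover bound, with `y` to become `n - α * n` and `Z` to become
    -- `n - m`. Passing from the difference of cubes to that of falling factorials again loses at
    -- most `3 * N²`.
    star-contradiction : ∀ {y Z} → 0ℚ ≤ y → y ≤ Z → y ≤ N → (choose3 N - choose3 y) + g * cube N ≤ E →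
                         six * E * Q + Q * cube Z ≤ Q * cube N + cube N → ⊥
    star-contradiction {y} {Z} y≥0 y≤Z y≤N lower upper = impossible (subst (0ℚ ≤_) (eq N Q (six * E) (six * g) six y Z)
      (Q≥0 ⊗ scaled (choose3 N - choose3 y) (falling N - falling y) lower falling≡ ⊕ gap upper ⊕ Q≥0 ⊗ cube-mono y≥0 y≤Z
        ⊕ scaled-g ⊗ (N≥0 ⊗ N≥0 ⊗ N≥0) ⊕ Q≥0 ⊗ triple≥0 (y≥0 ⊗ y≥0)
        ⊕ triple≥0 (gap Q≤N ⊗ (N≥0 ⊗ N≥0)) ⊕ Q≥0 ⊗ (gap y≤N ⊕ gap y≤N)))
      where
      distrib : ∀ s a b → s * (a - b) ≡ s * a - s * b
      distrib = solve-∀ ℚ-ring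
      falling≡ : six * (choose3 N - choose3 y) ≡ falling N - falling y
      falling≡ = trans (distrib six (choose3 N) (choose3 y)) (cong₂ _-_ (six*choose3 N) (six*choose3 y))
      eq : ∀ N Q E g s y Z →
        Q * (E - (N * (N - 1ℚ) * (N - (1ℚ + 1ℚ)) - y * (y - 1ℚ) * (y - (1ℚ + 1ℚ)) + g * (N * N * N)))
          + (Q * (N * N * N) + N * N * N - (E * Q + Q * (Z * Z * Z))) + Q * (Z * Z * Z - y * y * y)
          + (Q * g - s) * (N * N * N) + Q * (y * y + y * y + y * y)
          + ((N - Q) * (N * N) + (N - Q) * (N * N) + (N - Q) * (N * N)) + Q * ((N - y) + (N - y))
        ≡ N * N * N + (N * N * N + N * N * N + N * N * N) - s * (N * N * N)
      eq = solve-∀ ℚ-ring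

-- Comparison with the density hypothesis

module Comparison where
  open Sums
  open Patterns
  open Shares
  open BlowUp
  open CoverCount
  open Augmentation
  open RationalEstimates

  open import Data.Integer using (+_)
  open import Data.Nat as ℕ using (ℕ; _≥_)
  import Data.Nat.Properties as ℕ
  import Data.Nat.Tactic.RingSolver as ℕ-Solver
  open import Data.Rational using (ℚ; _<_; _≤_; _*_; _-_; _+_; -_; _⊔_; _/_; 0ℚ; 1ℚ; NonNegative; nonNegative)
  open import Data.Rational.Properties
  open import Tactic.RingSolver using (solve-∀)

  -- For `n = 4 * m + u` both sides agree: the cover term times `m` is
  -- `(4 * m + u)³ - (3 * m + u)³`. Further vertices only add slack.
  star-bound : ∀ {m u n z} → 4 ℕ.* m ℕ.+ u ℕ.≤ n → m ℕ.+ z ≡ n →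
    m ℕ.* (3 ℕ.* (u ℕ.* u) ℕ.+ (21 ℕ.* (u ℕ.* m) ℕ.+ 37 ℕ.* (m ℕ.* m))) ℕ.+ z ℕ.* z ℕ.* z ℕ.≤ n ℕ.* n ℕ.* n
  star-bound {m} {u} {n} {z} 4m+u≤n m+z≡n with ℕ.m≤n⇒∃[o]m+o≡n 4m+u≤n
  ... | v , refl with ℕ.+-cancelˡ-≡ m z (3 ℕ.* m ℕ.+ u ℕ.+ v) (trans m+z≡n (eq₀ m u v))
    where
    eq₀ : ∀ m u v → 4 ℕ.* m ℕ.+ u ℕ.+ v ≡ m ℕ.+ (3 ℕ.* m ℕ.+ u ℕ.+ v)
    eq₀ = ℕ-Solver.solve-∀
  ... | refl = lin (3 ℕ.* m ℕ.* v ℕ.* (6 ℕ.* m ℕ.+ 2 ℕ.* u ℕ.+ v) ℕ.+ 3 ℕ.* m ℕ.* m ℕ.* v) ℕ.z≤n (eq m u v)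
    where
    eq : ∀ m u v → m ℕ.* (3 ℕ.* (u ℕ.* u) ℕ.+ (21 ℕ.* (u ℕ.* m) ℕ.+ 37 ℕ.* (m ℕ.* m)))
        ℕ.+ (3 ℕ.* m ℕ.+ u ℕ.+ v) ℕ.* (3 ℕ.* m ℕ.+ u ℕ.+ v) ℕ.* (3 ℕ.* m ℕ.+ u ℕ.+ v) ℕ.+ 0
        ℕ.+ (3 ℕ.* m ℕ.* v ℕ.* (6 ℕ.* m ℕ.+ 2 ℕ.* u ℕ.+ v) ℕ.+ 3 ℕ.* m ℕ.* m ℕ.* v)
      ≡ (4 ℕ.* m ℕ.+ u ℕ.+ v) ℕ.* (4 ℕ.* m ℕ.+ u ℕ.+ v) ℕ.* (4 ℕ.* m ℕ.+ u ℕ.+ v) ℕ.+ 0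
    eq = ℕ-Solver.solve-∀

  ℕ→ℚ-cube : ∀ n → ℕ→ℚ (n ℕ.* n ℕ.* n) ≡ cube (ℕ→ℚ n)
  ℕ→ℚ-cube n = trans (ℕ→ℚ-* (n ℕ.* n) n) (cong (_* ℕ→ℚ n) (ℕ→ℚ-* n n))

  ℕ→ℚ-affine : ∀ q x c → ℕ→ℚ (q ℕ.* x ℕ.+ c) ≡ ℕ→ℚ q * ℕ→ℚ x + ℕ→ℚ c
  ℕ→ℚ-affine q x c = trans (ℕ→ℚ-+ (q ℕ.* x) c) (cong (_+ ℕ→ℚ c) (ℕ→ℚ-* q x))

  Dense : ℚ → ℚ → ℕ → ℕ → Set
  Dense α γ n edges =
    (choose3 (ℕ→ℚ 4 * α * ℕ→ℚ n) ⊔ (choose3 (ℕ→ℚ n) - choose3 (ℕ→ℚ n - α * ℕ→ℚ n)))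
      + γ * (ℕ→ℚ n * ℕ→ℚ n * ℕ→ℚ n) ≤ ℕ→ℚ edges

  module _ {α γ : ℚ} {q K : ℕ} (α>0 : 0ℚ < α) (α<¼ : α < + 1 / 4) (γ>0 : 0ℚ < γ) (qγ≥1 : 1ℚ ≤ ℕ→ℚ q * γ) (K≡14q : K ≡ 14 ℕ.* q) where

    module _ {n edges m u : ℕ} (n>0 : 0 ℕ.< n) (q≤n : q ℕ.≤ n) (dense : Dense α γ n edges)
             (4m+u≤n : 4 ℕ.* m ℕ.+ u ℕ.≤ n) (few : ℕ→ℚ (4 ℕ.* m) ≤ ℕ→ℚ 4 * α * ℕ→ℚ n) where

      private
        N Q E X A : ℚ
        N = ℕ→ℚ n
        Q = ℕ→ℚ q
        E = ℕ→ℚ edges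
        A = α * N
        X = ℕ→ℚ 4 * α * N

        N>0 : 0ℚ < N
        N>0 = <-≤-trans (positive⁻¹ 1ℚ) (ℕ→ℚ-mono-≤ n>0)

        instance
          N⁺ : NonNegative N
          N⁺ = nonNegative (<⇒≤ N>0)

        4α≤1 : ℕ→ℚ 4 * α ≤ 1ℚ
        4α≤1 = *-monoˡ-≤-nonNeg (ℕ→ℚ 4) (<⇒≤ α<¼)

        X≤N : X ≤ N
        X≤N = ≤-trans (*-monoʳ-≤-nonNeg N 4α≤1) (≤-reflexive (*-identityˡ N))

        A≤N : A ≤ N
        A≤N = ≤-trans (*-monoʳ-≤-nonNeg N (≤-trans (<⇒≤ α<¼) (<⇒≤ ¼<1))) (≤-reflexive (*-identityˡ N))
          where
          ¼<1 : + 1 / 4 < 1ℚ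
          ¼<1 = from-yes (+ 1 / 4 <? 1ℚ)

        A≥0 : 0ℚ ≤ A
        A≥0 = <⇒≤ α>0 ⊗ <⇒≤ N>0

        M≤A : ℕ→ℚ m ≤ A
        M≤A = *-cancelˡ-≤-pos (ℕ→ℚ 4) (subst₂ _≤_ (ℕ→ℚ-* 4 m) (*-assoc (ℕ→ℚ 4) α N) few)

        6EQ : ℕ→ℚ (6 ℕ.* edges ℕ.* q) ≡ six * E * Q
        6EQ = trans (ℕ→ℚ-* (6 ℕ.* edges) q) (cong (_* Q) (ℕ→ℚ-* 6 edges))

        Q≤N : Q ≤ N
        Q≤N = ℕ→ℚ-mono-≤ q≤n

      clique-case : 6 ℕ.* edges ℕ.* q ℕ.≤ q ℕ.* (m ℕ.* (64 ℕ.* (m ℕ.* m))) ℕ.+ n ℕ.* n ℕ.* n → ⊥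
      clique-case bound = clique-contradiction {N} {Q} {E} {γ} N>0 (0≤ℕ→ℚ q) Q≤N qγ≥1 {X} {ℕ→ℚ (4 ℕ.* m)}
        (0≤ℕ→ℚ (4 ℕ.* m)) few X≤N
        (≤-trans (+-monoˡ-≤ (γ * cube N) (p≤p⊔q (choose3 X) (choose3 N - choose3 (N - A)))) dense)
        (subst₂ _≤_ 6EQ rhs (ℕ→ℚ-mono-≤ bound))
        where
        eq : ∀ m → m ℕ.* (64 ℕ.* (m ℕ.* m)) ≡ 4 ℕ.* m ℕ.* (4 ℕ.* m) ℕ.* (4 ℕ.* m)
        eq = ℕ-Solver.solve-∀
        rhs : ℕ→ℚ (q ℕ.* (m ℕ.* (64 ℕ.* (m ℕ.* m))) ℕ.+ n ℕ.* n ℕ.* n) ≡ Q * cube (ℕ→ℚ (4 ℕ.* m)) + cube N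
        rhs = trans (ℕ→ℚ-affine q (m ℕ.* (64 ℕ.* (m ℕ.* m))) (n ℕ.* n ℕ.* n))
          (cong₂ (λ x y → Q * x + y) (trans (cong ℕ→ℚ (eq m)) (ℕ→ℚ-cube (4 ℕ.* m))) (ℕ→ℚ-cube n))

      star-case : 6 ℕ.* edges ℕ.* q ℕ.≤ q ℕ.* (m ℕ.* (3 ℕ.* (u ℕ.* u) ℕ.+ (21 ℕ.* (u ℕ.* m) ℕ.+ 37 ℕ.* (m ℕ.* m)))) ℕ.+ n ℕ.* n ℕ.* n → ⊥
      star-case bound with ℕ.m≤n⇒∃[o]m+o≡n (ℕ.≤-trans (ℕ.m≤n*m m 4) (ℕ.≤-trans (ℕ.m≤m+n (4 ℕ.* m) u) 4m+u≤n))
      ... | z , m+z≡n = star-contradiction {N} {Q} {E} {γ} N>0 (0≤ℕ→ℚ q) Q≤N qγ≥1 {N - A} {ℕ→ℚ z}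
        (gap A≤N)
        (subst (N - A ≤_) (sym Z≡) (+-monoʳ-≤ N (neg-antimono-≤ M≤A)))
        (≤-trans (+-monoʳ-≤ N (neg-antimono-≤ A≥0)) (≤-reflexive (+-identityʳ N)))
        (≤-trans (+-monoˡ-≤ (γ * cube N) (p≤q⊔p (choose3 X) (choose3 N - choose3 (N - A)))) dense)
        (subst₂ _≤_ lhs rhs (ℕ→ℚ-mono-≤ bound′))
        where
        Z≡ : ℕ→ℚ z ≡ N - ℕ→ℚ m
        Z≡ = trans (eq (ℕ→ℚ m) (ℕ→ℚ z)) (cong (_- ℕ→ℚ m) (trans (sym (ℕ→ℚ-+ m z)) (cong ℕ→ℚ m+z≡n)))
          where
          eq : ∀ m z → z ≡ m + z - m
          eq = solve-∀ ℚ-ring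
        bound′ : 6 ℕ.* edges ℕ.* q ℕ.+ q ℕ.* (z ℕ.* z ℕ.* z) ℕ.≤ q ℕ.* (n ℕ.* n ℕ.* n) ℕ.+ n ℕ.* n ℕ.* n
        bound′ = begin
          6 ℕ.* edges ℕ.* q ℕ.+ q ℕ.* (z ℕ.* z ℕ.* z)          ≤⟨ ℕ.+-monoˡ-≤ (q ℕ.* (z ℕ.* z ℕ.* z)) bound ⟩
          q ℕ.* S ℕ.+ n ℕ.* n ℕ.* n ℕ.+ q ℕ.* (z ℕ.* z ℕ.* z)  ≡⟨ eq q S (n ℕ.* n ℕ.* n) (z ℕ.* z ℕ.* z) ⟩
          q ℕ.* (S ℕ.+ z ℕ.* z ℕ.* z) ℕ.+ n ℕ.* n ℕ.* n        ≤⟨ ℕ.+-monoˡ-≤ (n ℕ.* n ℕ.* n) (ℕ.*-monoʳ-≤ q (star-bound {m} {u} {n} {z} 4m+u≤n m+z≡n)) ⟩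
          q ℕ.* (n ℕ.* n ℕ.* n) ℕ.+ n ℕ.* n ℕ.* n              ∎
          where
          open ℕ.≤-Reasoning
          S : ℕ
          S = m ℕ.* (3 ℕ.* (u ℕ.* u) ℕ.+ (21 ℕ.* (u ℕ.* m) ℕ.+ 37 ℕ.* (m ℕ.* m)))
          eq : ∀ q s n z → q ℕ.* s ℕ.+ n ℕ.+ q ℕ.* z ≡ q ℕ.* (s ℕ.+ z) ℕ.+ n
          eq = ℕ-Solver.solve-∀
        lhs : ℕ→ℚ (6 ℕ.* edges ℕ.* q ℕ.+ q ℕ.* (z ℕ.* z ℕ.* z)) ≡ six * E * Q + Q * cube (ℕ→ℚ z)
        lhs = trans (ℕ→ℚ-+ (6 ℕ.* edges ℕ.* q) (q ℕ.* (z ℕ.* z ℕ.* z)))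
          (cong₂ _+_ 6EQ (trans (ℕ→ℚ-* q (z ℕ.* z ℕ.* z)) (cong (λ x → Q * x) (ℕ→ℚ-cube z))))
        rhs : ℕ→ℚ (q ℕ.* (n ℕ.* n ℕ.* n) ℕ.+ n ℕ.* n ℕ.* n) ≡ Q * cube N + cube N
        rhs = trans (ℕ→ℚ-affine q (n ℕ.* n ℕ.* n) (n ℕ.* n ℕ.* n)) (cong₂ (λ x y → Q * x + y) (ℕ→ℚ-cube n) (ℕ→ℚ-cube n))

      dense-contradiction : 85 ℕ.* K ℕ.≤ n →
        ¬ 6 ℕ.* edges ℕ.* K ℕ.≤ K ℕ.* (m ℕ.* extremal u m) ℕ.+ (13 ℕ.* (n ℕ.* (n ℕ.* n)) ℕ.+ 85 ℕ.* (K ℕ.* (n ℕ.* n)))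
      dense-contradiction n-large bound = bySide (ℕ.⊔-sel (64 ℕ.* (m ℕ.* m)) (3 ℕ.* (u ℕ.* u) ℕ.+ (21 ℕ.* (u ℕ.* m) ℕ.+ 37 ℕ.* (m ℕ.* m))))
        where
        open ℕ.≤-Reasoning
        -- The term with `85 * K` is at most `n³`, which brings the cubic error to `14 * n³`;
        -- dividing by 14 then leaves `n³`. This is the origin of `K = 14 * q`.
        reduced : 6 ℕ.* edges ℕ.* q ℕ.≤ q ℕ.* (m ℕ.* extremal u m) ℕ.+ n ℕ.* n ℕ.* n
        reduced = ℕ.*-cancelˡ-≤ 14 (begin
          14 ℕ.* (6 ℕ.* edges ℕ.* q)     ≡⟨ trans (eq₁ (6 ℕ.* edges) q) (cong (6 ℕ.* edges ℕ.*_) (sym K≡14q)) ⟩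
          6 ℕ.* edges ℕ.* K              ≤⟨ bound ⟩
          K ℕ.* (m ℕ.* extremal u m) ℕ.+ (13 ℕ.* (n ℕ.* (n ℕ.* n)) ℕ.+ 85 ℕ.* (K ℕ.* (n ℕ.* n)))
            ≡⟨ eq₂ K (m ℕ.* extremal u m) n ⟩
          K ℕ.* (m ℕ.* extremal u m) ℕ.+ 13 ℕ.* (n ℕ.* n ℕ.* n) ℕ.+ 85 ℕ.* K ℕ.* (n ℕ.* n)
            ≤⟨ ℕ.+-monoʳ-≤ (K ℕ.* (m ℕ.* extremal u m) ℕ.+ 13 ℕ.* (n ℕ.* n ℕ.* n)) (ℕ.*-monoˡ-≤ (n ℕ.* n) n-large) ⟩
          K ℕ.* (m ℕ.* extremal u m) ℕ.+ 13 ℕ.* (n ℕ.* n ℕ.* n) ℕ.+ n ℕ.* (n ℕ.* n)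
            ≡⟨ trans (cong (λ K → K ℕ.* (m ℕ.* extremal u m) ℕ.+ 13 ℕ.* (n ℕ.* n ℕ.* n) ℕ.+ n ℕ.* (n ℕ.* n)) K≡14q) (eq₃ q (m ℕ.* extremal u m) n) ⟩
          14 ℕ.* (q ℕ.* (m ℕ.* extremal u m) ℕ.+ n ℕ.* n ℕ.* n) ∎)
          where
          eq₁ : ∀ e q → 14 ℕ.* (e ℕ.* q) ≡ e ℕ.* (14 ℕ.* q)
          eq₁ = ℕ-Solver.solve-∀
          eq₂ : ∀ K x n → K ℕ.* x ℕ.+ (13 ℕ.* (n ℕ.* (n ℕ.* n)) ℕ.+ 85 ℕ.* (K ℕ.* (n ℕ.* n))) ≡ K ℕ.* x ℕ.+ 13 ℕ.* (n ℕ.* n ℕ.* n) ℕ.+ 85 ℕ.* K ℕ.* (n ℕ.* n)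
          eq₂ = ℕ-Solver.solve-∀
          eq₃ : ∀ q x n → 14 ℕ.* q ℕ.* x ℕ.+ 13 ℕ.* (n ℕ.* n ℕ.* n) ℕ.+ n ℕ.* (n ℕ.* n) ≡ 14 ℕ.* (q ℕ.* x ℕ.+ n ℕ.* n ℕ.* n)
          eq₃ = ℕ-Solver.solve-∀
        bySide : _ ⊎ _ → ⊥
        bySide (inj₁ eq) = clique-case (subst (λ x → 6 ℕ.* edges ℕ.* q ℕ.≤ q ℕ.* (m ℕ.* x) ℕ.+ n ℕ.* n ℕ.* n) eq reduced)
        bySide (inj₂ eq) = star-case (subst (λ x → 6 ℕ.* edges ℕ.* q ℕ.≤ q ℕ.* (m ℕ.* x) ℕ.+ n ℕ.* n ℕ.* n) eq reduced)

-- Growing the tiling to the required size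

open Sums
open Patterns
open Shares
open BlowUp
open CoverCount
open Augmentation
open RationalEstimates
open Comparison

open import Data.Integer using (+_)
open import Data.Nat as ℕ using (ℕ; _≥_; zero; suc)
import Data.Nat.Properties as ℕ
open import Data.Rational using (ℚ; _<_; _≤_; _*_; _-_; _+_; -_; _⊔_; _/_; 0ℚ; 1ℚ; ↧ₙ_)
open import Data.Rational.Properties

summands≤ : ∀ a b c d {n} → a ℕ.+ (b ℕ.+ (c ℕ.+ d)) ℕ.≤ n → a ℕ.≤ n × b ℕ.≤ n × c ℕ.≤ n × d ℕ.≤ n
summands≤ a b c d h =
  ℕ.m+n≤o⇒m≤o a h , ℕ.m+n≤o⇒m≤o b bcd , ℕ.m+n≤o⇒m≤o c cd , ℕ.m+n≤o⇒n≤o c cd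
  where
  bcd : b ℕ.+ (c ℕ.+ d) ℕ.≤ _
  bcd = ℕ.m+n≤o⇒n≤o a h
  cd : c ℕ.+ d ℕ.≤ _
  cd = ℕ.m+n≤o⇒n≤o b bcd

opaque
  -- The summands provide, in this order, room among the uncovered vertices, the case of few copies,
  -- control of the quadratic error, and `q ≤ n`.
  threshold : ℕ → ℕ → ℕ
  threshold q K = suc (K ℕ.* (2 ℕ.* (4 ℕ.* pieceBound) ℕ.+ 2)) ℕ.+ (4 ℕ.* (K ℕ.* copiesNeeded K) ℕ.+ (85 ℕ.* K ℕ.+ q))

  threshold≤ : ∀ q K {n} → threshold q K ℕ.≤ n →
    K ℕ.* (2 ℕ.* (4 ℕ.* pieceBound) ℕ.+ 2) ℕ.< n × 4 ℕ.* (K ℕ.* copiesNeeded K) ℕ.≤ n × 85 ℕ.* K ℕ.≤ n × q ℕ.≤ n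
  threshold≤ q K = summands≤ (suc (K ℕ.* (2 ℕ.* (4 ℕ.* pieceBound) ℕ.+ 2))) (4 ℕ.* (K ℕ.* copiesNeeded K)) (85 ℕ.* K) q

module _ {α γ : ℚ} {q K : ℕ} .{{_ : ℕ.NonZero K}} (α>0 : 0ℚ < α) (α<¼ : α < + 1 / 4) (γ>0 : 0ℚ < γ)
         (qγ≥1 : 1ℚ ≤ ℕ→ℚ q * γ) (K≡14q : K ≡ 14 ℕ.* q)
         {n : ℕ} (H : ThreeGraph n) (dense : Dense α γ n (e H))
         (n-large₁ : K ℕ.* (2 ℕ.* (4 ℕ.* pieceBound) ℕ.+ 2) ℕ.< n) (n-large₂ : 4 ℕ.* (K ℕ.* copiesNeeded K) ℕ.≤ n)
         (n-large₃ : 85 ℕ.* K ℕ.≤ n) (q≤n : q ℕ.≤ n) where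

  Large : Set
  Large = Σ (Tiling H) (λ T → ℕ→ℚ 4 * α * ℕ→ℚ n < ℕ→ℚ (covered T))

  refute : ∀ {m} (C : Copies H m) → ¬ ℕ→ℚ 4 * α * ℕ→ℚ n < ℕ→ℚ (4 ℕ.* m) → ¬ EdgeBound C K
  refute {m} C few bound = dense-contradiction α>0 α<¼ γ>0 qγ≥1 K≡14q {n} {e H} {m} {length (Copies.uncovered C)}
    (ℕ.≤-<-trans ℕ.z≤n n-large₁) q≤n dense (4m+u≤n C) (≮⇒≥ few) n-large₃ bound

  -- Induction in place of a maximum tiling: every round either stops or adds a copy while using up
  -- one unit of `fuel`. Disjoint copies satisfy `4 * m ≤ n`, so the fuel cannot run out.
  grow : ∀ fuel {m} → Copies H m → n ℕ.< m ℕ.+ fuel → Large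
  grow zero {m} C n< = ⊥-elim (ℕ.<⇒≱ n< (ℕ.≤-trans (ℕ.≤-reflexive (ℕ.+-identityʳ m))
    (ℕ.≤-trans (ℕ.m≤n*m m 4) (ℕ.m+n≤o⇒m≤o (4 ℕ.* m) (4m+u≤n C)))))
  grow (suc fuel) {m} C n< = decide (ℕ→ℚ 4 * α * ℕ→ℚ n <? ℕ→ℚ (4 ℕ.* m))
    where
    continue : EdgeBound C K ⊎ More C K → ¬ ℕ→ℚ 4 * α * ℕ→ℚ n < ℕ→ℚ (4 ℕ.* m) → Large
    continue (inj₁ bound) few = ⊥-elim (refute C few bound)
    continue (inj₂ (m′ , m<m′ , C′)) _ = grow fuel C′ (ℕ.≤-trans n<
      (ℕ.≤-trans (ℕ.≤-reflexive (ℕ.+-suc m fuel)) (ℕ.+-monoˡ-≤ fuel m<m′)))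

    decide : Dec (ℕ→ℚ 4 * α * ℕ→ℚ n < ℕ→ℚ (4 ℕ.* m)) → Large
    decide (yes large) = toTiling C , subst (λ k → ℕ→ℚ 4 * α * ℕ→ℚ n < ℕ→ℚ k) (sym (covered-toTiling C)) large
    decide (no few)    = continue (bound-or-more C K n-large₁ n-large₂) few

  no-copies : Copies H 0
  no-copies = record { copy = λ () ; apart = λ {} }

  large-tiling : Large
  large-tiling = grow (suc n) no-copies (ℕ.n<1+n n)

above-threshold : ∀ {α γ : ℚ} q K .{{_ : ℕ.NonZero K}} → 0ℚ < α → α < + 1 / 4 → 0ℚ < γ → 1ℚ ≤ ℕ→ℚ q * γ → K ≡ 14 ℕ.* q →
  (n : ℕ) → n ≥ threshold q K → (H : ThreeGraph n) → Dense α γ n (e H) →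
  Σ (Tiling H) (λ T → ℕ→ℚ 4 * α * ℕ→ℚ n < ℕ→ℚ (covered T))
above-threshold q K α>0 α<¼ γ>0 qγ≥1 K≡14q n n≥ H dense =
  let n₁ , n₂ , n₃ , q≤n = threshold≤ q K n≥
  in large-tiling α>0 α<¼ γ>0 qγ≥1 K≡14q H dense n₁ n₂ n₃ q≤n

theorem1p1 : (α γ : ℚ) → 0ℚ < α → α < + 1 / 4 → 0ℚ < γ → γ < + 1 / 4 →
    Σ ℕ (λ n₀ → (n : ℕ) → n ≥ n₀ → (H : ThreeGraph n) →
    (choose3 (ℕ→ℚ 4 * α * ℕ→ℚ n) ⊔ (choose3 (ℕ→ℚ n) - choose3 (ℕ→ℚ n - α * ℕ→ℚ n)))
    + γ * (ℕ→ℚ n * ℕ→ℚ n * ℕ→ℚ n) ≤ ℕ→ℚ (e H) →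
    Σ (Tiling H) (λ T → ℕ→ℚ 4 * α * ℕ→ℚ n < ℕ→ℚ (covered T)))
theorem1p1 α γ α>0 α<¼ γ>0 _ = threshold (↧ₙ γ) (14 ℕ.* ↧ₙ γ) ,
  above-threshold (↧ₙ γ) (14 ℕ.* ↧ₙ γ) α>0 α<¼ γ>0 (1≤denominator* γ γ>0) refl
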